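{- Let $a,b,c\in\mathbb Z$, $f(i,j)=ai^2+bij+cj^2$, $\Delta=b^2-4ac$ and $\sigma=a+b+c$. For a prime $p>3$ put $$P(p)=\prod_{\substack{0<i<j<p/2\\ p\nmid f(i,j)}}\Big(\frac{f(i,j)}{p}\Big)\qquad (i,j\in\mathbb Z).$$ (i) Consider primes $p>3$ with $p\nmid c\sigma$, and for such $p$ let $k=k(p)$ be the least positive integer with $4c\sigma k\equiv-\Delta\pmod p$. Let $S(p)$ be the least nonnegative residue modulo $16$ of $\sum_{y=1}^{p-1}\big(\frac{y(y+1)(y+k)}{p}\big)$. Then $P$ and $S$ are equivalent as functions of $p$. (ii) If $f(i,j)=(mi+nj)(ui+vj)$ with $m,n,u,v\in\mathbb Z$, then $P(p)$ (for primes $p>3$) is a periodic function of $p$.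
   Context: $\big(\frac{\cdot}{p}\big)$ is the Legendre symbol; the product runs only over pairs of integers with $0<i<j<p/2$ and $p\nmid f(i,j)$ (an empty product is $1$). A function $g$ defined on a set of primes is called periodic if there is $m\in\mathbb Z_{>0}$ such that $g(p_1)=g(p_2)$ whenever $p_1,p_2$ are in its domain and $p_1\equiv p_2\pmod m$. Two functions $g,h$ defined on sets of primes are called equivalent if there is $m\in\mathbb Z_{>0}$ such that for each residue $r$ with $1\le r<m$, $\gcd(r,m)=1$, there is a polynomial $f_r$ of degree one with rational coefficients such that $g(p)=f_r(h(p))$ for every prime $p$ in the common domain of $g$ and $h$ with $p\equiv r\pmod m$. -}

module Defs where

open import Data.Nat as ℕ using (ℕ; zero; suc)
open import Data.Nat.GCD using (gcd)
open import Data.Nat.Primality using (Prime)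
open import Data.Integer as ℤ using (ℤ; +_; -[1+_])
open import Data.Integer.DivMod using (_%ℕ_)
import Data.Integer.Divisibility as ℤd
open import Data.Rational as ℚ using (ℚ)
open import Data.List using (List; []; _∷_; upTo; map; concatMap; filterᵇ; findᵇ; foldr)
open import Data.Bool.ListAction using (any)
open import Data.Maybe using (Maybe; just; nothing)
open import Data.Bool using (Bool; true; false; if_then_else_; not)
open import Data.Product using (Σ; _×_; _,_; ∃; ∃-syntax)
open import Relation.Binary.PropositionalEquality using (_≡_; _≢_)
open import Relation.Nullary using (¬_)

divᵇ : ℕ → ℤ → Bool
divᵇ zero    a = ℤ.∣ a ∣ ℕ.≡ᵇ 0
divᵇ (suc q) a = (a %ℕ suc q) ℕ.≡ᵇ 0

legendre : ℤ → ℕ → ℤ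
legendre a p =
  if divᵇ p a then + 0
  else if any (λ x → divᵇ p ((+ x) ℤ.* (+ x) ℤ.- a)) (upTo p) then + 1
  else -[1+ 0 ]

form : ℤ → ℤ → ℤ → ℤ → ℤ → ℤ
form a b c i j = a ℤ.* i ℤ.* i ℤ.+ b ℤ.* i ℤ.* j ℤ.+ c ℤ.* j ℤ.* j

disc : ℤ → ℤ → ℤ → ℤ
disc a b c = b ℤ.* b ℤ.- (+ 4) ℤ.* a ℤ.* c

sigma : ℤ → ℤ → ℤ → ℤ
sigma a b c = a ℤ.+ b ℤ.+ c

pairs : ℕ → List (ℕ × ℕ)
pairs p = concatMap (λ j → map (λ i → (i , j)) (filterᵇ (λ i → 0 ℕ.<ᵇ i) (upTo j)))
                    (filterᵇ (λ j → 2 ℕ.* j ℕ.<ᵇ p) (upTo p))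

prodℤ : List ℤ → ℤ
prodℤ = foldr ℤ._*_ (+ 1)

sumℤ : List ℤ → ℤ
sumℤ = foldr ℤ._+_ (+ 0)

P : ℤ → ℤ → ℤ → ℕ → ℤ
P a b c p = prodℤ (map (λ ij → legendre (F ij) p)
                       (filterᵇ (λ ij → not (divᵇ p (F ij))) (pairs p)))
  where
  F : ℕ × ℕ → ℤ
  F (i , j) = form a b c (+ i) (+ j)

-- k(p): least positive integer k with 4cσk ≡ -Δ (mod p).
-- (For p prime, p > 3, p ∤ cσ such a k exists and satisfies 1 ≤ k ≤ p,
--  so searching in 1..p finds the least one; the fallback 0 never occurs
--  on the relevant domain.)
kOf : ℤ → ℤ → ℤ → ℕ → ℕ
kOf a b c p with findᵇ (λ k → divᵇ p ((+ 4) ℤ.* c ℤ.* sigma a b c ℤ.* (+ k) ℤ.+ disc a b c))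
                       (map suc (upTo p))
... | just k  = k
... | nothing = 0

S : ℤ → ℤ → ℤ → ℕ → ℕ
S a b c p = sumℤ (map (λ y → legendre ((+ y) ℤ.* (+ y ℤ.+ + 1) ℤ.* (+ y ℤ.+ + kOf a b c p)) p)
                      (map suc (upTo (p ℕ.∸ 1)))) %ℕ 16

DomP : ℕ → Set
DomP p = Prime p × 3 ℕ.< p

-- domain of S : primes p > 3 with p ∤ cσ  (this is also the common domain of P and S)
DomS : ℤ → ℤ → ℤ → ℕ → Set
DomS a b c p = Prime p × 3 ℕ.< p × ¬ ((+ p) ℤd.∣ (c ℤ.* sigma a b c))

toℚ : ℤ → ℚ
toℚ z = z ℚ./ 1

Periodic : (ℕ → Set) → (ℕ → ℤ) → Set
Periodic D g = ∃[ m ] (0 ℕ.< m × (∀ p₁ p₂ → D p₁ → D p₂ →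
                  (+ m) ℤd.∣ (+ p₁ ℤ.- + p₂) → g p₁ ≡ g p₂))

Equivalent : (ℕ → Set) → (ℕ → ℤ) → (ℕ → ℤ) → Set
Equivalent D g h = ∃[ m ] (0 ℕ.< m × (∀ r → r ℕ.< m → gcd r m ≡ 1 →
  ∃[ α ] ∃[ β ] (α ≢ ℚ.0ℚ × (∀ p → D p → (+ m) ℤd.∣ (+ p ℤ.- + r) →
     toℚ (g p) ≡ α ℚ.* toℚ (h p) ℚ.+ β))))

{-# OPTIONS --safe #-}
-- Let p = 2 n + 1 and H = {1, …, n}.  With v = (j - i) / i the factor at (i , j) is χ (g v), where
-- g v = f (1 , 1 + v) = c v² + (b + 2 c) v + σ, and v occurs once for each i ∈ H with v i and (1 + v) i
-- in H modulo p.  The parity of the number of these i is read off Gauss's lemma for v, because absolutely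
-- least residues with x + y + z ≡ 0 have |x| + |y| + |z| odd exactly when they lie on the same side:
-- the resulting sign is κ χ (v), with κ depending on n only.  So P is the product of χ (g v) over the v with
-- χ (v) = - κ, which modulo 8 is a character sum.
--
-- If g splits into rational linear factors, that sum is additive in the factors modulo 8 and consists of
-- Legendre symbols of fixed integers, which are periodic in p.  In general it contains the sum of χ (v g v).
-- With u = c v + σ / v that becomes the sum of χ (A + u) χ (u² - 4 c σ), A = b + 2 c, and pairing u with - u
-- compares it modulo 8 with the sum of χ (U (U - 4 c σ) (A² - U)) over U = u² modulo 16, which is the sum S
-- since A² - 4 c σ is the discriminant.
module Submission where

open import Defs
open import Data.Nat using (ℕ)
open import Data.Integer using (ℤ; +_; _+_; _*_)
open import Data.Product using (_×_)
open import Relation.Binary.PropositionalEquality using (_≡_)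

open import Algebra.Bundles using (CommutativeMonoid)
open import Data.Bool.Base using (Bool; true; false; if_then_else_; _∧_; not; T)
open import Data.Bool.ListAction using (any)
open import Data.Bool.Properties using (T-≡; ¬-not; ∧-comm; ∧-zeroʳ)
open import Data.Empty using (⊥; ⊥-elim)
open import Data.Fin.Base as Fin using (Fin; toℕ; fromℕ<; opposite; _↑ˡ_; _↑ʳ_)
import Data.Fin.Permutation as Perm
import Data.Fin.Properties as Finₚ
open import Data.Integer.Base as ℤ using (-[1+_]; _-_; -_)
import Data.Integer.Divisibility as ℤd
open import Data.Integer.Divisibility.Signed as Signed using (_∣_; divides; ∣ᵤ⇒∣; ∣⇒∣ᵤ; _∣?_)
open import Data.Integer.DivMod using (_%ℕ_; _/ℕ_; n%ℕd<d; a≡a%ℕn+[a/ℕn]*n)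
import Data.Integer.Properties as ℤₚ
open import Data.Integer.Tactic.RingSolver using (solve-∀)
open import Data.List.Base using (List; []; _∷_; upTo; applyUpTo; map; concatMap; filterᵇ; findᵇ; _++_)
open import Data.List.Membership.Propositional using (_∈_)
open import Data.List.Membership.Propositional.Properties using (∈-upTo⁺; ∈-map⁺)
import Data.List.Properties as Listₚ
open import Data.List.Relation.Unary.Any using (here; there)
open import Data.Maybe.Base using (just; nothing)
open import Data.Nat.Base as ℕ using (zero; suc; NonZero; z≤n; s≤s)
open import Data.Nat.Coprimality using (prime⇒coprime; coprime-Bézout)
import Data.Nat.Divisibility as ℕ∣
import Data.Nat.DivMod as ℕD
open import Data.Nat.GCD using (gcd; gcd-greatest; module Bézout)
open import Data.Nat.Primality using (Prime; euclidsLemma; prime⇒irreducible; prime⇒nonTrivial)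
import Data.Nat.Properties as ℕₚ
open import Data.Product using (_,_; proj₁; proj₂; ∃-syntax)
open import Data.Rational.Base as ℚ using (ℚ)
import Data.Rational.Properties as ℚₚ
open import Data.Sum using (_⊎_; inj₁; inj₂; [_,_]′)
open import Data.Unit.Base using (tt)
open import Data.Vec.Base using (Vec; []; _∷_)
open import Function.Base using (_∘_)
open import Function.Bundles using (Equivalence)
open import Level using (0ℓ)
open import Relation.Binary.PropositionalEquality
  using (_≢_; refl; sym; trans; cong; cong₂; subst; subst₂; module ≡-Reasoning)
open import Relation.Nullary using (¬_; yes; no; Dec)
open import Relation.Nullary.Decidable using (map′; toWitness; _×-dec_; ¬?)

open import Algebra.Properties.CommutativeMonoid.Sum ℤₚ.*-1-commutativeMonoid
  using () renaming (sum to prod; ∑-comm to prod-comm; ∑-distrib-+ to prod-distrib-*; sum-cong-≗ to prod-cong-≗)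
open import Algebra.Properties.Semiring.Sum ℤₚ.+-*-semiring
  using (sum; ∑-comm; *-distribˡ-sum; ∑-distrib-+; sum-cong-≗)

-- A product of signs becomes a sum modulo 4, since (s - 1) (t - 1) is 0 or 4. Doubling clears the
-- 1/2 in the indicator (1 - κ χ (v)) / 2, so 2 P is known modulo 8. Symmetrizing in u produces the
-- sum of χ (A + u) χ (u² - 4 c σ) twice, while pairs of equal multiples of 8 give multiples of 16;
-- a second doubling therefore ends in 4 P ≡ X + ε S modulo 16 with a sign ε. This is where 16 comes
-- from: on a residue class of p the two values of P belong to two values of S that differ by 8, and
-- a line passes through two points. The delicate points are the zeros. Those of g contribute `ρ`
-- and those of u² - 4 c σ contribute `E`; each is evaluated through a further sign, but E + 2 ρ
-- modulo 16 is free of it. The constant k arises from U = 4 c σ (y + 1), which carries the zeros 4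
-- c σ, 0, A² to 0, -1, -k. If Δ = 0, then (4 c)² g is a product of linear factors and S ≡ -1, so
-- the additive argument covers this case too. Primes dividing a relevant coefficient are put into
-- the modulus: in (i) coprimality excludes them, in (ii) such a prime is alone in its class.

-- Congruences and complete residue systems

module Congruence (k : ℤ) where

  infix 4 _≋_
  record _≋_ (x y : ℤ) : Set where
    constructor mod
    field difference : k ∣ x - y
  open _≋_ public

  -- Reduces a congruence to a polynomial identity for the ring solver: the difference is exhibited
  -- as a multiple of one already known to be divisible. `by₂` does the same with two known
  -- differences.
  by : ∀ {x y a b} → a ≋ b → (c : ℤ) → x - y ≡ c * (a - b) → x ≋ y
  by {x} {y} {a} {b} (mod (divides q eq)) c h = mod (divides (c * q) (begin
    x - y        ≡⟨ h ⟩
    c * (a - b)  ≡⟨ cong (c *_) eq ⟩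
    c * (q * k)  ≡⟨ ℤₚ.*-assoc c q k ⟨
    c * q * k    ∎))
    where open ≡-Reasoning

  ≋-refl : ∀ {x} → x ≋ x
  ≋-refl {x} = mod (divides (+ 0) (ℤₚ.+-inverseʳ x))

  ≋-reflexive : ∀ {x y} → x ≡ y → x ≋ y
  ≋-reflexive refl = ≋-refl

  ≋-sym : ∀ {x y} → x ≋ y → y ≋ x
  ≋-sym {x} {y} h = by h (- + 1) (lemma x y)
    where
    lemma : ∀ x y → y - x ≡ - + 1 * (x - y)
    lemma = solve-∀

  by₂ : ∀ {x y a b a′ b′} → a ≋ b → a′ ≋ b′ → (c c′ : ℤ) →
        x - y ≡ c * (a - b) + c′ * (a′ - b′) → x ≋ y
  by₂ {x} {y} {a} {b} {a′} {b′} (mod (divides q eq)) (mod (divides q′ eq′)) c c′ h =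
    mod (divides (c * q + c′ * q′) (begin
      x - y                             ≡⟨ h ⟩
      c * (a - b) + c′ * (a′ - b′)      ≡⟨ cong₂ (λ s t → c * s + c′ * t) eq eq′ ⟩
      c * (q * k) + c′ * (q′ * k)       ≡⟨ lemma c c′ q q′ k ⟩
      (c * q + c′ * q′) * k             ∎))
    where
    open ≡-Reasoning
    lemma : ∀ c c′ q q′ k → c * (q * k) + c′ * (q′ * k) ≡ (c * q + c′ * q′) * k
    lemma = solve-∀

  ≋-trans : ∀ {x y z} → x ≋ y → y ≋ z → x ≋ z
  ≋-trans {x} {y} {z} h h′ = by₂ h h′ (+ 1) (+ 1) (lemma x y z)
    where
    lemma : ∀ x y z → x - z ≡ + 1 * (x - y) + + 1 * (y - z)
    lemma = solve-∀

  +-cong : ∀ {x y u v} → x ≋ y → u ≋ v → x + u ≋ y + v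
  +-cong {x} {y} {u} {v} h h′ = by₂ h h′ (+ 1) (+ 1) (lemma x y u v)
    where
    lemma : ∀ x y u v → (x + u) - (y + v) ≡ + 1 * (x - y) + + 1 * (u - v)
    lemma = solve-∀

  *-cong : ∀ {x y u v} → x ≋ y → u ≋ v → x * u ≋ y * v
  *-cong {x} {y} {u} {v} h h′ = by₂ h h′ u y (lemma x y u v)
    where
    lemma : ∀ x y u v → x * u - y * v ≡ u * (x - y) + y * (u - v)
    lemma = solve-∀

  neg-cong : ∀ {x y} → x ≋ y → - x ≋ - y
  neg-cong {x} {y} h = by h (- + 1) (lemma x y)
    where
    lemma : ∀ x y → - x - - y ≡ - + 1 * (x - y)
    lemma = solve-∀

  +-congˡ : ∀ c {x y} → x ≋ y → c + x ≋ c + y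
  +-congˡ c = +-cong (≋-refl {c})

  +-congʳ : ∀ c {x y} → x ≋ y → x + c ≋ y + c
  +-congʳ c e = +-cong e (≋-refl {c})

  *-congˡ : ∀ c {x y} → x ≋ y → c * x ≋ c * y
  *-congˡ c = *-cong (≋-refl {c})

  *-congʳ : ∀ c {x y} → x ≋ y → x * c ≋ y * c
  *-congʳ c e = *-cong e (≋-refl {c})

  ≋⇒0 : ∀ {x y} → x ≋ y → x - y ≋ + 0
  ≋⇒0 {x} {y} h = by h (+ 1) (lemma (x - y))
    where
    lemma : ∀ z → z - + 0 ≡ + 1 * z
    lemma = solve-∀

  0⇒≋ : ∀ {x y} → x - y ≋ + 0 → x ≋ y
  0⇒≋ {x} {y} h = by h (+ 1) (lemma (x - y))
    where
    lemma : ∀ z → z ≡ + 1 * (z - + 0)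
    lemma = solve-∀

  ∣⇒≋0 : ∀ {x} → k ∣ x → x ≋ + 0
  ∣⇒≋0 {x} h = mod (subst (k ∣_) (sym (ℤₚ.+-identityʳ x)) h)

  ≋0⇒∣ : ∀ {x} → x ≋ + 0 → k ∣ x
  ≋0⇒∣ {x} (mod h) = subst (k ∣_) (ℤₚ.+-identityʳ x) h

  multiple≋0 : ∀ q → q * k ≋ + 0
  multiple≋0 q = ∣⇒≋0 (divides q refl)

  Periodic₁ : ∀ {A : Set} → (ℤ → A) → Set
  Periodic₁ F = ∀ {x y} → x ≋ y → F x ≡ F y

module CongruentSums (k : ℤ) where
  open Congruence k

  sum-≋0 : ∀ {m} (f : Fin m → ℤ) → (∀ i → f i ≋ + 0) → sum f ≋ + 0
  sum-≋0 {zero}  f e = ≋-refl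
  sum-≋0 {suc m} f e = +-cong (e Fin.zero) (sum-≋0 (f ∘ Fin.suc) (e ∘ Fin.suc))

module Range (M : CommutativeMonoid 0ℓ 0ℓ) where
  open CommutativeMonoid M
    renaming (refl to ≈-refl; sym to ≈-sym; trans to ≈-trans)
  open import Algebra.Properties.CommutativeMonoid.Sum M
    renaming (sum to fold; ∑-distrib-+ to fold-distrib)

  fold-++ : ∀ m n (f : Fin (m ℕ.+ n) → Carrier) →
            fold f ≈ fold (λ i → f (i ↑ˡ n)) ∙ fold (λ i → f (m ↑ʳ i))
  fold-++ zero    n f = ≈-sym (identityˡ _)
  fold-++ (suc m) n f = ≈-trans (∙-congˡ (fold-++ m n (f ∘ Fin.suc))) (≈-sym (assoc _ _ _))

module Residues (p : ℕ) .{{_ : NonZero p}} where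
  open Congruence (+ p) public

  rep : Fin p → ℤ
  rep i = + toℕ i

  red : ℤ → Fin p
  red x = fromℕ< (n%ℕd<d x p)

  %-≋ : ∀ x → + (x %ℕ p) ≋ x
  %-≋ x = mod (divides (- (x /ℕ p)) (begin
    + (x %ℕ p) - x                                        ≡⟨ cong (λ z → + (x %ℕ p) - z) (a≡a%ℕn+[a/ℕn]*n x p) ⟩
    + (x %ℕ p) - (+ (x %ℕ p) + (x /ℕ p) * + p)            ≡⟨ lemma (+ (x %ℕ p)) (x /ℕ p) (+ p) ⟩
    - (x /ℕ p) * + p                                      ∎))
    where
    open ≡-Reasoning
    lemma : ∀ r q P → r - (r + q * P) ≡ - q * P
    lemma = solve-∀

  rep-red : ∀ x → rep (red x) ≋ x
  rep-red x = subst (λ k → + k ≋ x) (sym (Finₚ.toℕ-fromℕ< (n%ℕd<d x p))) (%-≋ x)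

  ≋⇒≡ : ∀ {a b} → a ℕ.< p → b ℕ.< p → + a ≋ + b → a ≡ b
  ≋⇒≡ {a} {b} a<p b<p (mod d) with ℤ.∣ + a - + b ∣ in eq | ∣⇒∣ᵤ d
  ... | zero  | _ = ℤₚ.+-injective (ℤₚ.i-j≡0⇒i≡j (+ a) (+ b) (ℤₚ.∣i∣≡0⇒i≡0 eq))
  ... | suc k | d′ = ⊥-elim (ℕₚ.<-irrefl refl (begin-strict
      p                      ≤⟨ ℕ∣.∣⇒≤ d′ ⟩
      suc k                  ≡⟨ eq ⟨
      ℤ.∣ + a - + b ∣         ≡⟨ cong ℤ.∣_∣ (ℤₚ.m-n≡m⊖n a b) ⟩
      ℤ.∣ a ℤ.⊖ b ∣           ≤⟨ ℤₚ.∣m⊝n∣≤m⊔n a b ⟩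
      a ℕ.⊔ b                <⟨ ℕₚ.⊔-pres-<m a<p b<p ⟩
      p                      ∎))
    where open ℕₚ.≤-Reasoning

  red-cong : ∀ {x y} → x ≋ y → red x ≡ red y
  red-cong {x} {y} h = Finₚ.toℕ-injective (≋⇒≡ (Finₚ.toℕ<n (red x)) (Finₚ.toℕ<n (red y))
    (≋-trans (rep-red x) (≋-trans h (≋-sym (rep-red y)))))

  red-rep : ∀ i → red (rep i) ≡ i
  red-rep i = Finₚ.toℕ-injective (≋⇒≡ (Finₚ.toℕ<n (red (rep i))) (Finₚ.toℕ<n i) (rep-red (rep i)))

  %-cong : ∀ {x y} → x ≋ y → x %ℕ p ≡ y %ℕ p
  %-cong {x} {y} h = ≋⇒≡ (n%ℕd<d x p) (n%ℕd<d y p)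
    (≋-trans (%-≋ x) (≋-trans h (≋-sym (%-≋ y))))

  module FullRange (M : CommutativeMonoid 0ℓ 0ℓ) where
    open CommutativeMonoid M
      renaming (refl to ≈-refl; sym to ≈-sym; trans to ≈-trans)
    open import Algebra.Properties.CommutativeMonoid.Sum M using (sum-permute; sum-cong-≋)
    open import Algebra.Properties.CommutativeMonoid.Sum M using () renaming (sum to fold)

    -- Change of variable over all residues. It is stated for a commutative monoid because character
    -- sums and the product `P` are both reindexed, and on integers because `π` and `ρ` need only be
    -- inverse modulo `p`.
    fold-permute : (F : ℤ → Carrier) → (∀ {x y} → x ≋ y → F x ≈ F y) →
      (π ρ : ℤ → ℤ) → (∀ {x y} → x ≋ y → π x ≋ π y) → (∀ {x y} → x ≋ y → ρ x ≋ ρ y) →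
      (∀ x → π (ρ x) ≋ x) → (∀ x → ρ (π x) ≋ x) →
      fold (λ i → F (π (rep i))) ≈ fold (λ i → F (rep i))
    fold-permute F F-cong π ρ π-cong ρ-cong πρ ρπ = ≈-sym (≈-trans
      (sum-permute (F ∘ rep) perm)
      (sum-cong-≋ (λ i → F-cong (rep-red (π (rep i))))))
      where
      inv : (f g : ℤ → ℤ) → (∀ {x y} → x ≋ y → f x ≋ f y) → (∀ x → f (g x) ≋ x) →
            ∀ i → red (f (rep (red (g (rep i))))) ≡ i
      inv f g f-cong fg i = trans
        (red-cong (≋-trans (f-cong (rep-red (g (rep i)))) (fg (rep i)))) (red-rep i)
      perm : Perm.Permutation p p
      perm = Perm.permutation (red ∘ π ∘ rep) (red ∘ ρ ∘ rep) (inv π ρ π-cong πρ) (inv ρ π ρ-cong ρπ)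

-- Signs

sg : ℕ → ℤ
sg zero    = + 1
sg (suc k) = - sg k

sg-+ : ∀ a b → sg (a ℕ.+ b) ≡ sg a * sg b
sg-+ zero    b = sym (ℤₚ.*-identityˡ (sg b))
sg-+ (suc a) b = trans (cong -_ (sg-+ a b)) (ℤₚ.neg-distribˡ-* (sg a) (sg b))

data IsSign : ℤ → Set where
  pos : IsSign (+ 1)
  neg : IsSign (- + 1)

sg-sign : ∀ k → IsSign (sg k)
sg-sign zero = pos
sg-sign (suc k) with sg k | sg-sign k
... | _ | pos = neg
... | _ | neg = pos

sign-square : ∀ {s} → IsSign s → s * s ≡ + 1
sign-square pos = refl
sign-square neg = refl

sign-* : ∀ {s t} → IsSign s → IsSign t → IsSign (s * t)
sign-* pos pos = pos
sign-* pos neg = neg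
sign-* neg pos = neg
sign-* neg neg = pos

prod-sign : ∀ {n} (f : Fin n → ℤ) → (∀ i → IsSign (f i)) → IsSign (prod f)
prod-sign {zero}  f h = pos
prod-sign {suc n} f h = sign-* (h Fin.zero) (prod-sign (f ∘ Fin.suc) (h ∘ Fin.suc))

-- Half systems modulo an odd prime

T⇒true : ∀ {b} → T b → b ≡ true
T⇒true {true} _ = refl

<ᵇ-true : ∀ {a b} → a ℕ.< b → (a ℕ.<ᵇ b) ≡ true
<ᵇ-true h = T⇒true (ℕₚ.<⇒<ᵇ h)

<ᵇ-false : ∀ {a b} → b ℕ.≤ a → (a ℕ.<ᵇ b) ≡ false
<ᵇ-false {a} {b} h = ¬-not (λ e → ℕₚ.<⇒≱ (ℕₚ.<ᵇ⇒< a b (Equivalence.from T-≡ e)) h)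

-- Writing the prime as `2 n + 1` makes `Fin n` the index set of the half system; `1 < n` is the
-- condition `p > 3`.
module OddPrime (n : ℕ) (1<n : 1 ℕ.< n) (prime : Prime (suc (n ℕ.+ n))) where

  p : ℕ
  p = suc (n ℕ.+ n)

  open Residues p public

  zero? : ∀ x → Dec (x ≋ + 0)
  zero? x = map′ ∣⇒≋0 ≋0⇒∣ (+ p ∣? x)

  euclid : ∀ x y → x * y ≋ + 0 → x ≋ + 0 ⊎ y ≋ + 0
  euclid x y h with euclidsLemma ℤ.∣ x ∣ ℤ.∣ y ∣ prime
                      (subst (p ℕ∣.∣_) (ℤₚ.abs-* x y) (∣⇒∣ᵤ (≋0⇒∣ h)))
  ... | inj₁ d = inj₁ (∣⇒≋0 (∣ᵤ⇒∣ d))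
  ... | inj₂ d = inj₂ (∣⇒≋0 (∣ᵤ⇒∣ d))

  *-≢0 : ∀ {x y} → ¬ x ≋ + 0 → ¬ y ≋ + 0 → ¬ x * y ≋ + 0
  *-≢0 {x} {y} hx hy h = [ hx , hy ]′ (euclid x y h)

  *-cancelˡ : ∀ x {y z} → ¬ x ≋ + 0 → x * y ≋ x * z → y ≋ z
  *-cancelˡ x {y} {z} hx h = [ (λ e → ⊥-elim (hx e)) , 0⇒≋ ]′
    (euclid x (y - z) (by h (+ 1) (lemma x y z)))
    where
    lemma : ∀ x y z → x * (y - z) - + 0 ≡ + 1 * (x * y - x * z)
    lemma = solve-∀

  small≢0 : ∀ k → suc k ℕ.< p → ¬ + suc k ≋ + 0
  small≢0 k k<p h with ≋⇒≡ k<p (s≤s z≤n) h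
  ... | ()

  2<p : 2 ℕ.< p
  2<p = s≤s (ℕₚ.≤-trans 1<n (ℕₚ.m≤m+n n n))

  4<p : 4 ℕ.< p
  4<p = s≤s (ℕₚ.+-mono-≤ 1<n 1<n)

  1≢0 : ¬ + 1 ≋ + 0
  1≢0 = small≢0 0 (ℕₚ.<-trans (ℕₚ.n<1+n 1) 2<p)

  2≢0 : ¬ + 2 ≋ + 0
  2≢0 = small≢0 1 2<p

  4≢0 : ¬ + 4 ≋ + 0
  4≢0 = small≢0 3 4<p

  neg-≢0 : ∀ {x} → ¬ x ≋ + 0 → ¬ - x ≋ + 0
  neg-≢0 {x} hx h = hx (by h (- + 1) (lemma x))
    where
    lemma : ∀ x → x - + 0 ≡ - + 1 * (- x - + 0)
    lemma = solve-∀

  *-zeroˡ : ∀ {x} y → x ≋ + 0 → x * y ≋ + 0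
  *-zeroˡ {x} y h = by h y (lemma x y)
    where
    lemma : ∀ x y → x * y - + 0 ≡ y * (x - + 0)
    lemma = solve-∀

  *-zeroʳ : ∀ x {y} → y ≋ + 0 → x * y ≋ + 0
  *-zeroʳ x {y} h = by h x (lemma x y)
    where
    lemma : ∀ x y → x * y - + 0 ≡ x * (y - + 0)
    lemma = solve-∀

  sign-injective : ∀ {s t} → IsSign s → IsSign t → s ≋ t → s ≡ t
  sign-injective pos pos h = refl
  sign-injective pos neg h = ⊥-elim (2≢0 (≋⇒0 h))
  sign-injective neg pos h = ⊥-elim (neg-≢0 2≢0 (≋⇒0 h))
  sign-injective neg neg h = refl

  private
    %ℕ-nonzero : ∀ x → ¬ x ≋ + 0 → NonZero (x %ℕ p)
    %ℕ-nonzero x hx with x %ℕ p | %-≋ x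
    ... | zero  | h = ⊥-elim (hx (≋-sym h))
    ... | suc _ | _ = _

  inverse : ∀ x → ¬ x ≋ + 0 → ∃[ y ] x * y ≋ + 1
  inverse x hx = bezout (coprime-Bézout (prime⇒coprime prime {{%ℕ-nonzero x hx}} (n%ℕd<d x p)))
    where
    r = x %ℕ p
    bezout : Bézout.Identity 1 p r → ∃[ y ] x * y ≋ + 1
    bezout (Bézout.+- a b eq) = - + b , ≋-trans
      (by₂ (%-≋ x) (multiple≋0 (+ a)) (+ b) (- + 1) (lemma x (+ r) (+ a) (+ b) (+ p) eq′)) ≋-refl
      where
      eq′ : + 1 + + b * + r ≡ + a * + p
      eq′ = trans (cong (λ z → + 1 + z) (sym (ℤₚ.pos-* b r))) (trans (cong +_ eq) (ℤₚ.pos-* a p))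
      lemma : ∀ x r a b p → + 1 + b * r ≡ a * p →
              x * - b - + 1 ≡ b * (r - x) + - + 1 * (a * p - + 0)
      lemma x r a b p e = trans (ring x r b) (cong (λ z → b * (r - x) + - + 1 * (z - + 0)) e)
        where
        ring : ∀ x r b → x * - b - + 1 ≡ b * (r - x) + - + 1 * (+ 1 + b * r - + 0)
        ring = solve-∀
    bezout (Bézout.-+ a b eq) = + b , by₂ (%-≋ x) (multiple≋0 (+ a)) (- + b) (+ 1)
                                       (lemma x (+ r) (+ a) (+ b) (+ p) eq′)
      where
      eq′ : + 1 + + a * + p ≡ + b * + r
      eq′ = trans (cong (λ z → + 1 + z) (sym (ℤₚ.pos-* a p))) (trans (cong +_ eq) (ℤₚ.pos-* b r))
      lemma : ∀ x r a b p → + 1 + a * p ≡ b * r →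
              x * b - + 1 ≡ - b * (r - x) + + 1 * (a * p - + 0)
      lemma x r a b p e = trans (ring₁ x r b) (trans (cong (λ z → - b * (r - x) + z - + 1) (sym e)) (ring₂ x r b (a * p)))
        where
        ring₁ : ∀ x r b → x * b - + 1 ≡ - b * (r - x) + b * r - + 1
        ring₁ = solve-∀
        ring₂ : ∀ x r b c → - b * (r - x) + (+ 1 + c) - + 1 ≡ - b * (r - x) + + 1 * (c - + 0)
        ring₂ = solve-∀

  -- With the value 0 at multiples of `p` inversion is an involution of all residues, so it is a
  -- legitimate substitution in sums over the complete system.
  inv : ℤ → ℤ
  inv x with zero? x
  ... | yes _ = + 0
  ... | no hx = proj₁ (inverse x hx)

  inv-zero : ∀ {x} → x ≋ + 0 → inv x ≡ + 0
  inv-zero {x} h with zero? x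
  ... | yes _ = refl
  ... | no hx = ⊥-elim (hx h)

  inv-* : ∀ {x} → ¬ x ≋ + 0 → x * inv x ≋ + 1
  inv-* {x} hx with zero? x
  ... | yes h = ⊥-elim (hx h)
  ... | no hx′ = proj₂ (inverse x hx′)

  inv-≢0 : ∀ {x} → ¬ x ≋ + 0 → ¬ inv x ≋ + 0
  inv-≢0 {x} hx h = 1≢0 (≋-trans (≋-sym (inv-* hx)) (*-zeroʳ x h))

  inv-unique : ∀ {x y} → ¬ x ≋ + 0 → x * y ≋ + 1 → inv x ≋ y
  inv-unique {x} hx h = *-cancelˡ x hx (≋-trans (inv-* hx) (≋-sym h))

  inv-cong : ∀ {x y} → x ≋ y → inv x ≋ inv y
  inv-cong {x} {y} h with zero? y
  ... | yes hy = ≋-reflexive (inv-zero (≋-trans h hy))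
  ... | no hy  = inv-unique (λ hx → hy (≋-trans (≋-sym h) hx))
                   (≋-trans (*-congʳ _ h) (proj₂ (inverse y hy)))

  inv-inv : ∀ x → inv (inv x) ≋ x
  inv-inv x with zero? x
  ... | yes h = ≋-trans (≋-reflexive (inv-zero ≋-refl)) (≋-sym h)
  ... | no hx = inv-unique y≢0 (≋-trans (≋-reflexive (ℤₚ.*-comm y x)) (proj₂ (inverse x hx)))
    where
    y = proj₁ (inverse x hx)
    y≢0 : ¬ y ≋ + 0
    y≢0 h = 1≢0 (≋-trans (≋-sym (proj₂ (inverse x hx))) (*-zeroʳ x h))

  divᵇ-true : ∀ {x} → x ≋ + 0 → divᵇ p x ≡ true
  divᵇ-true {x} h = cong (ℕ._≡ᵇ 0) (%-cong h)

  divᵇ-false : ∀ {x} → ¬ x ≋ + 0 → divᵇ p x ≡ false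
  divᵇ-false {x} hx with x %ℕ p | %ℕ-nonzero x hx
  ... | suc _ | _ = refl

  h : Fin n → ℤ
  h j = + suc (toℕ j)

  h<p : (j : Fin n) → suc (toℕ j) ℕ.< p
  h<p j = s≤s (ℕₚ.≤-trans (Finₚ.toℕ<n j) (ℕₚ.m≤m+n n n))

  h≢0 : ∀ j → ¬ h j ≋ + 0
  h≢0 j = small≢0 (toℕ j) (h<p j)

  infix 4 _≋±_
  _≋±_ : ℤ → ℤ → Set
  x ≋± y = x ≋ y ⊎ x ≋ - y

  ±-sym : ∀ {x y} → x ≋± y → y ≋± x
  ±-sym (inj₁ e) = inj₁ (≋-sym e)
  ±-sym {x} {y} (inj₂ e) = inj₂ (by e (+ 1) (lemma x y))
    where
    lemma : ∀ x y → y - - x ≡ + 1 * (x - - y)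
    lemma = solve-∀

  ±-trans : ∀ {x y z} → x ≋± y → y ≋± z → x ≋± z
  ±-trans (inj₁ e) (inj₁ e′) = inj₁ (≋-trans e e′)
  ±-trans (inj₁ e) (inj₂ e′) = inj₂ (≋-trans e e′)
  ±-trans (inj₂ e) (inj₁ e′) = inj₂ (≋-trans e (neg-cong e′))
  ±-trans {z = z} (inj₂ e) (inj₂ e′) =
    inj₁ (≋-trans e (≋-trans (neg-cong e′) (≋-reflexive (ℤₚ.neg-involutive z))))

  ±-* : ∀ d {x y} → x ≋± y → d * x ≋± d * y
  ±-* d (inj₁ e) = inj₁ (*-congˡ d e)
  ±-* d {x} {y} (inj₂ e) = inj₂ (≋-trans (*-congˡ d e) (≋-reflexive (sym (ℤₚ.neg-distribʳ-* d y))))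

  -- Two elements of the half system are at most `n`, so their sum lies strictly between 0 and `p`
  -- and the case of opposite signs cannot occur.
  h-injective : ∀ i j → h i ≋± h j → i ≡ j
  h-injective i j (inj₁ e) = Finₚ.toℕ-injective (ℕₚ.suc-injective (≋⇒≡ (h<p i) (h<p j) e))
  h-injective i j (inj₂ e) = ⊥-elim (small≢0 (toℕ i ℕ.+ suc (toℕ j))
      (s≤s (ℕₚ.+-mono-≤ (Finₚ.toℕ<n i) (Finₚ.toℕ<n j)))
      (by e (+ 1) (lemma (h i) (h j))))
    where
    lemma : ∀ x y → x + y - + 0 ≡ + 1 * (x - - y)
    lemma = solve-∀

  data Side (x : ℤ) : Set where
    plus  : ∀ j → x ≋ h j → Side x
    minus : ∀ j → x ≋ - h j → Side x

  complement : ∀ a b → a ℕ.+ b ≡ p → + a ≋ - + b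
  complement a b eq = ≋-trans (≋-reflexive (lemma (+ a) (+ b)))
    (≋-trans (+-congʳ (- + b) {+ a + + b} {+ 0} (≋-trans (≋-reflexive (trans (cong +_ eq) (sym (ℤₚ.*-identityˡ (+ p))))) (multiple≋0 (+ 1))))
      (≋-reflexive (ℤₚ.+-identityˡ (- + b))))
    where
    lemma : ∀ a b → a ≡ (a + b) - b
    lemma = solve-∀

  side : ∀ x → ¬ x ≋ + 0 → Side x
  side x hx with x %ℕ p | %-≋ x | n%ℕd<d x p
  ... | zero  | e | _ = ⊥-elim (hx (≋-sym e))
  ... | suc r | e | s≤s r<2n with r ℕₚ.<? n
  ...   | yes r<n = plus (fromℕ< r<n) (≋-trans (≋-sym e)
                      (≋-reflexive (cong (+_ ∘ suc) (sym (Finₚ.toℕ-fromℕ< r<n)))))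
  ...   | no r≮n = minus (fromℕ< m<n) (≋-trans (≋-sym e) (≋-trans (complement (suc r) (suc m) eq)
                      (≋-reflexive (cong (λ k → - + suc k) (sym (Finₚ.toℕ-fromℕ< m<n))))))
    where
    m = (n ℕ.+ n) ℕ.∸ suc r
    eq : suc r ℕ.+ suc m ≡ p
    eq = trans (ℕₚ.+-suc (suc r) m) (cong suc (ℕₚ.m+[n∸m]≡n r<2n))
    m<n : m ℕ.< n
    m<n = ℕₚ.+-cancelˡ-< (suc r) m n (ℕₚ.<-≤-trans
            (subst (ℕ._< p) (sym (ℕₚ.m+[n∸m]≡n r<2n)) (ℕₚ.n<1+n (n ℕ.+ n)))
            (s≤s (ℕₚ.+-monoˡ-≤ n (ℕₚ.≮⇒≥ r≮n))))

  half : ℕ → Bool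
  half r = (0 ℕ.<ᵇ r) ∧ (2 ℕ.* r ℕ.<ᵇ p)

  inH : ℤ → Bool
  inH x = half (x %ℕ p)

  -- `s` and `mag` are the sign and the absolute value of the absolutely least residue. At multiples
  -- of `p`, which are not in the half system, they take the conventional values -1 and `p`.
  s : ℤ → ℤ
  s x = if inH x then + 1 else - + 1

  mag : ℤ → ℕ
  mag x = if inH x then x %ℕ p else p ℕ.∸ x %ℕ p

  %-small : ∀ {x r} → r ℕ.< p → x ≋ + r → x %ℕ p ≡ r
  %-small r<p e = trans (%-cong e) (ℕD.m<n⇒m%n≡m r<p)

  half-true : ∀ {r} → r ℕ.< n → half (suc r) ≡ true
  half-true {r} r<n = <ᵇ-true (s≤s (ℕₚ.+-mono-≤ r<n (ℕₚ.≤-trans (ℕₚ.≤-reflexive (ℕₚ.+-identityʳ (suc r))) r<n)))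

  half-false : ∀ {r} → n ℕ.< r → half r ≡ false
  half-false {suc r} (s≤s n≤r) = <ᵇ-false (s≤s (ℕₚ.+-mono-≤ n≤r (ℕₚ.≤-trans n≤r (ℕₚ.≤-trans (ℕₚ.n≤1+n r)
    (ℕₚ.≤-reflexive (sym (ℕₚ.+-identityʳ (suc r))))))))

  private
    inH-plus% : ∀ {x} j → x ≋ h j → x %ℕ p ≡ suc (toℕ j)
    inH-plus% j e = %-small (h<p j) e

    inH-minus% : ∀ {x} j → x ≋ - h j → x %ℕ p ≡ p ℕ.∸ suc (toℕ j)
    inH-minus% {x} j e = %-small (s≤s (ℕₚ.m∸n≤m (n ℕ.+ n) (toℕ j))) (≋-trans e (≋-sym (complement _ _ (ℕₚ.m∸n+n≡m (ℕₚ.<⇒≤ (h<p j))))))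

  inH-plus : ∀ {x} j → x ≋ h j → inH x ≡ true
  inH-plus j e = trans (cong half (inH-plus% j e)) (half-true (Finₚ.toℕ<n j))

  inH-minus : ∀ {x} j → x ≋ - h j → inH x ≡ false
  inH-minus {x} j e = trans (cong half (inH-minus% j e))
    (half-false (ℕₚ.m+n≤o⇒m≤o∸n (suc n) (s≤s (ℕₚ.+-monoʳ-≤ n (Finₚ.toℕ<n j)))))

  inH-zero : ∀ {x} → x ≋ + 0 → inH x ≡ false
  inH-zero e = cong half (%-cong e)

  inH-cong : Periodic₁ inH
  inH-cong e = cong half (%-cong e)

  s-plus : ∀ {x} j → x ≋ h j → s x ≡ + 1
  s-plus j e = cong (if_then + 1 else - + 1) (inH-plus j e)

  s-minus : ∀ {x} j → x ≋ - h j → s x ≡ - + 1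
  s-minus j e = cong (if_then + 1 else - + 1) (inH-minus j e)

  s-sign : ∀ x → IsSign (s x)
  s-sign x with inH x
  ... | true  = pos
  ... | false = neg

  mag-plus : ∀ {x} j → x ≋ h j → mag x ≡ suc (toℕ j)
  mag-plus {x} j e = trans (cong (if_then x %ℕ p else p ℕ.∸ x %ℕ p) (inH-plus j e)) (inH-plus% j e)

  mag-minus : ∀ {x} j → x ≋ - h j → mag x ≡ suc (toℕ j)
  mag-minus {x} j e = trans (cong (if_then x %ℕ p else p ℕ.∸ x %ℕ p) (inH-minus j e))
    (trans (cong (p ℕ.∸_) (inH-minus% j e)) (ℕₚ.m∸[m∸n]≡n (ℕₚ.<⇒≤ (h<p j))))

  mag-cong : Periodic₁ mag
  mag-cong e = cong (λ r → if half r then r else p ℕ.∸ r) (%-cong e)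

  signed-magnitude : ∀ x → ¬ x ≋ + 0 → x ≋ s x * + mag x
  signed-magnitude x hx with side x hx
  ... | plus j e  = ≋-trans e (≋-reflexive (sym (trans (cong₂ (λ a b → a * + b) (s-plus j e) (mag-plus j e)) (ℤₚ.*-identityˡ (h j)))))
  ... | minus j e = ≋-trans e (≋-reflexive (sym (trans (cong₂ (λ a b → a * + b) (s-minus j e) (mag-minus j e)) (ℤₚ.-1*i≡-i (h j)))))

  mag-h : ∀ j → mag (h j) ≡ suc (toℕ j)
  mag-h j = mag-plus j ≋-refl

  mag-even : ∀ x → ¬ x ≋ + 0 → mag (- x) ≡ mag x
  mag-even x hx with side x hx
  ... | plus j e  = trans (mag-minus j (neg-cong e)) (sym (mag-plus j e))
  ... | minus j e = trans (mag-plus j (≋-trans (neg-cong e) (≋-reflexive (ℤₚ.neg-involutive (h j))))) (sym (mag-minus j e))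

  index : ∀ {x} → Side x → Fin n
  index (plus j _)  = j
  index (minus j _) = j

  index-± : ∀ {x} (sd : Side x) → x ≋± h (index sd)
  index-± (plus j e)  = inj₁ e
  index-± (minus j e) = inj₂ e

  module HalfRange (M : CommutativeMonoid 0ℓ 0ℓ) where
    open CommutativeMonoid M
      renaming (refl to ≈-refl; sym to ≈-sym; trans to ≈-trans)
    open import Algebra.Properties.CommutativeMonoid.Sum M
      using (sum-permute; sum-cong-≋) renaming (sum to fold; ∑-distrib-+ to fold-distrib)
    open Range M

    -- Multiplication by a unit permutes the half system up to signs, which an even `F` does not
    -- see; the inverse permutation is multiplication by `inv d`.
    half-permute : (F : ℤ → Carrier) → (∀ {x y} → x ≋± y → F x ≈ F y) →
      ∀ d → ¬ d ≋ + 0 → fold (λ j → F (d * h j)) ≈ fold (λ j → F (h j))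
    half-permute F F-even d hd = ≈-sym (≈-trans (sum-permute (F ∘ h) perm)
      (sum-cong-≋ (λ j → F-even (±-sym (index-± (multiply d hd j))))))
      where
      d′ = inv d
      multiply : ∀ e → ¬ e ≋ + 0 → ∀ j → Side (e * h j)
      multiply e he j = side (e * h j) (*-≢0 he (h≢0 j))
      f : ∀ e → ¬ e ≋ + 0 → Fin n → Fin n
      f e he j = index (multiply e he j)
      cancel : ∀ a b ha hb → a * b ≋ + 1 → ∀ j → f a ha (f b hb j) ≡ j
      cancel a b ha hb ab j = h-injective _ _ (±-trans
        (±-sym (index-± (multiply a ha (f b hb j))))
        (±-trans (±-* a (±-sym (index-± (multiply b hb j))))
          (inj₁ (≋-trans (≋-reflexive (sym (ℤₚ.*-assoc a b (h j))))
                  (≋-trans (*-congʳ (h j) ab) (≋-reflexive (ℤₚ.*-identityˡ (h j))))))))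
      perm : Perm.Permutation n n
      perm = Perm.permutation (f d hd) (f d′ (inv-≢0 hd))
        (cancel d d′ hd (inv-≢0 hd) (inv-* hd))
        (cancel d′ d (inv-≢0 hd) hd (≋-trans (≋-reflexive (ℤₚ.*-comm d′ d)) (inv-* hd)))

    fold-halves : (F : ℤ → Carrier) → (∀ {x y} → x ≋ y → F x ≈ F y) →
      fold (λ i → F (rep i)) ≈ F (+ 0) ∙ fold (λ j → F (h j) ∙ F (- h j))
    fold-halves F F-cong = ∙-congˡ (≈-trans (fold-++ n n (λ i → F (+ suc (toℕ i))))
      (≈-trans (∙-cong
        (sum-cong-≋ {n} (λ i → reflexive (cong (λ k → F (+ suc k)) (Finₚ.toℕ-↑ˡ i n))))
        -- Read backwards, the residues above `n` are `p - 1`, `p - 2`, and so on, that is the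
        -- negatives of the half system in its own order.
        (≈-trans (sum-permute {n} (λ i → F (+ suc (toℕ (n ↑ʳ i)))) Perm.reverse)
          (sum-cong-≋ {n} (λ i → F-cong (complement (suc (toℕ (n ↑ʳ opposite i))) (suc (toℕ i)) (reflected i))))))
        (≈-sym (fold-distrib (F ∘ h) (λ j → F (- h j))))))
      where
      reflected : ∀ i → suc (toℕ (n ↑ʳ opposite i)) ℕ.+ suc (toℕ i) ≡ p
      reflected i = cong suc (begin
        toℕ (n ↑ʳ opposite i) ℕ.+ suc (toℕ i)       ≡⟨ cong (ℕ._+ suc (toℕ i)) (Finₚ.toℕ-↑ʳ n (opposite i)) ⟩
        n ℕ.+ toℕ (opposite i) ℕ.+ suc (toℕ i)      ≡⟨ ℕₚ.+-assoc n _ _ ⟩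
        n ℕ.+ (toℕ (opposite i) ℕ.+ suc (toℕ i))    ≡⟨ cong (λ k → n ℕ.+ (k ℕ.+ suc (toℕ i))) (Finₚ.opposite-prop i) ⟩
        n ℕ.+ (n ℕ.∸ suc (toℕ i) ℕ.+ suc (toℕ i))   ≡⟨ cong (n ℕ.+_) (ℕₚ.m∸n+n≡m (Finₚ.toℕ<n i)) ⟩
        n ℕ.+ n                                     ∎)
        where open ≡-Reasoning

-- Gauss's lemma and Euler's criterion

any-true : ∀ {A : Set} (f : A → Bool) xs → any f xs ≡ true → ∃[ x ] f x ≡ true
any-true f (x ∷ xs) e with f x in eq
... | true  = x , eq
... | false = any-true f xs e

any-false : ∀ {A : Set} (f : A → Bool) xs → any f xs ≡ false → ∀ {x} → x ∈ xs → f x ≡ false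
any-false f (x ∷ xs) e (here refl) with f x
... | false = refl
any-false f (x ∷ xs) e (there m) with f x
... | false = any-false f xs e m

true≢false : true ≢ false
true≢false ()

power : ℕ → ℤ → ℤ
power k x = prod {k} (λ _ → x)

evaluate : ∀ {m} → Vec ℤ m → ℤ → ℤ
evaluate []       x = + 0
evaluate (c ∷ cs) x = c + x * evaluate cs x

-- Horner's scheme for division by x - r, constant coefficient first.
quotient : ∀ {m} → ℤ → Vec ℤ (suc m) → Vec ℤ m
quotient r (c ∷ [])     = []
quotient r (c ∷ d ∷ cs) = evaluate (d ∷ cs) r ∷ quotient r (d ∷ cs)

evaluate-quotient : ∀ {m} r (cs : Vec ℤ (suc m)) x →
  evaluate cs x - evaluate cs r ≡ (x - r) * evaluate (quotient r cs) x
evaluate-quotient r (c ∷ []) x = lemma c x r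
  where
  lemma : ∀ c x r → (c + x * + 0) - (c + r * + 0) ≡ (x - r) * + 0
  lemma = solve-∀
evaluate-quotient r (c ∷ d ∷ cs) x = begin
  (c + x * qx) - (c + r * qr)             ≡⟨ lemma₁ c x r qx qr ⟩
  x * (qx - qr) + (x - r) * qr            ≡⟨ cong (λ z → x * z + (x - r) * qr) (evaluate-quotient r (d ∷ cs) x) ⟩
  x * ((x - r) * t) + (x - r) * qr        ≡⟨ lemma₂ x r t qr ⟩
  (x - r) * (qr + x * t)                  ∎
  where
  open ≡-Reasoning
  qx = evaluate (d ∷ cs) x
  qr = evaluate (d ∷ cs) r
  t  = evaluate (quotient r (d ∷ cs)) x
  lemma₁ : ∀ c x r u v → (c + x * u) - (c + r * v) ≡ x * (u - v) + (x - r) * v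
  lemma₁ = solve-∀
  lemma₂ : ∀ x r t v → x * ((x - r) * t) + (x - r) * v ≡ (x - r) * (v + x * t)
  lemma₂ = solve-∀

binomial : ∀ k → ℤ → Vec ℤ (suc k)
binomial zero    c = c + + 1 ∷ []
binomial (suc k) c = c ∷ binomial k (+ 0)

evaluate-binomial : ∀ k c x → evaluate (binomial k c) x ≡ c + power k x
evaluate-binomial zero c x = trans (cong (λ z → c + + 1 + z) (ℤₚ.*-zeroʳ x)) (ℤₚ.+-identityʳ (c + + 1))
evaluate-binomial (suc k) c x =
  cong (λ z → c + x * z) (trans (evaluate-binomial k (+ 0) x) (ℤₚ.+-identityˡ (power k x)))

data IsTrit : ℤ → Set where
  trit0 : IsTrit (+ 0)
  tritS : ∀ {t} → IsSign t → IsTrit t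

trit-* : ∀ {t u} → IsTrit t → IsTrit u → IsTrit (t * u)
trit-* trit0 _ = trit0
trit-* {t} (tritS _) trit0 = subst IsTrit (sym (ℤₚ.*-zeroʳ t)) trit0
trit-* (tritS σ) (tritS τ) = tritS (sign-* σ τ)

module Legendre (n : ℕ) (1<n : 1 ℕ.< n) (prime : Prime (suc (n ℕ.+ n))) where

  open OddPrime n 1<n prime public

  -- A polynomial with `m` coefficients and `m` distinct roots vanishes everywhere: dividing by
  -- `x - r₀` leaves one coefficient fewer, and by `euclid` the other roots are roots of the
  -- quotient.
  lagrange : ∀ {m} (cs : Vec ℤ m) (r : Fin m → ℤ) → (∀ i j → r i ≋ r j → i ≡ j) →
             (∀ i → evaluate cs (r i) ≋ + 0) → ∀ x → evaluate cs x ≋ + 0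
  lagrange {zero}  []         r inj root x = ≋-refl
  lagrange {suc m} cs@(_ ∷ _) r inj root x = by₂ (root Fin.zero) quotient≋0 (+ 1) (x - r₀)
      (trans (lemma (evaluate cs x) (evaluate cs r₀)) (cong (λ z → + 1 * (evaluate cs r₀ - + 0) + z)
        (trans (evaluate-quotient r₀ cs x) (cong ((x - r₀) *_) (sym (ℤₚ.+-identityʳ _))))))
    where
    r₀ = r Fin.zero
    q  = quotient r₀ cs
    lemma : ∀ a b → a - + 0 ≡ + 1 * (b - + 0) + (a - b)
    lemma = solve-∀
    lemma′ : ∀ a b → (a - b) - + 0 ≡ + 1 * (a - + 0) + - + 1 * (b - + 0)
    lemma′ = solve-∀
    quotient-root : ∀ i → evaluate q (r (Fin.suc i)) ≋ + 0
    quotient-root i = [ (λ e → ⊥-elim (Finₚ.0≢1+n (sym (inj (Fin.suc i) Fin.zero (0⇒≋ e))))) , (λ e → e) ]′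
      (euclid (r (Fin.suc i) - r₀) (evaluate q (r (Fin.suc i)))
        (subst (_≋ + 0) (evaluate-quotient r₀ cs (r (Fin.suc i)))
          (by₂ (root (Fin.suc i)) (root Fin.zero) (+ 1) (- + 1)
            (lemma′ (evaluate cs (r (Fin.suc i))) (evaluate cs r₀)))))
    quotient≋0 : evaluate q x ≋ + 0
    quotient≋0 = lagrange q (r ∘ Fin.suc)
      (λ i j e → Finₚ.suc-injective (inj (Fin.suc i) (Fin.suc j) e)) quotient-root x

  prod-≋ : ∀ {k} {f g : Fin k → ℤ} → (∀ i → f i ≋ g i) → prod f ≋ prod g
  prod-≋ {zero}  e = ≋-refl
  prod-≋ {suc k} e = *-cong (e Fin.zero) (prod-≋ (e ∘ Fin.suc))

  prod-≢0 : ∀ {k} {f : Fin k → ℤ} → (∀ i → ¬ f i ≋ + 0) → ¬ prod f ≋ + 0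
  prod-≢0 {zero}  e = 1≢0
  prod-≢0 {suc k} e = *-≢0 (e Fin.zero) (prod-≢0 (e ∘ Fin.suc))

  module HalfProduct = HalfRange ℤₚ.*-1-commutativeMonoid

  gaussSign : ℤ → ℤ
  gaussSign d = prod {n} (λ j → s (d * h j))

  gaussSign-sign : ∀ d → IsSign (gaussSign d)
  gaussSign-sign d = prod-sign {n} _ (λ j → s-sign (d * h j))

  -- The magnitudes of the multiples of `d` run through the half system again. A general `g` is
  -- allowed because both the magnitudes themselves (Gauss's lemma) and their parities
  -- (`marker-prod`) are multiplied.
  prod-mag : ∀ d → ¬ d ≋ + 0 → (g : ℕ → ℤ) →
             prod {n} (λ j → g (mag (d * h j))) ≡ prod {n} (λ j → g (suc (toℕ j)))
  prod-mag d hd g = trans (HalfProduct.half-permute (g ∘ mag) even d hd)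
                     (prod-cong-≗ {n} (λ j → cong g (mag-h j)))
    where
    even : ∀ {x y} → x ≋± y → g (mag x) ≡ g (mag y)
    even (inj₁ e) = cong g (mag-cong e)
    even {x} {y} (inj₂ e) with zero? y
    ... | yes y0 = cong g (mag-cong (≋-trans e (≋-trans (neg-cong y0) (≋-sym y0))))
    ... | no hy  = cong g (trans (mag-cong e) (mag-even y hy))

  -- The product of the multiples `d * h j` is `d ^ n` times `n!`, and also the sign times `n!`
  -- after passing to absolutely least residues; `n!` is a unit modulo `p`.
  gauss : ∀ d → ¬ d ≋ + 0 → power n d ≋ gaussSign d
  gauss d hd = *-cancelˡ f! (prod-≢0 h≢0) (≋-trans (≋-reflexive (trans (ℤₚ.*-comm f! (power n d)) (begin
      power n d * f!                   ≡⟨ prod-distrib-* {n} (λ _ → d) h ⟨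
      prod {n} (λ j → d * h j)         ∎)))
    (≋-trans (prod-≋ {n} (λ j → signed-magnitude (d * h j) (*-≢0 hd (h≢0 j)))) (≋-reflexive (begin
      prod {n} (λ j → s (d * h j) * + mag (d * h j))   ≡⟨ prod-distrib-* {n} (λ j → s (d * h j)) (λ j → + mag (d * h j)) ⟩
      gaussSign d * prod {n} (λ j → + mag (d * h j))   ≡⟨ cong (gaussSign d *_) (prod-mag d hd (λ k → + k)) ⟩
      gaussSign d * f!                                 ≡⟨ ℤₚ.*-comm (gaussSign d) f! ⟩
      f! * gaussSign d                                 ∎))))
    where
    open ≡-Reasoning
    f! = prod {n} h

  opaque
    χ : ℤ → ℤ
    χ x = legendre x p

    χ-legendre : ∀ x → χ x ≡ legendre x p
    χ-legendre x = refl

  data Character (x : ℤ) : Set where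
    zero       : x ≋ + 0 → χ x ≡ + 0 → Character x
    residue    : ¬ x ≋ + 0 → ∀ y → y * y ≋ x → χ x ≡ + 1 → Character x
    nonresidue : ¬ x ≋ + 0 → (∀ y → ¬ y * y ≋ x) → χ x ≡ - + 1 → Character x

  private
    isRoot : ℤ → ℕ → Bool
    isRoot x y = divᵇ p (+ y * + y - x)

  opaque
    unfolding χ

    character : ∀ x → Character x
    character x with zero? x
    ... | yes x0 = zero x0 (cong (if_then + 0 else (if any (isRoot x) (upTo p) then + 1 else - + 1)) (divᵇ-true x0))
    ... | no hx with any (isRoot x) (upTo p) in eq
    ...   | true = residue hx (+ y) (root (zero? (+ y * + y - x)))
                     (trans (cong (if_then + 0 else (if any (isRoot x) (upTo p) then + 1 else - + 1)) (divᵇ-false hx))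
                       (cong (if_then + 1 else - + 1) eq))
      where
      y : ℕ
      y = proj₁ (any-true (isRoot x) (upTo p) eq)
      root : Dec (+ y * + y - x ≋ + 0) → + y * + y ≋ x
      root (yes e) = 0⇒≋ e
      root (no ¬e) = ⊥-elim (true≢false (trans (sym (proj₂ (any-true (isRoot x) (upTo p) eq))) (divᵇ-false ¬e)))
    ...   | false = nonresidue hx (λ y e → absurd y (≋-trans (*-cong (%-≋ y) (%-≋ y)) e))
                     (trans (cong (if_then + 0 else (if any (isRoot x) (upTo p) then + 1 else - + 1)) (divᵇ-false hx))
                       (cong (if_then + 1 else - + 1) eq))
      where
      absurd : ∀ y → + (y %ℕ p) * + (y %ℕ p) ≋ x → ⊥
      absurd y e = true≢false (trans (sym (divᵇ-true (≋⇒0 e)))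
        (any-false (isRoot x) (upTo p) eq (∈-upTo⁺ (n%ℕd<d y p))))

  χ-trit : ∀ x → IsTrit (χ x)
  χ-trit x with character x
  ... | zero _ e           = subst IsTrit (sym e) trit0
  ... | residue _ _ _ e    = subst IsTrit (sym e) (tritS pos)
  ... | nonresidue _ _ e   = subst IsTrit (sym e) (tritS neg)

  -- 0, 1 and -1 are distinct modulo an odd prime, so a congruence between values of `χ`, such as
  -- one from Euler's criterion, is an equality.
  trit-injective : ∀ {t u} → IsTrit t → IsTrit u → t ≋ u → t ≡ u
  trit-injective trit0 trit0 e = refl
  trit-injective trit0 (tritS pos) e = ⊥-elim (1≢0 (≋-sym e))
  trit-injective trit0 (tritS neg) e = ⊥-elim (neg-≢0 1≢0 (≋-sym e))
  trit-injective (tritS pos) trit0 e = ⊥-elim (1≢0 e)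
  trit-injective (tritS neg) trit0 e = ⊥-elim (neg-≢0 1≢0 e)
  trit-injective (tritS σ) (tritS τ) e = sign-injective σ τ e

  power-≋ : ∀ {x y} → x ≋ y → power n x ≋ power n y
  power-≋ e = prod-≋ {n} (λ _ → e)

  power-* : ∀ x y → power n (x * y) ≡ power n x * power n y
  power-* x y = prod-distrib-* {n} (λ _ → x) (λ _ → y)

  power-zero : ∀ {x} → x ≋ + 0 → power n x ≋ + 0
  power-zero = lemma (ℕₚ.<-trans (ℕₚ.n<1+n 0) 1<n)
    where
    lemma : ∀ {k x} → 0 ℕ.< k → x ≋ + 0 → power k x ≋ + 0
    lemma {suc k} {x} _ e = *-zeroˡ (power k x) e

  square-≢0 : ∀ {x y} → ¬ x ≋ + 0 → y * y ≋ x → ¬ y ≋ + 0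
  square-≢0 {x} {y} hx e y0 = hx (≋-trans (≋-sym e) (*-zeroˡ y y0))

  square-roots : ∀ {x y} → x * x ≋ y * y → x ≋± y
  square-roots {x} {y} e = [ inj₁ ∘ 0⇒≋ , (λ e′ → inj₂ (by e′ (+ 1) (lemma₂ x y))) ]′
    (euclid (x - y) (x + y) (by e (+ 1) (lemma₁ x y)))
    where
    lemma₁ : ∀ x y → (x - y) * (x + y) - + 0 ≡ + 1 * (x * x - y * y)
    lemma₁ = solve-∀
    lemma₂ : ∀ x y → x - - y ≡ + 1 * (x + y - + 0)
    lemma₂ = solve-∀

  power-square : ∀ y → ¬ y ≋ + 0 → power n (y * y) ≋ + 1
  power-square y hy = ≋-trans (≋-reflexive (power-* y y)) (≋-trans (*-cong (gauss y hy) (gauss y hy))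
    (≋-reflexive (sign-square (gaussSign-sign y))))

  -- Otherwise x would be one more root of X ^ n - 1 besides the n squares.
  power-nonresidue : ∀ x → ¬ x ≋ + 0 → (∀ y → ¬ y * y ≋ x) → ¬ power n x ≋ + 1
  power-nonresidue x hx nonsquare e = neg-≢0 1≢0 (≋-trans (≋-reflexive (sym (ℤₚ.+-identityʳ (- + 1))))
      (≋-trans (+-congˡ (- + 1) (≋-sym (power-zero ≋-refl)))
        -- The contradiction is read off at 0, where `X ^ n - 1` takes the value -1 because `n` is
        -- positive.
        (subst (_≋ + 0) (evaluate-binomial n (- + 1) (+ 0)) (lagrange (binomial n (- + 1)) r distinct root (+ 0)))))
    where
    r : Fin (suc n) → ℤ
    r Fin.zero    = x
    r (Fin.suc j) = h j * h j
    distinct : ∀ i j → r i ≋ r j → i ≡ j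
    distinct Fin.zero    Fin.zero    e = refl
    distinct Fin.zero    (Fin.suc j) e = ⊥-elim (nonsquare (h j) (≋-sym e))
    distinct (Fin.suc i) Fin.zero    e = ⊥-elim (nonsquare (h i) e)
    distinct (Fin.suc i) (Fin.suc j) e = cong Fin.suc (h-injective i j (square-roots e))
    vanish : ∀ y → power n y ≋ + 1 → evaluate (binomial n (- + 1)) y ≋ + 0
    vanish y e = ≋-trans (≋-reflexive (evaluate-binomial n (- + 1) y)) (+-congˡ (- + 1) e)
    root : ∀ i → evaluate (binomial n (- + 1)) (r i) ≋ + 0
    root Fin.zero    = vanish x e
    root (Fin.suc j) = vanish (h j * h j) (power-square (h j) (h≢0 j))

  -- For a square the power is the square of a Gauss sign, hence 1, without recourse to Fermat's
  -- theorem. For a nonsquare Gauss's lemma leaves only 1 and -1, and counting roots excludes 1.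
  euler : ∀ x → χ x ≋ power n x
  euler x with character x
  ... | zero x0 e = ≋-trans (≋-reflexive e) (≋-sym (power-zero x0))
  ... | residue hx y y² e = ≋-trans (≋-reflexive e)
          (≋-sym (≋-trans (power-≋ (≋-sym y²)) (power-square y (square-≢0 hx y²))))
  ... | nonresidue hx nonsquare e with gaussSign x in eq | gaussSign-sign x
  ...   | _ | pos = ⊥-elim (power-nonresidue x hx nonsquare (≋-trans (gauss x hx) (≋-reflexive eq)))
  ...   | _ | neg = ≋-trans (≋-reflexive e) (≋-sym (≋-trans (gauss x hx) (≋-reflexive eq)))

  χ-cong : Periodic₁ χ
  χ-cong {x} {y} e = trit-injective (χ-trit x) (χ-trit y)
    (≋-trans (euler x) (≋-trans (power-≋ e) (≋-sym (euler y))))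

  χ-* : ∀ x y → χ (x * y) ≡ χ x * χ y
  χ-* x y = trit-injective (χ-trit (x * y)) (trit-* (χ-trit x) (χ-trit y))
    (≋-trans (euler (x * y)) (≋-trans (≋-reflexive (power-* x y)) (≋-sym (*-cong (euler x) (euler y)))))

  χ-gauss : ∀ d → ¬ d ≋ + 0 → χ d ≡ gaussSign d
  χ-gauss d hd = trit-injective (χ-trit d) (tritS (gaussSign-sign d)) (≋-trans (euler d) (gauss d hd))

  χ-zero : ∀ {x} → x ≋ + 0 → χ x ≡ + 0
  χ-zero {x} x0 with character x
  ... | zero _ e         = e
  ... | residue hx _ _ _ = ⊥-elim (hx x0)
  ... | nonresidue hx _ _ = ⊥-elim (hx x0)

  χ-sign : ∀ {x} → ¬ x ≋ + 0 → IsSign (χ x)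
  χ-sign {x} hx = subst IsSign (sym (χ-gauss x hx)) (gaussSign-sign x)

  χ-square : ∀ {x} y → ¬ y ≋ + 0 → y * y ≋ x → χ x ≡ + 1
  χ-square {x} y hy e = trans (sym (χ-cong e)) (trans (χ-* y y) (sign-square (χ-sign hy)))

-- Parities of triples of absolutely least residues

sg-even : ∀ a b → sg (a ℕ.+ 2 ℕ.* b) ≡ sg a
sg-even a b = begin
  sg (a ℕ.+ (b ℕ.+ (b ℕ.+ 0)))  ≡⟨ sg-+ a _ ⟩
  sg a * sg (b ℕ.+ (b ℕ.+ 0))   ≡⟨ cong (λ z → sg a * sg (b ℕ.+ z)) (ℕₚ.+-identityʳ b) ⟩
  sg a * sg (b ℕ.+ b)           ≡⟨ cong (sg a *_) (trans (sg-+ b b) (sign-square (sg-sign b))) ⟩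
  sg a * + 1                    ≡⟨ ℤₚ.*-identityʳ (sg a) ⟩
  sg a                          ∎
  where open ≡-Reasoning

triangularSign : ℕ → ℤ
triangularSign n = prod {n} (λ j → sg (suc (toℕ j)))

-- Equals `(-1) ^ (n + n (n + 1) / 2)`: one minus sign for each element of the half system, and the
-- parity of the sum of the half system.
κ : ℕ → ℤ
κ n = sg n * triangularSign n

κ-sign : ∀ n → IsSign (κ n)
κ-sign n = sign-* (sg-sign n) (prod-sign {n} _ (λ j → sg-sign (suc (toℕ j))))

-1-prod : ∀ n → prod {n} (λ _ → - + 1) ≡ sg n
-1-prod zero    = refl
-1-prod (suc n) = trans (ℤₚ.-1*i≡-i _) (cong -_ (-1-prod n))

module Triple (n : ℕ) (1<n : 1 ℕ.< n) (prime : Prime (suc (n ℕ.+ n))) where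

  open Legendre n 1<n prime public

  marker : ℤ → Fin n → ℤ
  marker v j = if inH (v * h j) ∧ inH ((+ 1 + v) * h j) then - + 1 else + 1

  private
    i<p : ∀ (i : Fin n) → suc (toℕ i) ℕ.≤ n
    i<p i = Finₚ.toℕ<n i

    sg-triple : ∀ a b → sg a * sg b * sg (a ℕ.+ b) ≡ + 1
    sg-triple a b = trans (cong (sg a * sg b *_) (sg-+ a b)) (sign-square (sign-* (sg-sign a) (sg-sign b)))

    rotate : ∀ a b c → sg a * sg b * sg c ≡ sg b * sg c * sg a
    rotate a b c = lemma (sg a) (sg b) (sg c)
      where
      lemma : ∀ x y z → x * y * z ≡ y * z * x
      lemma = solve-∀

    swap : ∀ a b c → sg a * sg b * sg c ≡ sg a * sg c * sg b
    swap a b c = lemma (sg a) (sg b) (sg c)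
      where
      lemma : ∀ x y z → x * y * z ≡ x * z * y
      lemma = solve-∀

    sum<p : ∀ (i m : Fin n) → suc (toℕ i) ℕ.+ suc (toℕ m) ℕ.< p
    sum<p i m = s≤s (ℕₚ.+-mono-≤ (i<p i) (i<p m))

    restate : ∀ {y w i b b′ m m′} → inH y ≡ b → inH w ≡ b′ → mag y ≡ m → mag w ≡ m′ →
      (if b ∧ b′ then - + 1 else + 1) ≡ - (if b then + 1 else - + 1) * (sg i * sg m * sg m′) →
      (if inH y ∧ inH w then - + 1 else + 1) ≡ - s y * (sg i * sg (mag y) * sg (mag w))
    restate refl refl refl refl e = e

    -- For x + y = z modulo p the magnitudes add up to an odd number exactly
    -- when x and y lie in the half system but z does not.
    sides : ∀ {y w} (i : Fin n) → h i + y ≋ w → (sy : Side y) (sw : Side w) →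
      (if inH y ∧ inH w then - + 1 else + 1) ≡
      - s y * (sg (suc (toℕ i)) * sg (mag y) * sg (mag w))
    sides {y} {w} i e (plus m ey) (plus k ew)
      = restate {y} {w} {suc (toℕ i)} (inH-plus m ey) (inH-plus k ew) (mag-plus m ey) (mag-plus k ew) (
      sym (trans (cong (λ c → - + 1 * (sg a * sg b * sg c)) (sym total)) (cong (- + 1 *_) (sg-triple a b))))
      where
      a = suc (toℕ i)
      b = suc (toℕ m)
      total : a ℕ.+ b ≡ suc (toℕ k)
      total = ≋⇒≡ (sum<p i m) (h<p k) (≋-trans (+-congˡ (h i) (≋-sym ey)) (≋-trans e ew))
    sides {y} {w} i e (plus m ey) (minus k ew)
      = restate {y} {w} {suc (toℕ i)} (inH-plus m ey) (inH-minus k ew) (mag-plus m ey) (mag-minus k ew) (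
      -- Here the three magnitudes add up to the odd number `p`. In the other three cases one
      -- magnitude is the sum of the other two, so their total is even.
      sym (trans (cong (λ z → - + 1 * z) (begin
        sg a * sg b * sg c     ≡⟨ cong (_* sg c) (sg-+ a b) ⟨
        sg (a ℕ.+ b) * sg c    ≡⟨ sg-+ (a ℕ.+ b) c ⟨
        sg (a ℕ.+ b ℕ.+ c)     ≡⟨ cong sg (trans (cong (ℕ._+ c) total) (ℕₚ.m∸n+n≡m (ℕₚ.<⇒≤ (h<p k)))) ⟩
        sg p                   ≡⟨ cong (λ z → - sg (n ℕ.+ z)) (ℕₚ.+-identityʳ n) ⟨
        - sg (2 ℕ.* n)         ≡⟨ cong -_ (sg-even 0 n) ⟩
        - + 1                  ∎)) refl))
      where
      open ≡-Reasoning
      a = suc (toℕ i)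
      b = suc (toℕ m)
      c = suc (toℕ k)
      total : a ℕ.+ b ≡ p ℕ.∸ c
      total = ≋⇒≡ (sum<p i m) (s≤s (ℕₚ.m∸n≤m (n ℕ.+ n) (toℕ k)))
        (≋-trans (+-congˡ (h i) (≋-sym ey)) (≋-trans e (≋-trans ew
          (≋-sym (complement (p ℕ.∸ c) c (ℕₚ.m∸n+n≡m (ℕₚ.<⇒≤ (h<p k))))))))
    sides {y} {w} i e (minus m ey) (plus k ew)
      = restate {y} {w} {suc (toℕ i)} (inH-minus m ey) (inH-plus k ew) (mag-minus m ey) (mag-plus k ew) (
      sym (trans (ℤₚ.*-identityˡ _) (trans (rotate a b c)
        (trans (cong (λ z → sg b * sg c * sg z) (sym total)) (sg-triple b c)))))
      where
      a = suc (toℕ i)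
      b = suc (toℕ m)
      c = suc (toℕ k)
      total : b ℕ.+ c ≡ a
      total = ≋⇒≡ (sum<p m k) (h<p i) (≋-sym (≋-trans
        (≋-trans (≋-reflexive (add-sub (h i) (h m))) (+-congʳ (h m) (≋-trans (+-congˡ (h i) (≋-sym ey)) (≋-trans e ew))))
        (≋-reflexive (ℤₚ.+-comm (h k) (h m)))))
        where
        add-sub : ∀ x y → x ≡ (x - y) + y
        add-sub = solve-∀
    sides {y} {w} i e (minus m ey) (minus k ew)
      = restate {y} {w} {suc (toℕ i)} (inH-minus m ey) (inH-minus k ew) (mag-minus m ey) (mag-minus k ew) (
      sym (trans (ℤₚ.*-identityˡ _) (trans (swap a b c)
        (trans (cong (λ z → sg a * sg c * sg z) (sym total)) (sg-triple a c)))))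
      where
      a = suc (toℕ i)
      b = suc (toℕ m)
      c = suc (toℕ k)
      total : a ℕ.+ c ≡ b
      total = ≋⇒≡ (sum<p i k) (h<p m) (by (≋-trans (+-congˡ (h i) (≋-sym ey)) (≋-trans e ew)) (+ 1)
        (lemma (h i) (h m) (h k)))
        where
        lemma : ∀ x y z → (x + z) - y ≡ + 1 * ((x - y) - - z)
        lemma = solve-∀

  -- Multiplying `sides` over the half system, each of the three families of magnitudes contributes
  -- the same triangular sign, so their cube leaves one of them. The signs of `v * h j` give `χ v`
  -- by Gauss's lemma. Both `v` and `1 + v` must be units for the magnitudes to permute the half
  -- system.
  marker-prod : ∀ v → ¬ v ≋ + 0 → ¬ + 1 + v ≋ + 0 → prod {n} (marker v) ≡ κ n * χ v
  marker-prod v hv hv′ = begin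
    prod {n} (marker v)
      ≡⟨ prod-cong-≗ {n} (λ j → trans
           (sides j (≋-reflexive (lemma (h j) v)) (side _ (*-≢0 hv (h≢0 j))) (side _ (*-≢0 hv′ (h≢0 j))))
           (assoc (σ j) (A j) (B j) (C j))) ⟩
    prod {n} (λ j → - + 1 * (σ j * (A j * (B j * C j))))
      ≡⟨ prod-distrib-* {n} (λ _ → - + 1) (λ j → σ j * (A j * (B j * C j))) ⟩
    prod {n} (λ _ → - + 1) * prod {n} (λ j → σ j * (A j * (B j * C j)))
      ≡⟨ cong₂ _*_ (-1-prod n) (prod-distrib-* {n} σ (λ j → A j * (B j * C j))) ⟩
    sg n * (gaussSign v * prod {n} (λ j → A j * (B j * C j)))
      ≡⟨ cong (λ z → sg n * (gaussSign v * z)) (trans (prod-distrib-* {n} A (λ j → B j * C j))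
           (cong (triangularSign n *_) (trans (prod-distrib-* {n} B C)
             (cong₂ _*_ (prod-mag v hv sg) (prod-mag (+ 1 + v) hv′ sg))))) ⟩
    sg n * (gaussSign v * (triangularSign n * (triangularSign n * triangularSign n)))
      ≡⟨ cong (λ z → sg n * (gaussSign v * (triangularSign n * z)))
           (sign-square (prod-sign {n} _ (λ j → sg-sign (suc (toℕ j))))) ⟩
    sg n * (gaussSign v * (triangularSign n * + 1))
      ≡⟨ regroup (sg n) (gaussSign v) (triangularSign n) ⟩
    κ n * gaussSign v
      ≡⟨ cong (κ n *_) (χ-gauss v hv) ⟨
    κ n * χ v ∎
    where
    open ≡-Reasoning
    σ A B C : Fin n → ℤ
    σ j = s (v * h j)
    A j = sg (suc (toℕ j))
    B j = sg (mag (v * h j))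
    C j = sg (mag ((+ 1 + v) * h j))
    lemma : ∀ x v → x + v * x ≡ (+ 1 + v) * x
    lemma = solve-∀
    assoc : ∀ x a b c → - x * (a * b * c) ≡ - + 1 * (x * (a * (b * c)))
    assoc = solve-∀
    regroup : ∀ x y z → x * (y * (z * + 1)) ≡ x * z * y
    regroup = solve-∀

-- Character sums

indicator : ℤ → ℕ → ℤ
indicator x p = if divᵇ p x then + 1 else + 0

-- A linear combination of functions as data, so that expanding a summand and summing it term by
-- term are separate steps, joined by `∑-combination`.
combination : List (ℤ × (ℤ → ℤ)) → ℤ → ℤ
combination []            x = + 0
combination ((c , F) ∷ L) x = c * F x + combination L x

module CharacterSums (n : ℕ) (1<n : 1 ℕ.< n) (prime : Prime (suc (n ℕ.+ n))) where

  open Triple n 1<n prime public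

  ∑ₚ : (ℤ → ℤ) → ℤ
  ∑ₚ F = sum {p} (λ i → F (rep i))

  ∑-cong : ∀ {F G} → (∀ x → F x ≡ G x) → ∑ₚ F ≡ ∑ₚ G
  ∑-cong e = sum-cong-≗ {p} (λ i → e (rep i))

  ∑-*ˡ : ∀ c F → ∑ₚ (λ x → c * F x) ≡ c * ∑ₚ F
  ∑-*ˡ c F = sym (*-distribˡ-sum {p} c (λ i → F (rep i)))

  ∑-+ : ∀ F G → ∑ₚ (λ x → F x + G x) ≡ ∑ₚ F + ∑ₚ G
  ∑-+ F G = ∑-distrib-+ {p} (λ i → F (rep i)) (λ i → G (rep i))

  ∑-swap : ∀ (F : ℤ → ℤ → ℤ) → ∑ₚ (λ x → ∑ₚ (F x)) ≡ ∑ₚ (λ y → ∑ₚ (λ x → F x y))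
  ∑-swap F = ∑-comm {p} {p} (λ i j → F (rep i) (rep j))

  ∑-zero : ∑ₚ (λ _ → + 0) ≡ + 0
  ∑-zero = ∑-*ˡ (+ 0) (λ _ → + 0)

  ∑-one : ∑ₚ (λ _ → + 1) ≡ + p
  ∑-one = count p
    where
    count : ∀ k → sum {k} (λ _ → + 1) ≡ + k
    count zero    = refl
    count (suc k) = cong (λ z → + 1 + z) (count k)

  total : List (ℤ × (ℤ → ℤ)) → ℤ
  total []            = + 0
  total ((c , F) ∷ L) = c * ∑ₚ F + total L

  ∑-combination : ∀ L {F : ℤ → ℤ} → (∀ x → F x ≡ combination L x) → ∑ₚ F ≡ total L
  ∑-combination L e = trans (∑-cong e) (split L)
    where
    split : ∀ L → ∑ₚ (combination L) ≡ total L
    split []            = ∑-zero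
    split ((c , F) ∷ L) = trans (∑-+ (λ x → c * F x) (combination L)) (cong₂ _+_ (∑-*ˡ c F) (split L))

  module FullSum = FullRange ℤₚ.+-0-commutativeMonoid

  ∑-shift : ∀ F → Periodic₁ F → ∀ a → ∑ₚ (λ x → F (x + a)) ≡ ∑ₚ F
  ∑-shift F F-cong a = FullSum.fold-permute F F-cong (_+ a) (_+ - a) (+-congʳ a) (+-congʳ (- a))
    (λ x → ≋-reflexive (back x a)) (λ x → ≋-reflexive (forth x a))
    where
    back : ∀ x a → x + - a + a ≡ x
    back = solve-∀
    forth : ∀ x a → x + a + - a ≡ x
    forth = solve-∀

  ∑-dilate : ∀ F → Periodic₁ F → ∀ a → ¬ a ≋ + 0 → ∑ₚ (λ x → F (a * x)) ≡ ∑ₚ F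
  ∑-dilate F F-cong a ha = FullSum.fold-permute F F-cong (a *_) (inv a *_) (*-congˡ a) (*-congˡ (inv a))
    (λ x → ≋-trans (≋-reflexive (sym (ℤₚ.*-assoc a (inv a) x))) (unit x (inv-* ha)))
    (λ x → ≋-trans (≋-reflexive (sym (ℤₚ.*-assoc (inv a) a x)))
             (unit x (≋-trans (≋-reflexive (ℤₚ.*-comm (inv a) a)) (inv-* ha))))
    where
    unit : ∀ x {u} → u ≋ + 1 → u * x ≋ x
    unit x e = ≋-trans (*-congʳ x e) (≋-reflexive (ℤₚ.*-identityˡ x))

  ∑-affine : ∀ F → Periodic₁ F → ∀ a b → ¬ a ≋ + 0 → ∑ₚ (λ x → F (a * x + b)) ≡ ∑ₚ F
  ∑-affine F F-cong a b ha = trans (∑-dilate (λ x → F (x + b)) (λ e → F-cong (+-congʳ b e)) a ha) (∑-shift F F-cong b)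

  ∑-inv : ∀ F → Periodic₁ F → ∑ₚ (λ x → F (inv x)) ≡ ∑ₚ F
  ∑-inv F F-cong = FullSum.fold-permute F F-cong inv inv inv-cong inv-cong inv-inv inv-inv

  opaque
    δ : ℤ → ℤ
    δ x = indicator x p

    δ-indicator : ∀ x → δ x ≡ indicator x p
    δ-indicator x = refl

    δ-one : ∀ {x} → x ≋ + 0 → δ x ≡ + 1
    δ-one e = cong (if_then + 1 else + 0) (divᵇ-true e)

    δ-zero : ∀ {x} → ¬ x ≋ + 0 → δ x ≡ + 0
    δ-zero e = cong (if_then + 1 else + 0) (divᵇ-false e)

    δ-cong : Periodic₁ δ
    δ-cong e = cong (λ r → if r ℕ.≡ᵇ 0 then + 1 else + 0) (%-cong e)

  δ-iff : ∀ {x y} → (x ≋ + 0 → y ≋ + 0) → (y ≋ + 0 → x ≋ + 0) → δ x ≡ δ y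
  δ-iff {x} {y} f g = lemma (zero? x)
    where
    lemma : Dec (x ≋ + 0) → δ x ≡ δ y
    lemma (yes e) = trans (δ-one e) (sym (δ-one (f e)))
    lemma (no ¬e) = trans (δ-zero ¬e) (sym (δ-zero (λ e → ¬e (g e))))

  δ-swap : ∀ x y → δ (x - y) ≡ δ (y - x)
  δ-swap x y = δ-iff (λ e → ≋⇒0 {y} {x} (≋-sym (0⇒≋ {x} {y} e))) (λ e → ≋⇒0 {x} {y} (≋-sym (0⇒≋ {y} {x} e)))

  -- A translation moves the support of `δ` to 0, the first term of the sum; all later terms vanish.
  ∑-δ : ∀ a F → Periodic₁ F → ∑ₚ (λ x → δ (x - a) * F x) ≡ F a
  ∑-δ a F F-cong = trans (sym (∑-shift G G-cong a)) (trans (cong₂ _+_ first rest) (ℤₚ.+-identityʳ (F a)))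
    where
    G : ℤ → ℤ
    G x = δ (x - a) * F x
    G-cong : Periodic₁ G
    G-cong e = cong₂ _*_ (δ-cong (+-congʳ (- a) e)) (F-cong e)
    cancel : ∀ x a → x + a - a ≡ x
    cancel = solve-∀
    first : G (+ 0 + a) ≡ F a
    first = trans (cong₂ _*_ (δ-one (≋-reflexive (cancel (+ 0) a))) (F-cong (≋-reflexive (ℤₚ.+-identityˡ a))))
              (ℤₚ.*-identityˡ (F a))
    rest : sum {n ℕ.+ n} (λ i → G (+ suc (toℕ i) + a)) ≡ + 0
    rest = trans (sum-cong-≗ {n ℕ.+ n} (λ i → trans (cong (_* F (+ suc (toℕ i) + a)) (δ-zero (λ e →
             small≢0 (toℕ i) (s≤s (Finₚ.toℕ<n i)) (≋-trans (≋-reflexive (sym (cancel (+ suc (toℕ i)) a))) e))))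
             (ℤₚ.*-zeroˡ (F (+ suc (toℕ i) + a)))))
             (sym (*-distribˡ-sum {n ℕ.+ n} (+ 0) (λ _ → + 0)))

  ∑-δ₁ : ∀ a → ∑ₚ (λ x → δ (x - a)) ≡ + 1
  ∑-δ₁ a = trans (∑-cong (λ x → sym (ℤₚ.*-identityʳ (δ (x - a))))) (∑-δ a (λ _ → + 1) (λ _ → refl))

  ∑-δ-linear : ∀ a b F → ¬ b ≋ + 0 → Periodic₁ F → ∑ₚ (λ x → δ (a + b * x) * F x) ≡ F (- a * inv b)
  ∑-δ-linear a b F hb F-cong = trans (∑-cong (λ x → cong (_* F x) (δ-iff
      (λ e → [ (λ e′ → ⊥-elim (hb e′)) , (λ e′ → e′) ]′ (euclid b (x - - a * inv b) (≋-trans (factor x) e)))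
      (λ e → ≋-trans (≋-sym (factor x)) (*-zeroʳ b e)))))
    (∑-δ (- a * inv b) F F-cong)
    where
    lemma : ∀ a b x i → b * (x - - a * i) - (a + b * x) ≡ a * (b * i - + 1)
    lemma = solve-∀
    factor : ∀ x → b * (x - - a * inv b) ≋ a + b * x
    factor x = by (inv-* hb) a (lemma a b x (inv b))

  δ-squares : ∀ u y → ¬ y ≋ + 0 → δ (u * u - y * y) ≡ δ (u - y) + δ (u - - y)
  δ-squares u y hy = split (zero? (u - y)) (zero? (u - - y))
    where
    factor₁ : ∀ u y → u * u - y * y ≡ (u - y) * (u + y)
    factor₁ = solve-∀
    factor₂ : ∀ u y → u * u - y * y ≡ (u - - y) * (u - y)
    factor₂ = solve-∀
    split : Dec (u - y ≋ + 0) → Dec (u - - y ≋ + 0) → δ (u * u - y * y) ≡ δ (u - y) + δ (u - - y)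
    split (yes a) (yes b) = ⊥-elim (*-≢0 2≢0 hy (by₂ b a (+ 1) (- + 1) (lemma u y)))
      where
      lemma : ∀ u y → + 2 * y - + 0 ≡ + 1 * (u - - y - + 0) + - + 1 * (u - y - + 0)
      lemma = solve-∀
    split (yes a) (no b) = trans (δ-one (subst (_≋ + 0) (sym (factor₁ u y)) (*-zeroˡ (u + y) a)))
      (sym (cong₂ _+_ (δ-one a) (δ-zero b)))
    split (no a) (yes b) = trans (δ-one (subst (_≋ + 0) (sym (factor₂ u y)) (*-zeroˡ (u - y) b)))
      (sym (cong₂ _+_ (δ-zero a) (δ-one b)))
    split (no a) (no b)  = trans (δ-zero (λ e → [ b , a ]′ (euclid (u - - y) (u - y) (subst (_≋ + 0) (factor₂ u y) e))))
      (sym (cong₂ _+_ (δ-zero a) (δ-zero b)))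

  square-count : ∀ U → ∑ₚ (λ u → δ (u * u - U)) ≡ + 1 + χ U
  square-count U = count (character U)
    where
    count : Character U → ∑ₚ (λ u → δ (u * u - U)) ≡ + 1 + χ U
    count (zero U0 e) = trans (trans (∑-cong (λ u → δ-iff (to u) (from u))) (∑-δ₁ (+ 0)))
                          (cong (λ z → + 1 + z) (sym e))
      where
      to : ∀ u → u * u - U ≋ + 0 → u - + 0 ≋ + 0
      to u e = ≋⇒0 {u} ([ (λ z → z) , (λ z → z) ]′ (euclid u u (≋-trans (0⇒≋ {u * u} {U} e) U0)))
      from : ∀ u → u - + 0 ≋ + 0 → u * u - U ≋ + 0
      from u e = ≋⇒0 {u * u} {U} (≋-trans (*-zeroˡ u (0⇒≋ {u} e)) (≋-sym U0))
    count (residue hU y y² e) = trans (trans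
        (∑-cong (λ u → trans (δ-cong (+-congˡ (u * u) (neg-cong (≋-sym y²)))) (δ-squares u y (square-≢0 hU y²))))
        (trans (∑-+ (λ u → δ (u - y)) (λ u → δ (u - - y))) (cong₂ _+_ (∑-δ₁ y) (∑-δ₁ (- y)))))
        (cong (λ z → + 1 + z) (sym e))
    count (nonresidue hU nonsquare e) = trans
      (trans (∑-cong (λ u → δ-zero (λ e → nonsquare u (0⇒≋ {u * u} {U} e)))) ∑-zero)
      (cong (λ z → + 1 + z) (sym e))

  -- Substitution `U = u²` with the multiplicity `1 + χ U`, obtained by inserting `δ (U - u * u)`
  -- and exchanging the two sums.
  ∑-squares : ∀ F → Periodic₁ F → ∑ₚ (λ u → F (u * u)) ≡ ∑ₚ (λ U → (+ 1 + χ U) * F U)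
  ∑-squares F F-cong = begin
    ∑ₚ (λ u → F (u * u))                             ≡⟨ ∑-cong (λ u → ∑-δ (u * u) F F-cong) ⟨
    ∑ₚ (λ u → ∑ₚ (λ U → δ (U - u * u) * F U))        ≡⟨ ∑-swap (λ u U → δ (U - u * u) * F U) ⟩
    ∑ₚ (λ U → ∑ₚ (λ u → δ (U - u * u) * F U))        ≡⟨ ∑-cong (λ U → trans
                                                          (∑-cong (λ u → ℤₚ.*-comm (δ (U - u * u)) (F U)))
                                                          (trans (∑-*ˡ (F U) (λ u → δ (U - u * u))) (ℤₚ.*-comm (F U) _))) ⟩
    ∑ₚ (λ U → ∑ₚ (λ u → δ (U - u * u)) * F U)        ≡⟨ ∑-cong (λ U → cong (_* F U) (trans
                                                          (∑-cong (λ u → δ-swap U (u * u)))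
                                                          (square-count U))) ⟩
    ∑ₚ (λ U → (+ 1 + χ U) * F U)                     ∎
    where open ≡-Reasoning

  -- `∑-squares` applied to the constant 1 counts the `p` residues in two ways.
  ∑-χ : ∑ₚ χ ≡ + 0
  ∑-χ = cancel (∑ₚ χ) (trans (sym (trans (∑-squares (λ _ → + 1) (λ _ → refl))
          (∑-combination ((+ 1 , (λ _ → + 1)) ∷ (+ 1 , χ) ∷ []) (λ x → expand (χ x))))) refl)
    where
    expand : ∀ c → (+ 1 + c) * + 1 ≡ + 1 * + 1 + (+ 1 * c + + 0)
    expand = solve-∀
    cancel : ∀ s → + 1 * ∑ₚ (λ _ → + 1) + (+ 1 * s + + 0) ≡ ∑ₚ (λ _ → + 1) → s ≡ + 0
    cancel s e = trans (lemma (∑ₚ (λ _ → + 1)) s) (trans (cong (_- ∑ₚ (λ _ → + 1)) e) (ℤₚ.+-inverseʳ (∑ₚ (λ _ → + 1))))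
      where
      lemma : ∀ q s → s ≡ + 1 * q + (+ 1 * s + + 0) - q
      lemma = solve-∀

  ∑-χ-affine : ∀ a b → ¬ a ≋ + 0 → ∑ₚ (λ x → χ (a * x + b)) ≡ + 0
  ∑-χ-affine a b ha = trans (∑-affine χ χ-cong a b ha) ∑-χ

  private
    ∑-χ-shifted : ∀ e → ∑ₚ (λ x → χ (x * (x + e))) ≡ + p * δ e - + 1
    ∑-χ-shifted e = shifted (zero? e)
      where
      shifted : Dec (e ≋ + 0) → ∑ₚ (λ x → χ (x * (x + e))) ≡ + p * δ e - + 1
      shifted (yes e0) = trans (∑-combination ((+ 1 , (λ _ → + 1)) ∷ (- + 1 , (λ x → δ (x - + 0))) ∷ []) (λ x → point x (zero? x)))
        (trans (cong₂ (λ a b → + 1 * a + (- + 1 * b + + 0)) ∑-one (∑-δ₁ (+ 0)))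
          (trans (lemma (+ p)) (cong (λ z → + p * z - + 1) (sym (δ-one e0)))))
        where
        lemma : ∀ q → + 1 * q + (- + 1 * + 1 + + 0) ≡ q * + 1 - + 1
        lemma = solve-∀
        point : ∀ x → Dec (x ≋ + 0) → χ (x * (x + e)) ≡ + 1 * + 1 + (- + 1 * δ (x - + 0) + + 0)
        point x (yes x0) = trans (χ-zero (*-zeroˡ (x + e) x0)) (sym (cong (λ z → + 1 * + 1 + (- + 1 * z + + 0)) (δ-one (≋⇒0 {x} x0))))
        point x (no hx)  = trans (χ-square x hx (≋-sym (*-congˡ x (≋-trans (+-congˡ x e0) (≋-reflexive (ℤₚ.+-identityʳ x))))))
          (sym (cong (λ z → + 1 * + 1 + (- + 1 * z + + 0)) (δ-zero (λ e → hx (0⇒≋ {x} e)))))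
      -- χ (x (x + e)) = χ (1 + e / x) away from 0.
      shifted (no he) = trans (∑-combination ((+ 1 , (λ x → χ (e * inv x + + 1))) ∷ (- + 1 , (λ x → δ (x - + 0))) ∷ []) (λ x → point x (zero? x)))
        (trans (cong₂ (λ a b → + 1 * a + (- + 1 * b + + 0))
            (trans (∑-inv (λ x → χ (e * x + + 1)) (λ e′ → χ-cong (+-congʳ (+ 1) (*-congˡ e e′)))) (∑-χ-affine e (+ 1) he))
            (∑-δ₁ (+ 0)))
          (cong (λ z → z - + 1) (sym (trans (cong (+ p *_) (δ-zero he)) (ℤₚ.*-zeroʳ (+ p))))))
        where
        point : ∀ x → Dec (x ≋ + 0) → χ (x * (x + e)) ≡ + 1 * χ (e * inv x + + 1) + (- + 1 * δ (x - + 0) + + 0)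
        point x (yes x0) = trans (χ-zero (*-zeroˡ (x + e) x0))
          (sym (cong₂ (λ y z → + 1 * y + (- + 1 * z + + 0))
            (χ-square (+ 1) 1≢0 (≋-reflexive (sym (trans (cong (λ z → e * z + + 1) (inv-zero x0)) (cong (_+ + 1) (ℤₚ.*-zeroʳ e))))))
            (δ-one (≋⇒0 {x} x0))))
        point x (no hx) = trans (χ-cong (by (inv-* hx) (- (x * e)) (lemma x e (inv x))))
          (trans (χ-* (x * x) (e * inv x + + 1)) (trans (cong (_* χ (e * inv x + + 1)) (χ-square x hx ≋-refl))
            (sym (trans (cong (λ z → + 1 * χ (e * inv x + + 1) + (- + 1 * z + + 0)) (δ-zero (λ e → hx (0⇒≋ {x} e))))
              (ℤₚ.+-identityʳ _)))))
          where
          lemma : ∀ x e i → x * (x + e) - x * x * (e * i + + 1) ≡ - (x * e) * (x * i - + 1)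
          lemma = solve-∀

  ∑-χ-product : ∀ a b → ∑ₚ (λ x → χ ((x - a) * (x - b))) ≡ + p * δ (a - b) - + 1
  ∑-χ-product a b = trans (sym (∑-shift (λ x → χ ((x - a) * (x - b)))
      (λ e → χ-cong (*-cong (+-congʳ (- a) e) (+-congʳ (- b) e))) a))
    (trans (∑-cong (λ x → cong χ (lemma x a b))) (∑-χ-shifted (a - b)))
    where
    lemma : ∀ x a b → (x + a - a) * (x + a - b) ≡ x * (x + (a - b))
    lemma = solve-∀

  -- The factor `1 + χ U` from `∑-squares` splits the sum into a linear character sum, which
  -- vanishes, and one with a quadratic having the roots 0 and `d`.
  ∑-χ-squares-minus : ∀ d → ∑ₚ (λ u → χ (u * u - d)) ≡ + p * δ d - + 1
  ∑-χ-squares-minus d = begin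
    ∑ₚ (λ u → χ (u * u - d))
      ≡⟨ ∑-squares (λ U → χ (U - d)) (λ e → χ-cong (+-congʳ (- d) e)) ⟩
    ∑ₚ (λ U → (+ 1 + χ U) * χ (U - d))
      ≡⟨ ∑-combination ((+ 1 , (λ U → χ (+ 1 * U + - d))) ∷ (+ 1 , (λ U → χ ((U - + 0) * (U - d)))) ∷ []) point ⟩
    + 1 * ∑ₚ (λ U → χ (+ 1 * U + - d)) + (+ 1 * ∑ₚ (λ U → χ ((U - + 0) * (U - d))) + + 0)
      ≡⟨ cong₂ (λ a b → + 1 * a + (+ 1 * b + + 0)) (∑-χ-affine (+ 1) (- d) 1≢0) (∑-χ-product (+ 0) d) ⟩
    + 1 * + 0 + (+ 1 * (+ p * δ (+ 0 - d) - + 1) + + 0)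
      ≡⟨ lemma (+ p * δ (+ 0 - d)) ⟩
    + p * δ (+ 0 - d) - + 1
      ≡⟨ cong (λ z → + p * z - + 1) (δ-iff (λ e → ≋-sym (0⇒≋ {+ 0} {d} e)) (λ e → ≋⇒0 {+ 0} {d} (≋-sym e))) ⟩
    + p * δ d - + 1 ∎
    where
    open ≡-Reasoning
    lemma : ∀ z → + 1 * + 0 + (+ 1 * (z - + 1) + + 0) ≡ z - + 1
    lemma = solve-∀
    expand : ∀ a b → (+ 1 + a) * b ≡ + 1 * b + (+ 1 * (a * b) + + 0)
    expand = solve-∀
    point : ∀ U → (+ 1 + χ U) * χ (U - d) ≡ + 1 * χ (+ 1 * U + - d) + (+ 1 * χ ((U - + 0) * (U - d)) + + 0)
    point U = trans (expand (χ U) (χ (U - d))) (cong₂ (λ a b → + 1 * a + (+ 1 * b + + 0))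
      (cong (λ z → χ (z + - d)) (sym (ℤₚ.*-identityˡ U)))
      (trans (sym (χ-* U (U - d))) (cong (λ z → χ (z * (U - d))) (sym (ℤₚ.+-identityʳ U)))))

-- P as a character sum modulo 8

prodℤ-filter : ∀ {A : Set} (f : A → ℤ) (c : A → Bool) xs →
  prodℤ (map f (filterᵇ c xs)) ≡ prodℤ (map (λ x → if c x then f x else + 1) xs)
prodℤ-filter f c [] = refl
prodℤ-filter f c (x ∷ xs) with c x
... | true  = cong (f x *_) (prodℤ-filter f c xs)
... | false = trans (prodℤ-filter f c xs) (sym (ℤₚ.*-identityˡ _))

prodℤ-++ : ∀ xs ys → prodℤ (xs ++ ys) ≡ prodℤ xs * prodℤ ys
prodℤ-++ []       ys = sym (ℤₚ.*-identityˡ _)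
prodℤ-++ (x ∷ xs) ys = trans (cong (x *_) (prodℤ-++ xs ys)) (sym (ℤₚ.*-assoc x _ _))

prodℤ-concatMap : ∀ {A B : Set} (f : B → ℤ) (k : A → List B) xs →
  prodℤ (map f (concatMap k xs)) ≡ prodℤ (map (λ x → prodℤ (map f (k x))) xs)
prodℤ-concatMap f k []       = refl
prodℤ-concatMap f k (x ∷ xs) = trans (cong prodℤ (Listₚ.map-++ f (k x) (concatMap k xs)))
  (trans (prodℤ-++ (map f (k x)) _) (cong (prodℤ (map f (k x)) *_) (prodℤ-concatMap f k xs)))

prodℤ-applyUpTo : ∀ (f : ℕ → ℤ) m → prodℤ (applyUpTo f m) ≡ prod {m} (f ∘ toℕ)
prodℤ-applyUpTo f zero    = refl
prodℤ-applyUpTo f (suc m) = cong (f 0 *_) (prodℤ-applyUpTo (f ∘ suc) m)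

prodℤ-upTo : ∀ (f : ℕ → ℤ) m → prodℤ (map f (upTo m)) ≡ prod {m} (f ∘ toℕ)
prodℤ-upTo f m = trans (cong prodℤ (Listₚ.map-upTo f m)) (prodℤ-applyUpTo f m)

prod-one : ∀ {k} {f : Fin k → ℤ} → (∀ i → f i ≡ + 1) → prod f ≡ + 1
prod-one {zero}  e = refl
prod-one {suc k} e = cong₂ _*_ (e Fin.zero) (prod-one (e ∘ Fin.suc))

-- Padding with factors 1 turns the triangular range of pairs into a square of residues, where rows
-- and columns can be exchanged and reindexed.
prod-restrict : ∀ (f : ℕ → ℤ) {m q} → m ℕ.≤ q →
  prod {m} (f ∘ toℕ) ≡ prod {q} (λ i → if toℕ i ℕ.<ᵇ m then f (toℕ i) else + 1)
prod-restrict f {q = q} z≤n = sym (prod-one {q} (λ _ → refl))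
prod-restrict f (s≤s m≤q) = cong (f 0 *_) (prod-restrict (f ∘ suc) m≤q)

if-cong : ∀ {A : Set} {b b′ : Bool} {x y : A} → b ≡ b′ → (if b then x else y) ≡ (if b′ then x else y)
if-cong refl = refl

module Mod4 = Congruence (+ 4)
module Mod8 = Congruence (+ 8)

-- For signs, `s t - 1` differs from `(s - 1) + (t - 1)` by `(s - 1) (t - 1)`, which is 0 or 4.
prod-mod4 : ∀ {k} {f : Fin k → ℤ} → (∀ i → IsSign (f i)) → prod f - + 1 Mod4.≋ sum (λ i → f i - + 1)
prod-mod4 {zero} e = Mod4.≋-refl
prod-mod4 {suc k} {f} e = Mod4.≋-trans (step (e Fin.zero) (prod-sign (f ∘ Fin.suc) (e ∘ Fin.suc)))
  (Mod4.+-congˡ (f Fin.zero - + 1) (prod-mod4 (e ∘ Fin.suc)))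
  where
  step : ∀ {s t} → IsSign s → IsSign t → s * t - + 1 Mod4.≋ (s - + 1) + (t - + 1)
  step pos pos = Mod4.≋-refl
  step pos neg = Mod4.≋-refl
  step neg pos = Mod4.≋-refl
  step neg neg = Mod4.mod (divides (+ 1) refl)

module Reduction (n : ℕ) (1<n : 1 ℕ.< n) (prime : Prime (suc (n ℕ.+ n))) where

  open CharacterSums n 1<n prime public

  -- The value 1 at multiples of p accounts for the factors that the product P omits.
  χ₁ : ℤ → ℤ
  χ₁ x = χ x + δ x

  χ₁-zero : ∀ {x} → x ≋ + 0 → χ₁ x ≡ + 1
  χ₁-zero e = cong₂ _+_ (χ-zero e) (δ-one e)

  χ₁-χ : ∀ {x} → ¬ x ≋ + 0 → χ₁ x ≡ χ x
  χ₁-χ {x} e = trans (cong (λ z → χ x + z) (δ-zero e)) (ℤₚ.+-identityʳ (χ x))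

  χ₁-sign : ∀ x → IsSign (χ₁ x)
  χ₁-sign x = lemma (zero? x)
    where
    lemma : Dec (x ≋ + 0) → IsSign (χ₁ x)
    lemma (yes e) = subst IsSign (sym (χ₁-zero e)) pos
    lemma (no ¬e) = subst IsSign (sym (χ₁-χ ¬e)) (χ-sign ¬e)

  χ₁-cong : Periodic₁ χ₁
  χ₁-cong e = cong₂ _+_ (χ-cong e) (δ-cong e)

  χ₁-square : ∀ {y} x → ¬ y ≋ + 0 → χ₁ (y * y * x) ≡ χ₁ x
  χ₁-square {y} x hy = cong₂ _+_
    (trans (χ-* (y * y) x) (trans (cong (_* χ x) (χ-square y hy ≋-refl)) (ℤₚ.*-identityˡ (χ x))))
    (δ-iff (λ e → [ (λ e′ → ⊥-elim (*-≢0 hy hy e′)) , (λ e′ → e′) ]′ (euclid (y * y) x e)) (*-zeroʳ (y * y)))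

  χ₁-legendre : ∀ x → (if not (divᵇ p x) then legendre x p else + 1) ≡ χ₁ x
  χ₁-legendre x = lemma (zero? x)
    where
    lemma : Dec (x ≋ + 0) → (if not (divᵇ p x) then legendre x p else + 1) ≡ χ₁ x
    lemma (yes e) = trans (if-cong (cong not (divᵇ-true e))) (sym (χ₁-zero e))
    lemma (no ¬e) = trans (if-cong (cong not (divᵇ-false ¬e))) (trans (sym (χ-legendre x)) (sym (χ₁-χ ¬e)))

  -- For units `v` this is twice the indicator of `χ v = - κ n`, hence even; at 0 it is 1.
  wt : ℤ → ℤ
  wt v = + 1 - κ n * χ v

  -- The values `v = 0` and `v = -1` belong to `j = i` and `j = 0`, which occur in no pair, so their
  -- terms are taken out of the complete sum; at 0 the weight is 1.
  W : (ℤ → ℤ) → ℤ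
  W θ = ∑ₚ (λ v → wt v * (+ 1 - θ v)) - (+ 1 - θ (+ 0)) - wt (- + 1) * (+ 1 - θ (- + 1))

  module _ (a b c : ℤ) where

    f : ℤ → ℤ → ℤ
    f = form a b c

    g : ℤ → ℤ
    g v = f (+ 1) (+ 1 + v)

    θ : ℤ → ℤ
    θ v = χ₁ (g v)

    f-cong : ∀ {x y x′ y′} → x ≋ x′ → y ≋ y′ → f x y ≋ f x′ y′
    f-cong e e′ = +-cong (+-cong (*-cong (*-congˡ a e) e) (*-cong (*-congˡ b e) e′)) (*-cong (*-congˡ c e′) e′)

    θ-cong : Periodic₁ θ
    θ-cong e = χ₁-cong (f-cong ≋-refl (+-congˡ (+ 1) e))

    -- Expresses `i < j` by membership of `j - i` in the half system. The conditions thereby become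
    -- periodic in both arguments, which permits substitutions modulo `p`.
    cell : ℤ → ℤ → ℤ
    cell x y = if inH y ∧ (inH x ∧ inH (y - x)) then χ₁ (f x y) else + 1

    cell-cong : ∀ {x y x′ y′} → x ≋ x′ → y ≋ y′ → cell x y ≡ cell x′ y′
    cell-cong {x} {y} {x′} {y′} e e′ = trans
      (if-cong (cong₂ _∧_ (inH-cong e′) (cong₂ _∧_ (inH-cong e) (inH-cong (+-cong e′ (neg-cong e))))))
      (cong (if inH y′ ∧ (inH x′ ∧ inH (y′ - x′)) then_else + 1) (χ₁-cong (f-cong e e′)))

    private
      lower : ∀ {k} → k ℕ.≤ n → (2 ℕ.* k ℕ.<ᵇ p) ≡ true
      lower {k} h = <ᵇ-true (s≤s (ℕₚ.+-mono-≤ h (ℕₚ.≤-trans (ℕₚ.≤-reflexive (ℕₚ.+-identityʳ k)) h)))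

      upper : ∀ {k} → n ℕ.< k → (2 ℕ.* k ℕ.<ᵇ p) ≡ false
      upper {suc k} h@(s≤s n≤k) = <ᵇ-false (s≤s (ℕₚ.+-mono-≤ n≤k (ℕₚ.≤-trans (ℕₚ.<⇒≤ h)
        (ℕₚ.≤-reflexive (sym (ℕₚ.+-identityʳ (suc k)))))))

      inH-lower : ∀ {k} → 0 ℕ.< k → k ℕ.≤ n → inH (+ k) ≡ true
      inH-lower {suc k} _ h = inH-plus (fromℕ< h) (≋-reflexive (cong (+_ ∘ suc) (sym (Finₚ.toℕ-fromℕ< h))))

      inH-upper : ∀ {k} → k ℕ.< p → n ℕ.< k → inH (+ k) ≡ false
      inH-upper k<p h = trans (cong half (ℕD.m<n⇒m%n≡m k<p)) (half-false h)

      inH-negative : ∀ {k} → 0 ℕ.< k → k ℕ.≤ n → inH (- + k) ≡ false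
      inH-negative {suc k} _ h = inH-minus (fromℕ< h) (≋-reflexive (cong (λ k → - + suc k) (sym (Finₚ.toℕ-fromℕ< h))))

      and₂ : ∀ {b} b′ → b ≡ false → b′ ∧ b ≡ false
      and₂ b′ refl = ∧-zeroʳ b′

      -- If `i < j` lie in the half system, so does `j - i`. If `j ≤ i`, then `j - i` is 0 or the
      -- negative of an element of the half system, unless `i` already exceeds `n`.
      cell-ℕ : ∀ i j → i ℕ.< p → j ℕ.< p →
        (if 2 ℕ.* j ℕ.<ᵇ p then (if i ℕ.<ᵇ j then (if 0 ℕ.<ᵇ i then χ₁ (f (+ i) (+ j)) else + 1) else + 1) else + 1)
        ≡ cell (+ i) (+ j)
      cell-ℕ i j i<p j<p = split (j ℕₚ.≤? n) (i ℕₚ.<? j)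
        where
        inside : ∀ i → 0 ℕ.< i → i ℕ.< j → j ℕ.≤ n → inH (+ j) ∧ (inH (+ i) ∧ inH (+ j - + i)) ≡ true
        inside i 0<i i<j j≤n = cong₂ _∧_ (inH-lower (ℕₚ.<-trans 0<i i<j) j≤n)
          (cong₂ _∧_ (inH-lower 0<i (ℕₚ.≤-trans (ℕₚ.<⇒≤ i<j) j≤n))
            (trans (cong inH (trans (ℤₚ.m-n≡m⊖n j i) (ℤₚ.⊖-≥ (ℕₚ.<⇒≤ i<j))))
              (inH-lower (ℕₚ.m<n⇒0<n∸m i<j) (ℕₚ.≤-trans (ℕₚ.m∸n≤m j i) j≤n))))
        outside : j ℕ.≤ i → inH (+ i) ∧ inH (+ j - + i) ≡ false
        outside j≤i = by-cases (j ℕₚ.≟ i) (i ℕₚ.≤? n)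
          where
          by-cases : Dec (j ≡ i) → Dec (i ℕ.≤ n) → inH (+ i) ∧ inH (+ j - + i) ≡ false
          by-cases (yes refl) _ = and₂ (inH (+ i)) (inH-zero (≋⇒0 {+ i} {+ i} ≋-refl))
          by-cases (no j≢i) (yes i≤n) = and₂ (inH (+ i)) (trans
            (cong inH (trans (ℤₚ.m-n≡m⊖n j i) (ℤₚ.⊖-≤ j≤i)))
            (inH-negative (ℕₚ.m<n⇒0<n∸m (ℕₚ.≤∧≢⇒< j≤i j≢i)) (ℕₚ.≤-trans (ℕₚ.m∸n≤m i j) i≤n)))
          by-cases (no j≢i) (no i≰n) = cong (_∧ inH (+ j - + i)) (inH-upper i<p (ℕₚ.≰⇒> i≰n))
        split : Dec (j ℕ.≤ n) → Dec (i ℕ.< j) →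
          (if 2 ℕ.* j ℕ.<ᵇ p then (if i ℕ.<ᵇ j then (if 0 ℕ.<ᵇ i then χ₁ (f (+ i) (+ j)) else + 1) else + 1) else + 1)
          ≡ cell (+ i) (+ j)
        split (no j≰n) _ = trans (if-cong (upper (ℕₚ.≰⇒> j≰n)))
          (sym (if-cong (cong (_∧ (inH (+ i) ∧ inH (+ j - + i))) (inH-upper j<p (ℕₚ.≰⇒> j≰n)))))
        split (yes j≤n) (no i≮j) = trans (if-cong (lower j≤n)) (trans (if-cong (<ᵇ-false (ℕₚ.≮⇒≥ i≮j)))
          (sym (if-cong (and₂ (inH (+ j)) (outside (ℕₚ.≮⇒≥ i≮j))))))
        split (yes j≤n) (yes i<j) = trans (if-cong (lower j≤n)) (trans (if-cong (<ᵇ-true i<j)) (positive i i<j))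
          where
          positive : ∀ i → i ℕ.< j → (if 0 ℕ.<ᵇ i then χ₁ (f (+ i) (+ j)) else + 1) ≡ cell (+ i) (+ j)
          positive zero    i<j = sym (if-cong (and₂ (inH (+ j)) (cong (_∧ inH (+ j - + 0)) (inH-zero {+ 0} ≋-refl))))
          positive (suc i) i<j = sym (if-cong (inside (suc i) (s≤s z≤n) i<j j≤n))

    P-cells : P a b c p ≡ prod {p} (λ i → prod {p} (λ j → cell (rep i) (rep j)))
    P-cells = begin
      P a b c p
        ≡⟨ prodℤ-filter (λ ij → legendre (F ij) p) (λ ij → not (divᵇ p (F ij))) (pairs p) ⟩
      prodℤ (map value (pairs p))
        ≡⟨ prodℤ-concatMap value (λ j → map (λ i → (i , j)) (column j)) (filterᵇ (λ j → 2 ℕ.* j ℕ.<ᵇ p) (upTo p)) ⟩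
      prodℤ (map line (filterᵇ (λ j → 2 ℕ.* j ℕ.<ᵇ p) (upTo p)))
        ≡⟨ prodℤ-filter line (λ j → 2 ℕ.* j ℕ.<ᵇ p) (upTo p) ⟩
      prodℤ (map (λ j → if 2 ℕ.* j ℕ.<ᵇ p then line j else + 1) (upTo p))
        ≡⟨ prodℤ-upTo (λ j → if 2 ℕ.* j ℕ.<ᵇ p then line j else + 1) p ⟩
      prod {p} (λ j → if 2 ℕ.* toℕ j ℕ.<ᵇ p then line (toℕ j) else + 1)
        ≡⟨ prod-cong-≗ {p} (λ j → cong (if 2 ℕ.* toℕ j ℕ.<ᵇ p then_else + 1) (line-value (toℕ j) (ℕₚ.<⇒≤ (Finₚ.toℕ<n j)))) ⟩
      prod {p} (λ j → if 2 ℕ.* toℕ j ℕ.<ᵇ p then prod {p} (entry (toℕ j)) else + 1)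
        ≡⟨ prod-cong-≗ {p} (λ j → trans (push (2 ℕ.* toℕ j ℕ.<ᵇ p) (entry (toℕ j)))
             (prod-cong-≗ {p} (λ i → cell-ℕ (toℕ i) (toℕ j) (Finₚ.toℕ<n i) (Finₚ.toℕ<n j)))) ⟩
      prod {p} (λ j → prod {p} (λ i → cell (rep i) (rep j)))
        ≡⟨ prod-comm {p} {p} (λ j i → cell (rep i) (rep j)) ⟩
      prod {p} (λ i → prod {p} (λ j → cell (rep i) (rep j))) ∎
      where
      open ≡-Reasoning
      F : ℕ × ℕ → ℤ
      F (i , j) = f (+ i) (+ j)
      value : ℕ × ℕ → ℤ
      value ij = if not (divᵇ p (F ij)) then legendre (F ij) p else + 1
      column : ℕ → List ℕ
      column j = filterᵇ (λ i → 0 ℕ.<ᵇ i) (upTo j)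
      line : ℕ → ℤ
      line j = prodℤ (map value (map (λ i → (i , j)) (column j)))
      entry : ℕ → Fin p → ℤ
      entry j i = if toℕ i ℕ.<ᵇ j then (if 0 ℕ.<ᵇ toℕ i then χ₁ (f (rep i) (+ j)) else + 1) else + 1
      push : ∀ (b : Bool) (t : Fin p → ℤ) → (if b then prod {p} t else + 1) ≡ prod {p} (λ i → if b then t i else + 1)
      push true  t = refl
      push false t = sym (prod-one {p} (λ _ → refl))
      line-value : ∀ j → j ℕ.≤ p → line j ≡ prod {p} (entry j)
      line-value j j≤p = begin
        line j
          ≡⟨ cong prodℤ (Listₚ.map-∘ (column j)) ⟨
        prodℤ (map (λ i → value (i , j)) (column j))
          ≡⟨ prodℤ-filter (λ i → value (i , j)) (λ i → 0 ℕ.<ᵇ i) (upTo j) ⟩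
        prodℤ (map (λ i → if 0 ℕ.<ᵇ i then value (i , j) else + 1) (upTo j))
          ≡⟨ prodℤ-upTo (λ i → if 0 ℕ.<ᵇ i then value (i , j) else + 1) j ⟩
        prod {j} (λ i → if 0 ℕ.<ᵇ toℕ i then value (toℕ i , j) else + 1)
          ≡⟨ prod-cong-≗ {j} (λ i → cong (if 0 ℕ.<ᵇ toℕ i then_else + 1) (χ₁-legendre (F (toℕ i , j)))) ⟩
        prod {j} (λ i → if 0 ℕ.<ᵇ toℕ i then χ₁ (f (+ toℕ i) (+ j)) else + 1)
          ≡⟨ prod-restrict (λ i → if 0 ℕ.<ᵇ i then χ₁ (f (+ i) (+ j)) else + 1) j≤p ⟩
        prod {p} (entry j) ∎

    factor : ℤ → ℤ
    factor v = prod {n} (λ k → if inH (v * h k) ∧ inH ((+ 1 + v) * h k) then θ v else + 1)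

    -- For fixed `i` in the half system put `j = (1 + v) i`. By homogeneity `f i j` is `i² * g v`,
    -- the square is invisible to `χ₁`, and the products over `i` and `v` are exchanged.
    P-factors : P a b c p ≡ prod {p} (λ i → factor (rep i))
    P-factors = begin
      P a b c p
        ≡⟨ P-cells ⟩
      prod {p} (λ i → row (rep i))
        ≡⟨ HalfProduct.fold-halves row (λ e → prod-cong-≗ {p} (λ j → cell-cong e (≋-refl {rep j}))) ⟩
      row (+ 0) * prod {n} (λ k → row (h k) * row (- h k))
        ≡⟨ cong₂ _*_ (row-one (inH-zero {+ 0} ≋-refl)) (prod-cong-≗ {n} (λ k →
             trans (cong (row (h k) *_) (row-one (inH-minus { - h k} k ≋-refl))) (ℤₚ.*-identityʳ (row (h k))))) ⟩
      + 1 * prod {n} (λ k → row (h k))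
        ≡⟨ ℤₚ.*-identityˡ (prod {n} (λ k → row (h k))) ⟩
      prod {n} (λ k → row (h k))
        ≡⟨ prod-cong-≗ {n} (λ k → trans (sym (reindex k)) (prod-cong-≗ {p} (λ i → point k (rep i)))) ⟩
      prod {n} (λ k → prod {p} (λ i → if inH (rep i * h k) ∧ inH ((+ 1 + rep i) * h k) then θ (rep i) else + 1))
        ≡⟨ prod-comm {n} {p} (λ k i → if inH (rep i * h k) ∧ inH ((+ 1 + rep i) * h k) then θ (rep i) else + 1) ⟩
      prod {p} (λ i → factor (rep i)) ∎
      where
      open ≡-Reasoning
      module FullProduct = FullRange ℤₚ.*-1-commutativeMonoid
      row : ℤ → ℤ
      row x = prod {p} (λ j → cell x (rep j))
      row-one : ∀ {x} → inH x ≡ false → row x ≡ + 1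
      row-one {x} e = prod-one {p} (λ j → if-cong {x = χ₁ (f x (rep j))} {y = + 1}
        (and₂ (inH (rep j)) (cong (_∧ inH (rep j - x)) e)))
      reindex : ∀ k → prod {p} (λ i → cell (h k) ((+ 1 + rep i) * h k)) ≡ row (h k)
      reindex k = FullProduct.fold-permute (cell (h k)) (λ e → cell-cong (≋-refl {h k}) e)
        (λ v → (+ 1 + v) * h k) (λ y → inv (h k) * y - + 1)
        (λ e → *-congʳ (h k) (+-congˡ (+ 1) e)) (λ e → +-congʳ (- + 1) (*-congˡ (inv (h k)) e))
        (λ y → by (inv-* (h≢0 k)) y (there′ (h k) (inv (h k)) y))
        (λ v → by (inv-* (h≢0 k)) (+ 1 + v) (back (h k) (inv (h k)) v))
        where
        there′ : ∀ k i y → (+ 1 + (i * y - + 1)) * k - y ≡ y * (k * i - + 1)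
        there′ = solve-∀
        back : ∀ k i v → (i * ((+ 1 + v) * k) - + 1) - v ≡ (+ 1 + v) * (k * i - + 1)
        back = solve-∀
      point : ∀ k v → cell (h k) ((+ 1 + v) * h k) ≡ (if inH (v * h k) ∧ inH ((+ 1 + v) * h k) then θ v else + 1)
      point k v = trans (cong (if inH ((+ 1 + v) * h k) ∧ (inH (h k) ∧ inH ((+ 1 + v) * h k - h k)) then_else + 1)
          (trans (cong χ₁ (homogeneous a b c (h k) v)) (χ₁-square {h k} (g v) (h≢0 k))))
        (if-cong (trans (cong (inH ((+ 1 + v) * h k) ∧_) (cong₂ _∧_ (inH-plus {h k} k ≋-refl) (cong inH (gap (h k) v))))
          (∧-comm (inH ((+ 1 + v) * h k)) (inH (v * h k)))))
        where
        homogeneous : ∀ a b c k v →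
          a * k * k + b * k * ((+ 1 + v) * k) + c * ((+ 1 + v) * k) * ((+ 1 + v) * k) ≡
          k * k * (a * + 1 * + 1 + b * + 1 * (+ 1 + v) + c * (+ 1 + v) * (+ 1 + v))
        homogeneous = solve-∀
        gap : ∀ k v → (+ 1 + v) * k - k ≡ v * k
        gap = solve-∀

    factor-sign : ∀ v → IsSign (factor v)
    factor-sign v = prod-sign {n} _ (λ k → choose (inH (v * h k) ∧ inH ((+ 1 + v) * h k)))
      where
      choose : ∀ b → IsSign (if b then θ v else + 1)
      choose true  = χ₁-sign (g v)
      choose false = pos

    corner : ℤ
    corner = wt (- + 1) * (+ 1 - θ (- + 1))

    factor-value : ∀ v → + 2 * (factor v - + 1) ≡
      - wt v * (+ 1 - θ v) + δ v * (+ 1 - θ (+ 0)) +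
      δ (v - - + 1) * corner
    factor-value v = split (zero? v) (zero? (v - - + 1)) (χ₁-sign (g v)) refl
      where
      Goal : Set
      Goal = + 2 * (factor v - + 1) ≡ - wt v * (+ 1 - θ v) + δ v * (+ 1 - θ (+ 0)) +
                δ (v - - + 1) * corner
      fill : ∀ {F K t d d′} → factor v ≡ F → κ n * χ v ≡ K → θ v ≡ t → δ v ≡ d → δ (v - - + 1) ≡ d′ →
             + 2 * (F - + 1) ≡ - (+ 1 - K) * (+ 1 - t) + d * (+ 1 - θ (+ 0)) +
                d′ * corner → Goal
      fill refl refl refl refl refl e = e
      split : ∀ {t} → Dec (v ≋ + 0) → Dec (v - - + 1 ≋ + 0) → IsSign t → θ v ≡ t → Goal
      split (yes v0) (yes v1) _ _ = ⊥-elim (1≢0 (by₂ v1 v0 (+ 1) (- + 1) (lemma v)))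
        where
        lemma : ∀ v → + 1 - + 0 ≡ + 1 * (v - - + 1 - + 0) + - + 1 * (v - + 0)
        lemma = solve-∀
      split (yes v0) (no hv1) _ _ = fill
        (prod-one {n} (λ k → if-cong (cong (_∧ inH ((+ 1 + v) * h k)) (inH-zero (*-zeroˡ (h k) v0)))))
        (trans (cong (κ n *_) (χ-zero v0)) (ℤₚ.*-zeroʳ (κ n))) (θ-cong v0) (δ-one v0) (δ-zero hv1)
        (lemma (θ (+ 0)) corner)
        where
        lemma : ∀ t u → + 2 * (+ 1 - + 1) ≡ - (+ 1 - + 0) * (+ 1 - t) + + 1 * (+ 1 - t) + + 0 * u
        lemma = solve-∀
      split (no hv) (yes v1) _ _ = fill
        (prod-one {n} (λ k → if-cong (and₂ (inH (v * h k)) (inH-zero (*-zeroˡ {+ 1 + v} (h k) (by v1 (+ 1) (shift v)))))))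
        (cong (κ n *_) (χ-cong (0⇒≋ {v} { - + 1} v1))) (θ-cong (0⇒≋ {v} { - + 1} v1)) (δ-zero hv) (δ-one v1)
        (lemma (θ (+ 0)) (κ n * χ (- + 1)) (θ (- + 1)))
        where
        shift : ∀ v → + 1 + v - + 0 ≡ + 1 * (v - - + 1 - + 0)
        shift = solve-∀
        lemma : ∀ t K u → + 2 * (+ 1 - + 1) ≡ - (+ 1 - K) * (+ 1 - u) + + 0 * (+ 1 - t) + + 1 * ((+ 1 - K) * (+ 1 - u))
        lemma = solve-∀
      split (no hv) (no hv1) pos t = fill
        (prod-one {n} (λ k → trans (cong (if inH (v * h k) ∧ inH ((+ 1 + v) * h k) then_else + 1) t)
          (const (inH (v * h k) ∧ inH ((+ 1 + v) * h k)))))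
        refl t (δ-zero hv) (δ-zero hv1) (lemma (κ n * χ v) (+ 1 - θ (+ 0)) corner)
        where
        const : ∀ b → (if b then + 1 else + 1) ≡ + 1
        const true  = refl
        const false = refl
        lemma : ∀ K t u → + 2 * (+ 1 - + 1) ≡ - (+ 1 - K) * (+ 1 - + 1) + + 0 * t + + 0 * u
        lemma = solve-∀
      split (no hv) (no hv1) neg t = fill
        (trans (prod-cong-≗ {n} (λ k → cong (if inH (v * h k) ∧ inH ((+ 1 + v) * h k) then_else + 1) t))
          (marker-prod v hv (λ e → hv1 (by e (+ 1) (shift v)))))
        refl t (δ-zero hv) (δ-zero hv1) (lemma (κ n * χ v) (+ 1 - θ (+ 0)) corner)
        where
        shift : ∀ v → v - - + 1 - + 0 ≡ + 1 * (+ 1 + v - + 0)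
        shift = solve-∀
        lemma : ∀ K t u → + 2 * (K - + 1) ≡ - (+ 1 - K) * (+ 1 - - + 1) + + 0 * t + + 0 * u
        lemma = solve-∀

    P-sign : IsSign (P a b c p)
    P-sign = subst IsSign (sym P-factors) (prod-sign {p} _ (λ i → factor-sign (rep i)))

    -- `prod-mod4` gives a sum modulo 4; the doubling that `factor-value` requires raises the
    -- modulus to 8.
    P-mod8 : + 2 * P a b c p Mod8.≋ + 2 - W θ
    P-mod8 = Mod8.≋-trans (double (Mod4.≋-trans
        (Mod4.≋-reflexive (cong (_- + 1) P-factors)) (prod-mod4 {p} (λ i → factor-sign (rep i)))))
      (Mod8.≋-reflexive (trans (cong (λ z → + 2 + z) twice) (regroup (∑ₚ (λ v → wt v * (+ 1 - θ v)))
        (+ 1 - θ (+ 0)) corner)))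
      where
      double : ∀ {x y} → x - + 1 Mod4.≋ y → + 2 * x Mod8.≋ + 2 + + 2 * y
      double {x} {y} (Mod4.mod (divides q e)) = Mod8.mod (divides q (trans (lemma₁ x y) (trans (cong (+ 2 *_) e) (lemma₂ q))))
        where
        lemma₁ : ∀ x y → + 2 * x - (+ 2 + + 2 * y) ≡ + 2 * (x - + 1 - y)
        lemma₁ = solve-∀
        lemma₂ : ∀ q → + 2 * (q * + 4) ≡ q * + 8
        lemma₂ = solve-∀
      twice : + 2 * ∑ₚ (λ v → factor v - + 1) ≡
        - + 1 * ∑ₚ (λ v → wt v * (+ 1 - θ v)) +
        ((+ 1 - θ (+ 0)) * + 1 + (corner * + 1 + + 0))
      twice = trans (sym (∑-*ˡ (+ 2) (λ v → factor v - + 1)))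
        (trans (∑-combination
          ((- + 1 , (λ v → wt v * (+ 1 - θ v))) ∷ (+ 1 - θ (+ 0) , (λ v → δ (v - + 0))) ∷
           (corner , (λ v → δ (v - - + 1))) ∷ [])
          (λ v → trans (factor-value v) (trans
            (cong (λ z → - wt v * (+ 1 - θ v) + δ z * (+ 1 - θ (+ 0)) +
              δ (v - - + 1) * corner) (sym (ℤₚ.+-identityʳ v)))
            (lemma (wt v) (+ 1 - θ v) (δ (v - + 0)) (+ 1 - θ (+ 0)) (δ (v - - + 1))
              corner))))
          (cong₂ (λ x y → - + 1 * ∑ₚ (λ v → wt v * (+ 1 - θ v)) +
            ((+ 1 - θ (+ 0)) * x + (corner * y + + 0))) (∑-δ₁ (+ 0)) (∑-δ₁ (- + 1))))
        where
        lemma : ∀ A B d t d′ u → - A * B + d * t + d′ * u ≡ - + 1 * (A * B) + (t * d + (u * d′ + + 0))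
        lemma = solve-∀
      regroup : ∀ s t u → + 2 + (- + 1 * s + (t * + 1 + (u * + 1 + + 0))) ≡ + 2 - (s - t - u)
      regroup = solve-∀

-- Explicit functions of the residue of p

module Mod16 = Congruence (+ 16)

odd-prime : (Q : ℕ → Set) → (∀ n → 1 ℕ.< n → Prime (suc (n ℕ.+ n)) → Q (suc (n ℕ.+ n))) →
            ∀ p → Prime p → 3 ℕ.< p → Q p
odd-prime Q q p pr 3<p = cases (p ℕ.% 2) refl (ℕD.m%n<n p 2)
  where
  n = p ℕ./ 2
  double : n ℕ.* 2 ≡ n ℕ.+ n
  double = trans (ℕₚ.*-comm n 2) (cong (n ℕ.+_) (ℕₚ.+-identityʳ n))
  cases : ∀ r → p ℕ.% 2 ≡ r → r ℕ.< 2 → Q p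
  cases zero e _ = ⊥-elim (not-two (prime⇒irreducible pr (ℕ∣.m%n≡0⇒n∣m p 2 e)))
    where
    not-two : 2 ≡ 1 ⊎ 2 ≡ p → ⊥
    not-two (inj₂ e) = ℕₚ.<-irrefl e (ℕₚ.<-trans (ℕₚ.n<1+n 2) 3<p)
  cases (suc zero) e _ = subst Q (sym eq) (q n 1<n (subst Prime eq pr))
    where
    eq : p ≡ suc (n ℕ.+ n)
    eq = trans (ℕD.m≡m%n+[m/n]*n p 2) (cong₂ ℕ._+_ e double)
    1<n : 1 ℕ.< n
    1<n = ℕₚ.≰⇒> (λ n≤1 → ℕₚ.<⇒≱ 3<p (subst (ℕ._≤ 3) (sym eq) (s≤s (ℕₚ.+-mono-≤ n≤1 n≤1))))
  cases (suc (suc r)) e (s≤s (s≤s ()))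

half-odd : ∀ n → suc (n ℕ.+ n) ℕ./ 2 ≡ n
half-odd n = begin
  suc (n ℕ.+ n) ℕ./ 2           ≡⟨ cong (λ z → suc z ℕ./ 2) (trans (cong (n ℕ.+_) (sym (ℕₚ.+-identityʳ n))) (ℕₚ.*-comm 2 n)) ⟩
  (1 ℕ.+ n ℕ.* 2) ℕ./ 2         ≡⟨ ℕD.+-distrib-/-∣ʳ 1 {n ℕ.* 2} {2} (ℕ∣.divides n refl) ⟩
  1 ℕ./ 2 ℕ.+ n ℕ.* 2 ℕ./ 2     ≡⟨ ℕD.m*n/n≡m n 2 ⟩
  n                             ∎
  where open ≡-Reasoning

≤/⇒*≤ : ∀ {a b} c .{{_ : NonZero c}} → a ℕ.≤ b ℕ./ c → a ℕ.* c ℕ.≤ b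
≤/⇒*≤ {a} {b} c h = ℕₚ.≤-trans (ℕₚ.*-monoˡ-≤ c h) (ℕD.m/n*n≤m b c)

*≤⇒≤/ : ∀ {a b} c .{{_ : NonZero c}} → a ℕ.* c ℕ.≤ b → a ℕ.≤ b ℕ./ c
*≤⇒≤/ {a} {b} c h = ℕₚ.≤-trans (ℕₚ.≤-reflexive (sym (ℕD.m*n/n≡m a c))) (ℕD./-monoˡ-≤ c h)

*-odd-< : ∀ {l d} n → l ℕ.≤ suc d → l ℕ.* suc (n ℕ.+ n) ℕ.< suc n ℕ.* (2 ℕ.* suc d)
*-odd-< {l} {d} n h = begin-strict
  l ℕ.* suc (n ℕ.+ n)             ≤⟨ ℕₚ.*-monoˡ-≤ (suc (n ℕ.+ n)) h ⟩
  suc d ℕ.* suc (n ℕ.+ n)         <⟨ ℕₚ.*-monoʳ-< (suc d) (s≤s (ℕₚ.≤-reflexive (sym (ℕₚ.+-suc n n)))) ⟩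
  suc d ℕ.* (suc n ℕ.+ suc n)     ≡⟨ cong (λ z → suc d ℕ.* (suc n ℕ.+ z)) (ℕₚ.+-identityʳ (suc n)) ⟨
  suc d ℕ.* (2 ℕ.* suc n)         ≡⟨ ℕₚ.*-assoc (suc d) 2 (suc n) ⟨
  suc d ℕ.* 2 ℕ.* suc n           ≡⟨ ℕₚ.*-comm (suc d ℕ.* 2) (suc n) ⟩
  suc n ℕ.* (suc d ℕ.* 2)         ≡⟨ cong (suc n ℕ.*_) (ℕₚ.*-comm (suc d) 2) ⟩
  suc n ℕ.* (2 ℕ.* suc d)         ∎
  where open ℕₚ.≤-Reasoning

-- Spreads the sign of `q` over an index range independent of `q`, so that a parity of floors
-- becomes a double product whose order can be exchanged.
prod-threshold : ∀ {k q} → q ℕ.≤ k → prod {k} (λ l → if toℕ l ℕ.<ᵇ q then - + 1 else + 1) ≡ sg q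
prod-threshold {k} z≤n = prod-one {k} (λ _ → refl)
prod-threshold (s≤s h) = trans (cong (- + 1 *_) (prod-threshold h)) (ℤₚ.-1*i≡-i _)

module GaussFloor (n : ℕ) (1<n : 1 ℕ.< n) (pr : Prime (suc (n ℕ.+ n))) where

  open Reduction n 1<n pr public

  -- Removing multiples of `p` from `x` changes the floor of `2 x / p` by an even number. For the
  -- remainder the floor is 0 in the half system and 1 outside.
  s-floor : ∀ x → ¬ + x ≋ + 0 → s (+ x) ≡ sg (2 ℕ.* x ℕ./ p)
  s-floor x hx = cases (r ℕₚ.≤? n)
    where
    open ≡-Reasoning
    r q : ℕ
    r = x ℕ.% p
    q = x ℕ./ p
    2x : 2 ℕ.* x ≡ 2 ℕ.* r ℕ.+ 2 ℕ.* q ℕ.* p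
    2x = trans (cong (2 ℕ.*_) (ℕD.m≡m%n+[m/n]*n x p)) (trans (ℕₚ.*-distribˡ-+ 2 r (q ℕ.* p))
           (cong (2 ℕ.* r ℕ.+_) (sym (ℕₚ.*-assoc 2 q p))))
    floor : sg (2 ℕ.* x ℕ./ p) ≡ sg (2 ℕ.* r ℕ./ p)
    floor = begin
      sg (2 ℕ.* x ℕ./ p)                                ≡⟨ cong (λ z → sg (z ℕ./ p)) 2x ⟩
      sg ((2 ℕ.* r ℕ.+ 2 ℕ.* q ℕ.* p) ℕ./ p)            ≡⟨ cong sg (ℕD.+-distrib-/-∣ʳ (2 ℕ.* r) (ℕ∣.divides (2 ℕ.* q) refl)) ⟩
      sg (2 ℕ.* r ℕ./ p ℕ.+ 2 ℕ.* q ℕ.* p ℕ./ p)        ≡⟨ cong (λ z → sg (2 ℕ.* r ℕ./ p ℕ.+ z)) (ℕD.m*n/n≡m (2 ℕ.* q) p) ⟩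
      sg (2 ℕ.* r ℕ./ p ℕ.+ 2 ℕ.* q)                    ≡⟨ sg-even (2 ℕ.* r ℕ./ p) q ⟩
      sg (2 ℕ.* r ℕ./ p)                                ∎
    r+r : 2 ℕ.* r ≡ r ℕ.+ r
    r+r = cong (r ℕ.+_) (ℕₚ.+-identityʳ r)
    half-r : ∀ r → r ≡ x ℕ.% p → r ℕ.≤ n → half r ≡ true
    half-r zero    e _ = ⊥-elim (hx (≋-trans (≋-sym (%-≋ (+ x))) (≋-reflexive (cong +_ (sym e)))))
    half-r (suc r) e h = half-true h
    cases : Dec (r ℕ.≤ n) → s (+ x) ≡ sg (2 ℕ.* x ℕ./ p)
    cases (yes r≤n) = trans (if-cong (half-r r refl r≤n))
      (sym (trans floor (cong sg (ℕD.m<n⇒m/n≡0 (s≤s (subst (ℕ._≤ n ℕ.+ n) (sym r+r) (ℕₚ.+-mono-≤ r≤n r≤n)))))))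
    cases (no r≰n) = trans (if-cong (half-false (ℕₚ.≰⇒> r≰n))) (sym (trans floor (cong sg (begin
      2 ℕ.* r ℕ./ p              ≡⟨ cong (ℕ._/ p) (sym (ℕₚ.m+[n∸m]≡n p≤2r)) ⟩
      (p ℕ.+ t) ℕ./ p            ≡⟨ ℕD.+-distrib-/-∣ˡ t ℕ∣.∣-refl ⟩
      p ℕ./ p ℕ.+ t ℕ./ p        ≡⟨ cong₂ ℕ._+_ (ℕD.n/n≡1 p) (ℕD.m<n⇒m/n≡0 t<p) ⟩
      1                          ∎))))
      where
      t : ℕ
      t = 2 ℕ.* r ℕ.∸ p
      p≤2r : p ℕ.≤ 2 ℕ.* r
      p≤2r = subst (p ℕ.≤_) (sym r+r) (ℕₚ.+-mono-≤ (ℕₚ.≰⇒> r≰n) (ℕₚ.<⇒≤ (ℕₚ.≰⇒> r≰n)))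
      t<p : t ℕ.< p
      t<p = ℕₚ.+-cancelˡ-< p t p (subst (ℕ._< p ℕ.+ p) (trans (sym r+r) (sym (ℕₚ.m+[n∸m]≡n p≤2r)))
        (ℕₚ.+-mono-< (ℕD.m%n<n x p) (ℕD.m%n<n x p)))

  -- Eisenstein's count of lattice points: the signs in Gauss's lemma are parities of the numbers of
  -- `l` with `l p < 2 d j`. Counting by `l` instead of `j` leaves `d` factors, a number independent
  -- of `p`, each determined by the parities of `n` and of the floor of `l p / (2 d)`.
  χ-floor : ∀ e → ¬ + suc e ≋ + 0 →
    χ (+ suc e) ≡ prod {suc e} (λ l → sg n * sg (suc (toℕ l) ℕ.* p ℕ./ (2 ℕ.* suc e)))
  χ-floor e he = begin
    χ (+ d)
      ≡⟨ χ-gauss (+ d) he ⟩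
    prod {n} (λ j → s (+ d * h j))
      ≡⟨ prod-cong-≗ {n} (λ j → trans (cong s (sym (ℤₚ.pos-* d (suc (toℕ j))))) (trans
           (s-floor (d ℕ.* suc (toℕ j)) (λ z → *-≢0 he (h≢0 j) (subst (_≋ + 0) (ℤₚ.pos-* d (suc (toℕ j))) z)))
           (sym (prod-threshold (X/p≤d j))))) ⟩
    prod {n} (λ j → prod {d} (λ l → if toℕ l ℕ.<ᵇ X j ℕ./ p then - + 1 else + 1))
      ≡⟨ prod-cong-≗ {n} (λ j → prod-cong-≗ {d} (λ l → flip j l (suc (toℕ j) ℕ.* (2 ℕ.* d) ℕₚ.≤? suc (toℕ l) ℕ.* p))) ⟩
    prod {n} (λ j → prod {d} (λ l → - + 1 * (if toℕ j ℕ.<ᵇ t l then - + 1 else + 1)))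
      ≡⟨ prod-comm {n} {d} (λ j l → - + 1 * (if toℕ j ℕ.<ᵇ t l then - + 1 else + 1)) ⟩
    prod {d} (λ l → prod {n} (λ j → - + 1 * (if toℕ j ℕ.<ᵇ t l then - + 1 else + 1)))
      ≡⟨ prod-cong-≗ {d} (λ l → trans (prod-distrib-* {n} (λ _ → - + 1) (λ j → if toℕ j ℕ.<ᵇ t l then - + 1 else + 1))
           (cong₂ _*_ (-1-prod n) (prod-threshold (t≤n l)))) ⟩
    prod {d} (λ l → sg n * sg (t l)) ∎
    where
    open ≡-Reasoning
    d = suc e
    X : Fin n → ℕ
    X j = 2 ℕ.* (d ℕ.* suc (toℕ j))
    t : Fin d → ℕ
    t l = suc (toℕ l) ℕ.* p ℕ./ (2 ℕ.* d)
    X≡ : ∀ j → X j ≡ suc (toℕ j) ℕ.* (2 ℕ.* d)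
    X≡ j = trans (sym (ℕₚ.*-assoc 2 d (suc (toℕ j)))) (ℕₚ.*-comm (2 ℕ.* d) (suc (toℕ j)))
    2j<p : ∀ (j : Fin n) → 2 ℕ.* suc (toℕ j) ℕ.≤ p
    2j<p j = ℕₚ.≤-trans (ℕₚ.*-monoʳ-≤ 2 (Finₚ.toℕ<n j))
      (ℕₚ.≤-trans (ℕₚ.≤-reflexive (cong (n ℕ.+_) (ℕₚ.+-identityʳ n))) (ℕₚ.n≤1+n (n ℕ.+ n)))
    X/p≤d : ∀ j → X j ℕ./ p ℕ.≤ d
    X/p≤d j = ℕₚ.≤-trans (ℕD./-monoˡ-≤ p (ℕₚ.≤-trans (ℕₚ.≤-reflexive (trans (X≡ j) (trans (sym (ℕₚ.*-assoc (suc (toℕ j)) 2 d))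
        (trans (ℕₚ.*-comm (suc (toℕ j) ℕ.* 2) d) (cong (d ℕ.*_) (ℕₚ.*-comm (suc (toℕ j)) 2))))))
        (ℕₚ.*-monoʳ-≤ d (2j<p j)))) (ℕₚ.≤-reflexive (ℕD.m*n/n≡m d p))
    t≤n : ∀ l → t l ℕ.≤ n
    t≤n l = ℕₚ.≤-pred (ℕD.m<n*o⇒m/o<n {n = suc n} {o = 2 ℕ.* d} (*-odd-< {suc (toℕ l)} n (Finₚ.toℕ<n l)))
    X≢ : ∀ j l → ¬ X j ≡ suc (toℕ l) ℕ.* p
    X≢ j l eq = *-≢0 2≢0 (*-≢0 he (h≢0 j)) (≋-trans (≋-reflexive (begin
      + 2 * (+ d * h j)              ≡⟨ cong (+ 2 *_) (ℤₚ.pos-* d (suc (toℕ j))) ⟨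
      + 2 * + (d ℕ.* suc (toℕ j))    ≡⟨ ℤₚ.pos-* 2 (d ℕ.* suc (toℕ j)) ⟨
      + X j                          ≡⟨ cong +_ eq ⟩
      + (suc (toℕ l) ℕ.* p)          ≡⟨ ℤₚ.pos-* (suc (toℕ l)) p ⟩
      + suc (toℕ l) * + p            ∎)) (multiple≋0 (+ suc (toℕ l))))
    -- As p does not divide 2 d j, the number l p is below 2 d j unless 2 d j is below l p.
    flip : ∀ j l → Dec (suc (toℕ j) ℕ.* (2 ℕ.* d) ℕ.≤ suc (toℕ l) ℕ.* p) →
      (if toℕ l ℕ.<ᵇ X j ℕ./ p then - + 1 else + 1) ≡ - + 1 * (if toℕ j ℕ.<ᵇ t l then - + 1 else + 1)
    flip j l (yes h) = trans
      (if-cong (<ᵇ-false (ℕₚ.≤-pred (ℕₚ.≰⇒> (λ l<X/p → X≢ j l (ℕₚ.≤-antisym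
        (ℕₚ.≤-trans (ℕₚ.≤-reflexive (X≡ j)) h) (≤/⇒*≤ p l<X/p)))))))
      (sym (cong (- + 1 *_) (if-cong (<ᵇ-true (*≤⇒≤/ (2 ℕ.* d) h)))))
    flip j l (no ¬h) = trans
      (if-cong (<ᵇ-true (*≤⇒≤/ p (ℕₚ.<⇒≤ (subst (suc (toℕ l) ℕ.* p ℕ.<_) (sym (X≡ j)) (ℕₚ.≰⇒> ¬h))))))
      (sym (cong (- + 1 *_) (if-cong (<ᵇ-false (ℕₚ.≤-pred (ℕₚ.≰⇒> (λ j<t → ¬h (≤/⇒*≤ (2 ℕ.* d) j<t))))))))

  χ-1 : χ (- + 1) ≡ sg n
  χ-1 = trans (χ-gauss (- + 1) (neg-≢0 1≢0)) (trans (prod-cong-≗ {n} (λ j → s-minus j (≋-reflexive (ℤₚ.-1*i≡-i (h j))))) (-1-prod n))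

-- The coefficients in Equivalent are chosen before p, so they must be computable from its residue:
-- mere periodicity would not provide them without Dirichlet's theorem.
record Explicit (g : ℕ → ℤ) : Set where
  field
    modulus     : ℕ
    {{nonZero}} : NonZero modulus
    value       : ℕ → ℤ
    agrees      : ∀ p → Prime p → 3 ℕ.< p → ¬ p ℕ∣.∣ modulus → g p Mod16.≋ value (p ℕ.% modulus)
open Explicit

explicit-const : ∀ c → Explicit (λ _ → c)
explicit-const c = record { modulus = 1 ; value = λ _ → c ; agrees = λ _ _ _ _ → Mod16.≋-refl }

explicit₂ : ∀ (_∙_ : ℤ → ℤ → ℤ) → (∀ {x y u v} → x Mod16.≋ y → u Mod16.≋ v → (x ∙ u) Mod16.≋ (y ∙ v)) →
  ∀ {g g′} → Explicit g → Explicit g′ → Explicit (λ p → g p ∙ g′ p)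
explicit₂ _∙_ ∙-cong {g} {g′} E E′ = record
  { modulus = m ℕ.* m′
  ; nonZero = ℕₚ.m*n≢0 m m′
  ; value   = λ r → value E (r ℕ.% m) ∙ value E′ (r ℕ.% m′)
  ; agrees  = λ p pr 3<p p∤ → ∙-cong
      (subst (λ k → g p Mod16.≋ value E k) (sym (ℕD.m∣n⇒o%n%m≡o%m m (m ℕ.* m′) p {{nonZero E}} {{ℕₚ.m*n≢0 m m′}} (ℕ∣.m∣m*n m′)))
        (agrees E p pr 3<p (λ d → p∤ (ℕ∣.∣m⇒∣m*n m′ d))))
      (subst (λ k → g′ p Mod16.≋ value E′ k) (sym (ℕD.m∣n⇒o%n%m≡o%m m′ (m ℕ.* m′) p {{nonZero E′}} {{ℕₚ.m*n≢0 m m′}} (ℕ∣.n∣m*n m)))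
        (agrees E′ p pr 3<p (λ d → p∤ (ℕ∣.∣n⇒∣m*n m d))))
  }
  where
  m = modulus E
  m′ = modulus E′

explicit-+ : ∀ {g g′} → Explicit g → Explicit g′ → Explicit (λ p → g p + g′ p)
explicit-+ = explicit₂ _+_ Mod16.+-cong

explicit-* : ∀ {g g′} → Explicit g → Explicit g′ → Explicit (λ p → g p * g′ p)
explicit-* = explicit₂ _*_ Mod16.*-cong

explicit-neg : ∀ {g} → Explicit g → Explicit (λ p → - g p)
explicit-neg E = record
  { modulus = modulus E ; nonZero = nonZero E ; value = -_ ∘ value E
  ; agrees = λ p pr 3<p p∤ → Mod16.neg-cong (agrees E p pr 3<p p∤) }

-- `m` carries the primes at which the comparison may fail; as a factor of the new modulus it
-- exempts them from `agrees`.
explicit-cong : ∀ m {{_ : NonZero m}} {g g′} →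
  (∀ p → Prime p → 3 ℕ.< p → ¬ p ℕ∣.∣ m → g p Mod16.≋ g′ p) → Explicit g′ → Explicit g
explicit-cong m h E = record
  { modulus = m ℕ.* modulus E
  ; nonZero = ℕₚ.m*n≢0 m (modulus E)
  ; value   = λ r → value E (r ℕ.% modulus E)
  ; agrees  = λ p pr 3<p p∤ → Mod16.≋-trans (h p pr 3<p (λ d → p∤ (ℕ∣.∣m⇒∣m*n (modulus E) d)))
      (Mod16.≋-trans (agrees E p pr 3<p (λ d → p∤ (ℕ∣.∣n⇒∣m*n m d)))
        (Mod16.≋-reflexive (cong (value E) (sym (ℕD.m∣n⇒o%n%m≡o%m (modulus E) (m ℕ.* modulus E) p
          {{nonZero E}} {{ℕₚ.m*n≢0 m (modulus E)}} (ℕ∣.n∣m*n m))))))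
  }

explicit-periodic : ∀ m {{_ : NonZero m}} (v : ℕ → ℤ) → (∀ r q → v (r ℕ.+ q ℕ.* m) ≡ v r) → Explicit v
explicit-periodic m v periodic = record
  { modulus = m ; value = v
  ; agrees = λ p _ _ _ → Mod16.≋-reflexive (trans (cong v (ℕD.m≡m%n+[m/n]*n p m)) (periodic (p ℕ.% m) (p ℕ./ m))) }

explicit-p : Explicit (λ p → + p)
explicit-p = record { modulus = 16 ; value = +_ ; agrees = λ p _ _ _ → Mod16.mod (divides (+ (p ℕ./ 16)) (begin
    + p - + (p ℕ.% 16)                                          ≡⟨ cong (λ k → + k - + (p ℕ.% 16)) (ℕD.m≡m%n+[m/n]*n p 16) ⟩
    + (p ℕ.% 16 ℕ.+ p ℕ./ 16 ℕ.* 16) - + (p ℕ.% 16)             ≡⟨ cong (λ z → + (p ℕ.% 16) + z - + (p ℕ.% 16)) (ℤₚ.pos-* (p ℕ./ 16) 16) ⟩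
    + (p ℕ.% 16) + + (p ℕ./ 16) * + 16 - + (p ℕ.% 16)           ≡⟨ lemma (+ (p ℕ.% 16)) (+ (p ℕ./ 16) * + 16) ⟩
    + (p ℕ./ 16) * + 16                                         ∎)) }
  where
  open ≡-Reasoning
  lemma : ∀ r q → r + q - r ≡ q
  lemma = solve-∀

half-period : ∀ m r q → (r ℕ.+ q ℕ.* (2 ℕ.* m)) ℕ./ 2 ≡ r ℕ./ 2 ℕ.+ q ℕ.* m
half-period m r q = trans (cong (λ z → (r ℕ.+ z) ℕ./ 2) (trans (cong (q ℕ.*_) (ℕₚ.*-comm 2 m)) (sym (ℕₚ.*-assoc q m 2))))
  (trans (ℕD.+-distrib-/-∣ʳ r (ℕ∣.divides (q ℕ.* m) refl)) (cong (r ℕ./ 2 ℕ.+_) (ℕD.m*n/n≡m (q ℕ.* m) 2)))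

sg-period : ∀ r q → sg (r ℕ.+ q ℕ.* 2) ≡ sg r
sg-period r q = trans (cong (λ z → sg (r ℕ.+ z)) (ℕₚ.*-comm q 2)) (sg-even r q)

explicit-sg : Explicit (λ p → sg (p ℕ./ 2))
explicit-sg = explicit-periodic 4 (λ p → sg (p ℕ./ 2)) (λ r q → trans (cong sg (half-period 2 r q)) (sg-period (r ℕ./ 2) q))

-- Among four consecutive signs `(-1) ^ j` two are negative, so their product is 1.
triangularSign-period : ∀ r q → triangularSign (r ℕ.+ q ℕ.* 4) ≡ triangularSign r
triangularSign-period r zero    = cong triangularSign (ℕₚ.+-identityʳ r)
triangularSign-period r (suc q) = begin
  triangularSign (r ℕ.+ (4 ℕ.+ q ℕ.* 4))   ≡⟨ cong triangularSign (trans (cong (r ℕ.+_) (ℕₚ.+-comm 4 (q ℕ.* 4))) (sym (ℕₚ.+-assoc r (q ℕ.* 4) 4))) ⟩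
  triangularSign (k ℕ.+ 4)                 ≡⟨ four k ⟩
  triangularSign k                         ≡⟨ triangularSign-period r q ⟩
  triangularSign r                         ∎
  where
  open ≡-Reasoning
  open Range ℤₚ.*-1-commutativeMonoid
  k = r ℕ.+ q ℕ.* 4
  lemma : ∀ {s} → IsSign s → (- (s * + 1)) * ((- (s * - + 1)) * ((- (s * + 1)) * ((- (s * - + 1)) * + 1))) ≡ + 1
  lemma pos = refl
  lemma neg = refl
  four : ∀ k → triangularSign (k ℕ.+ 4) ≡ triangularSign k
  four k = trans (fold-++ k 4 (λ j → sg (suc (toℕ j)))) (trans (cong₂ _*_
      (prod-cong-≗ {k} (λ j → cong (λ z → sg (suc z)) (Finₚ.toℕ-↑ˡ j 4)))
      (trans (prod-cong-≗ {4} (λ j → cong (λ z → - z) (trans (cong sg (Finₚ.toℕ-↑ʳ k j)) (sg-+ k (toℕ j))))) (lemma (sg-sign k))))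
    (ℤₚ.*-identityʳ (triangularSign k)))

explicit-κ : Explicit (λ p → κ (p ℕ./ 2))
explicit-κ = explicit-* explicit-sg (explicit-periodic 8 (λ p → triangularSign (p ℕ./ 2))
  (λ r q → trans (cong triangularSign (half-period 4 r q)) (triangularSign-period (r ℕ./ 2) q)))

explicit-χ-pos : ∀ e → Explicit (legendre (+ suc e))
explicit-χ-pos e = explicit-cong d
  (λ p pr 3<p p∤d → Mod16.≋-reflexive (odd-prime Q floor p pr 3<p p∤d))
  -- Adding `4 d` to `p` adds `2 d` to the floor of `p / 2` and `2 l` to that of `l p / (2 d)`; both
  -- are even, so no quadratic reciprocity is needed.
  (explicit-periodic (2 ℕ.* (2 ℕ.* d)) G (λ r q → prod-cong-≗ {d} (λ l → cong₂ _*_ (first r q) (second r q (suc (toℕ l))))))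
  where
  d = suc e
  G : ℕ → ℤ
  G p = prod {d} (λ l → sg (p ℕ./ 2) * sg (suc (toℕ l) ℕ.* p ℕ./ (2 ℕ.* d)))
  Q : ℕ → Set
  Q p = ¬ p ℕ∣.∣ d → legendre (+ d) p ≡ G p
  floor : ∀ n → 1 ℕ.< n → Prime (suc (n ℕ.+ n)) → Q (suc (n ℕ.+ n))
  floor n 1<n pr p∤d = trans (sym (χ-legendre (+ d))) (trans (χ-floor e (λ d0 → p∤d (∣⇒∣ᵤ (≋0⇒∣ d0))))
    (prod-cong-≗ {d} (λ l → cong (λ z → sg z * sg (suc (toℕ l) ℕ.* p ℕ./ (2 ℕ.* d))) (sym (half-odd n)))))
    where open GaussFloor n 1<n pr
  first : ∀ r q → sg ((r ℕ.+ q ℕ.* (2 ℕ.* (2 ℕ.* d))) ℕ./ 2) ≡ sg (r ℕ./ 2)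
  first r q = trans (cong sg (trans (half-period (2 ℕ.* d) r q) (cong (r ℕ./ 2 ℕ.+_)
    (trans (cong (q ℕ.*_) (ℕₚ.*-comm 2 d)) (sym (ℕₚ.*-assoc q d 2)))))) (sg-period (r ℕ./ 2) (q ℕ.* d))
  second : ∀ r q l → sg (l ℕ.* (r ℕ.+ q ℕ.* (2 ℕ.* (2 ℕ.* d))) ℕ./ (2 ℕ.* d)) ≡ sg (l ℕ.* r ℕ./ (2 ℕ.* d))
  second r q l = begin
    sg (l ℕ.* (r ℕ.+ q ℕ.* (2 ℕ.* (2 ℕ.* d))) ℕ./ (2 ℕ.* d))
      ≡⟨ cong (λ z → sg (z ℕ./ (2 ℕ.* d))) (trans (ℕₚ.*-distribˡ-+ l r _) (cong (l ℕ.* r ℕ.+_)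
           (trans (sym (ℕₚ.*-assoc l q _)) (sym (ℕₚ.*-assoc (l ℕ.* q) 2 (2 ℕ.* d)))))) ⟩
    sg ((l ℕ.* r ℕ.+ l ℕ.* q ℕ.* 2 ℕ.* (2 ℕ.* d)) ℕ./ (2 ℕ.* d))
      ≡⟨ cong sg (trans (ℕD.+-distrib-/-∣ʳ (l ℕ.* r) (ℕ∣.divides (l ℕ.* q ℕ.* 2) refl))
           (cong (l ℕ.* r ℕ./ (2 ℕ.* d) ℕ.+_) (ℕD.m*n/n≡m (l ℕ.* q ℕ.* 2) (2 ℕ.* d)))) ⟩
    sg (l ℕ.* r ℕ./ (2 ℕ.* d) ℕ.+ l ℕ.* q ℕ.* 2)
      ≡⟨ sg-period (l ℕ.* r ℕ./ (2 ℕ.* d)) (l ℕ.* q) ⟩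
    sg (l ℕ.* r ℕ./ (2 ℕ.* d)) ∎
    where open ≡-Reasoning

legendre-odd : ∀ (Q : (ℤ → ℤ) → ℕ → Set) →
  (∀ n 1<n pr → Q (Legendre.χ n 1<n pr) (suc (n ℕ.+ n))) → (∀ {f g} p → (∀ x → f x ≡ g x) → Q f p → Q g p) →
  ∀ p → Prime p → 3 ℕ.< p → Q (λ x → legendre x p) p
legendre-odd Q q resp = odd-prime (λ p → Q (λ x → legendre x p) p)
  (λ n 1<n pr → resp (suc (n ℕ.+ n)) (Legendre.χ-legendre n 1<n pr) (q n 1<n pr))

explicit-χ : ∀ d → Explicit (legendre d)
explicit-χ (+ zero)  = explicit-cong 1 {g′ = λ _ → + 0} (λ p pr 3<p _ → Mod16.≋-reflexive
  (legendre-odd (λ f _ → f (+ 0) ≡ + 0) (λ n 1<n pr → let open GaussFloor n 1<n pr in χ-zero ≋-refl)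
    (λ _ e h → trans (sym (e _)) h) p pr 3<p)) (explicit-const (+ 0))
explicit-χ (+ suc e) = explicit-χ-pos e
explicit-χ -[1+ e ]  = explicit-cong 1 {g′ = λ p → sg (p ℕ./ 2) * legendre (+ suc e) p} (λ p pr 3<p _ → Mod16.≋-reflexive
  (legendre-odd (λ f p → f -[1+ e ] ≡ sg (p ℕ./ 2) * f (+ suc e))
    (λ n 1<n pr → let open GaussFloor n 1<n pr in
      trans (cong χ (sym (ℤₚ.-1*i≡-i (+ suc e)))) (trans (χ-* (- + 1) (+ suc e))
        (cong (_* χ (+ suc e)) (trans χ-1 (cong sg (sym (half-odd n)))))))
    (λ p h e′ → trans (sym (h _)) (trans e′ (cong (sg (p ℕ./ 2) *_) (h _)))) p pr 3<p))
  (explicit-* explicit-sg (explicit-χ-pos e))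

-- For nonzero `d` the indicator vanishes except at the primes dividing `d`, and these are absorbed
-- into the modulus.
explicit-δ : ∀ d → Explicit (indicator d)
explicit-δ d = by-cases (d ℤₚ.≟ + 0)
  where
  by-cases : Dec (d ≡ + 0) → Explicit (indicator d)
  by-cases (yes refl) = explicit-cong 1 {g′ = λ _ → + 1} (λ p pr 3<p _ → Mod16.≋-reflexive
    (odd-prime (λ p → indicator (+ 0) p ≡ + 1) (λ n 1<n pr → let open GaussFloor n 1<n pr in
      trans (sym (δ-indicator (+ 0))) (δ-one ≋-refl)) p pr 3<p)) (explicit-const (+ 1))
  by-cases (no d≢0) = explicit-cong ℤ.∣ d ∣ {{ℤ.≢-nonZero d≢0}} {g′ = λ _ → + 0} (λ p pr 3<p p∤d → Mod16.≋-reflexive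
    (odd-prime (λ p → ¬ p ℕ∣.∣ ℤ.∣ d ∣ → indicator d p ≡ + 0) (λ n 1<n pr p∤d → let open GaussFloor n 1<n pr in
      trans (sym (δ-indicator d)) (δ-zero (λ d0 → p∤d (∣⇒∣ᵤ (≋0⇒∣ d0))))) p pr 3<p p∤d)) (explicit-const (+ 0))

-- Products of linear factors

infixl 6 _⊕_ _⊝_
infixl 7 _⊗_

-- The closed forms below are kept as syntax: dependence on the residue of `p` alone then follows by
-- structural induction, and the same expression can be read with Legendre symbols (`at`) or with
-- `χ` (`⟦_⟧`).
data Term : Set where
  con chi del : ℤ → Term
  kap size    : Term
  _⊕_ _⊝_ _⊗_ : Term → Term → Term

eval : Term → (χ δ : ℤ → ℤ) (k q : ℤ) → ℤ
eval (con c) χ δ k q = c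
eval (chi d) χ δ k q = χ d
eval (del d) χ δ k q = δ d
eval kap     χ δ k q = k
eval size    χ δ k q = q
eval (t ⊕ u) χ δ k q = eval t χ δ k q + eval u χ δ k q
eval (t ⊝ u) χ δ k q = eval t χ δ k q - eval u χ δ k q
eval (t ⊗ u) χ δ k q = eval t χ δ k q * eval u χ δ k q

at : Term → ℕ → ℤ
at t p = eval t (λ x → legendre x p) (λ x → indicator x p) (κ (p ℕ./ 2)) (+ p)

explicit-term : ∀ t → Explicit (at t)
explicit-term (con c) = explicit-const c
explicit-term (chi d) = explicit-χ d
explicit-term (del d) = explicit-δ d
explicit-term kap     = explicit-κ
explicit-term size    = explicit-p
explicit-term (t ⊕ u) = explicit-+ (explicit-term t) (explicit-term u)
explicit-term (t ⊝ u) = explicit-+ (explicit-term t) (explicit-neg (explicit-term u))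
explicit-term (t ⊗ u) = explicit-* (explicit-term t) (explicit-term u)

chi₁ : ℤ → Term
chi₁ x = chi x ⊕ del x

weight₋₁ : Term
weight₋₁ = con (+ 1) ⊝ kap ⊗ chi (- + 1)

-- Closed form of `W` for a single factor `α + β v`. For nonzero `β` the bracket after `kap`
-- collects the sum of `χ (v (α + β v))` and the value of `χ` at the root `- α / β`.
linearTerm : (α β : ℤ) → Dec (β ≡ + 0) → Term
linearTerm α β β? = main β? ⊝ (con (+ 1) ⊝ chi₁ α) ⊝ weight₋₁ ⊗ (con (+ 1) ⊝ chi₁ (α + β * - + 1))
  where
  main : Dec (β ≡ + 0) → Term
  main (yes _) = (con (+ 1) ⊝ chi₁ α) ⊗ size
  main (no _)  = size ⊝ con (+ 1) ⊕ kap ⊗ (chi β ⊗ (size ⊗ del α ⊝ con (+ 1)) ⊕ chi (- α * β))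

-- Corrects for the zero of α + β v, where χ₁ of a product is not multiplicative.
zeroTerm : (α β γ ε : ℤ) → Dec (β ≡ + 0) → Term
zeroTerm α β γ ε (yes _) = con (+ 0)
zeroTerm α β γ ε (no _)  =
  -- At `v = - α / β` one has `χ v = χ (- α β)`, and `γ + ε v` times the square `β²` is
  -- `β (β γ - ε α)`.
  (con (+ 1) ⊝ kap ⊗ chi (- α * β)) ⊗ (con (+ 1) ⊝ chi₁ (β * (β * γ - ε * α)))
  ⊝ del α ⊗ (con (+ 1) ⊝ chi₁ γ)
  ⊝ weight₋₁ ⊗ (del (α + β * - + 1) ⊗ (con (+ 1) ⊝ chi₁ (γ + ε * - + 1)))

-- If one factor is identically zero, all values of the form vanish, every factor of `P` is omitted
-- and `W` is 0. This must be decided first, since the formula for the zeros supposes a factor with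
-- at most one zero.
splitTerm : (α β γ ε : ℤ) → Dec (α ≡ + 0) → Dec (β ≡ + 0) → Dec (γ ≡ + 0) → Dec (ε ≡ + 0) → Term
splitTerm α β γ ε (yes _) (yes _) _ _ = con (+ 0)
splitTerm α β γ ε _ _ (yes _) (yes _) = con (+ 0)
splitTerm α β γ ε _ β? _ ε? = linearTerm α β β? ⊕ linearTerm γ ε ε? ⊝ zeroTerm α β γ ε β? ⊝ zeroTerm γ ε α β ε?

productTerm : (α β γ ε : ℤ) → Term
productTerm α β γ ε = splitTerm α β γ ε (α ℤₚ.≟ + 0) (β ℤₚ.≟ + 0) (γ ℤₚ.≟ + 0) (ε ℤₚ.≟ + 0)

module LinearFactors (n : ℕ) (1<n : 1 ℕ.< n) (prime : Prime (suc (n ℕ.+ n))) where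

  open GaussFloor n 1<n prime public

  ⟦_⟧ : Term → ℤ
  ⟦ t ⟧ = eval t χ δ (κ n) (+ p)

  opaque
    unfolding χ δ

    at-⟦⟧ : ∀ t → at t p ≡ ⟦ t ⟧
    at-⟦⟧ t = cong (λ k → eval t χ δ (κ k) (+ p)) (half-odd n)

  χ-4 : ∀ x → χ (+ 4 * x) ≡ χ x
  χ-4 x = trans (χ-* (+ 4) x) (trans (cong (_* χ x) (χ-square (+ 2) 2≢0 ≋-refl)) (ℤₚ.*-identityˡ (χ x)))

  χ-inv : ∀ b → ¬ b ≋ + 0 → χ (inv b) ≡ χ b
  χ-inv b hb = begin
    χ (inv b)                  ≡⟨ ℤₚ.*-identityˡ (χ (inv b)) ⟨
    + 1 * χ (inv b)            ≡⟨ cong (_* χ (inv b)) (χ-square b hb ≋-refl) ⟨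
    χ (b * b) * χ (inv b)      ≡⟨ χ-* (b * b) (inv b) ⟨
    χ (b * b * inv b)          ≡⟨ χ-cong (by (inv-* hb) b (lemma b (inv b))) ⟩
    χ b                        ∎
    where
    open ≡-Reasoning
    lemma : ∀ b i → b * b * i - b ≡ b * (b * i - + 1)
    lemma = solve-∀

  χ-root : ∀ a b → ¬ b ≋ + 0 → χ (- a * inv b) ≡ χ (- a * b)
  χ-root a b hb = trans (χ-* (- a) (inv b)) (trans (cong (χ (- a) *_) (χ-inv b hb)) (sym (χ-* (- a) b)))

  linear : ℤ → ℤ → ℤ → ℤ
  linear α β v = α + β * v

  linear-cong : ∀ α β {x y} → x ≋ y → linear α β x ≋ linear α β y
  linear-cong α β e = +-congˡ α (*-congˡ β e)

  ∑-χ-linear : ∀ α β → ¬ β ≋ + 0 → ∑ₚ (λ v → χ (linear α β v)) ≡ + 0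
  ∑-χ-linear α β hβ = trans (∑-cong (λ v → cong χ (ℤₚ.+-comm α (β * v)))) (∑-χ-affine β α hβ)

  -- Multiplying by `χ β * χ β = 1` makes the quadratic monic in `u = β v`.
  ∑-χ-v-linear : ∀ α β → ¬ β ≋ + 0 → ∑ₚ (λ v → χ (v * linear α β v)) ≡ χ β * (+ p * δ α - + 1)
  ∑-χ-v-linear α β hβ = begin
    ∑ₚ (λ v → χ (v * linear α β v))
      ≡⟨ ∑-cong (λ v → trans (sym (ℤₚ.*-identityˡ _)) (trans (cong (_* χ (v * linear α β v)) (sym (sign-square (χ-sign hβ))))
           (trans (ℤₚ.*-assoc (χ β) (χ β) _) (cong (χ β *_) (trans (sym (χ-* β (v * linear α β v))) (cong χ (lemma α β v))))))) ⟩
    ∑ₚ (λ v → χ β * χ ((β * v - + 0) * (β * v - - α)))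
      ≡⟨ ∑-*ˡ (χ β) (λ v → χ ((β * v - + 0) * (β * v - - α))) ⟩
    χ β * ∑ₚ (λ v → χ ((β * v - + 0) * (β * v - - α)))
      ≡⟨ cong (χ β *_) (trans (∑-dilate (λ u → χ ((u - + 0) * (u - - α)))
           (λ e → χ-cong (*-cong (+-congʳ (- + 0) e) (+-congʳ (- - α) e))) β hβ)
           (trans (∑-χ-product (+ 0) (- α)) (cong (λ z → + p * δ z - + 1) (trans (ℤₚ.+-identityˡ (- - α)) (ℤₚ.neg-involutive α))))) ⟩
    χ β * (+ p * δ α - + 1) ∎
    where
    open ≡-Reasoning
    lemma : ∀ α β v → β * (v * (α + β * v)) ≡ (β * v - + 0) * (β * v - - α)
    lemma = solve-∀

  linear-0 : ∀ α β → linear α β (+ 0) ≡ α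
  linear-0 α β = trans (cong (λ z → α + z) (ℤₚ.*-zeroʳ β)) (ℤₚ.+-identityʳ α)

  linear-constant : ∀ α {β} → β ≡ + 0 → ∀ v → linear α β v ≡ α
  linear-constant α refl v = trans (cong (λ z → α + z) (ℤₚ.*-zeroˡ v)) (ℤₚ.+-identityʳ α)

  W-linear : ∀ α β (β? : Dec (β ≡ + 0)) → (¬ β ≡ + 0 → ¬ β ≋ + 0) →
    W (λ v → χ₁ (linear α β v)) ≡ ⟦ linearTerm α β β? ⟧
  W-linear α β β? good = trans
      (cong₂ (λ s t → s - (+ 1 - t) - wt (- + 1) * (+ 1 - χ₁ (linear α β (- + 1)))) (body β?) (cong χ₁ (linear-0 α β)))
      (match β?)
    where
    q = + p
    k = κ n
    main : Dec (β ≡ + 0) → ℤ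
    main (yes _) = (+ 1 - χ₁ α) * q
    main (no _)  = q - + 1 + k * (χ β * (q * δ α - + 1) + χ (- α * β))
    body : ∀ β? → ∑ₚ (λ v → wt v * (+ 1 - χ₁ (linear α β v))) ≡ main β?
    body (yes β0) = trans (∑-combination ((+ 1 - χ₁ α , (λ _ → + 1)) ∷ (- k * (+ 1 - χ₁ α) , χ) ∷ [])
        (λ v → trans (cong (λ z → wt v * (+ 1 - χ₁ z)) (linear-constant α β0 v)) (lemma k (χ v) (+ 1 - χ₁ α))))
      (trans (cong₂ (λ a b → (+ 1 - χ₁ α) * a + (- k * (+ 1 - χ₁ α) * b + + 0)) ∑-one ∑-χ) (lemma′ k (+ 1 - χ₁ α) q))
      where
      lemma : ∀ k c t → (+ 1 - k * c) * t ≡ t * + 1 + (- k * t * c + + 0)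
      lemma = solve-∀
      lemma′ : ∀ k t q → t * q + (- k * t * + 0 + + 0) ≡ t * q
      lemma′ = solve-∀
    body (no β≢0) = trans (∑-combination
        ((+ 1 , (λ _ → + 1)) ∷ (- + 1 , (λ v → χ (linear α β v))) ∷ (- + 1 , (λ v → δ (linear α β v) * + 1)) ∷
         (- k , χ) ∷ (k , (λ v → χ (v * linear α β v))) ∷ (k , (λ v → δ (linear α β v) * χ v)) ∷ [])
        (λ v → trans (lemma k (χ v) (χ (linear α β v)) (δ (linear α β v)))
          (cong (λ z → + 1 * + 1 + (- + 1 * χ (linear α β v) + (- + 1 * (δ (linear α β v) * + 1) + (- k * χ v +
            (k * z + (k * (δ (linear α β v) * χ v) + + 0)))))) (sym (χ-* v (linear α β v))))))
      (trans (sums ∑-one (∑-χ-linear α β hβ) (∑-δ-linear α β (λ _ → + 1) hβ (λ _ → refl)) ∑-χ (∑-χ-v-linear α β hβ)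
          (trans (∑-δ-linear α β χ hβ χ-cong) (χ-root α β hβ)))
        (lemma′ k q (χ β * (q * δ α - + 1)) (χ (- α * β))))
      where
      hβ = good β≢0
      lemma : ∀ k c x d → (+ 1 - k * c) * (+ 1 - (x + d)) ≡
        + 1 * + 1 + (- + 1 * x + (- + 1 * (d * + 1) + (- k * c + (k * (c * x) + (k * (d * c) + + 0)))))
      lemma = solve-∀
      lemma′ : ∀ k q u v → + 1 * q + (- + 1 * + 0 + (- + 1 * + 1 + (- k * + 0 + (k * u + (k * v + + 0))))) ≡ q - + 1 + k * (u + v)
      lemma′ = solve-∀
      sums : ∀ {a a′ b b′ c c′ d d′ e e′ f f′} → a ≡ a′ → b ≡ b′ → c ≡ c′ → d ≡ d′ → e ≡ e′ → f ≡ f′ →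
        + 1 * a + (- + 1 * b + (- + 1 * c + (- k * d + (k * e + (k * f + + 0))))) ≡
        + 1 * a′ + (- + 1 * b′ + (- + 1 * c′ + (- k * d′ + (k * e′ + (k * f′ + + 0)))))
      sums refl refl refl refl refl refl = refl
    match : ∀ β? → main β? - (+ 1 - χ₁ α) - wt (- + 1) * (+ 1 - χ₁ (linear α β (- + 1))) ≡ ⟦ linearTerm α β β? ⟧
    match (yes _) = refl
    match (no _)  = refl

  vanishing : ∀ {x} y → IsSign x → IsSign y → (+ 1 - x) * (+ 1 - y) Mod8.≋ + 0 ⊎ (+ 1 - x) * (+ 1 - y) ≡ + 4
  vanishing y pos _   = inj₁ (Mod8.≋-reflexive (ℤₚ.*-zeroˡ (+ 1 - y)))
  vanishing _ neg pos = inj₁ Mod8.≋-refl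
  vanishing _ neg neg = inj₂ refl

  -- For signs, `1 - s t = (1 - s) + (1 - t) - (1 - s) (1 - t)`. If one argument vanishes, `χ₁` of
  -- the product is 1 whatever the other value is; the `δ` terms cancel the surplus.
  χ₁-product : ∀ x y → + 1 - χ₁ (x * y) ≡
    (+ 1 - χ₁ x) + (+ 1 - χ₁ y) - (+ 1 - χ₁ x) * (+ 1 - χ₁ y) - δ x * (+ 1 - χ₁ y) - δ y * (+ 1 - χ₁ x)
  χ₁-product x y = split (zero? x) (zero? y)
    where
    fill : ∀ {a b c d e} → χ₁ (x * y) ≡ a → χ₁ x ≡ b → χ₁ y ≡ c → δ x ≡ d → δ y ≡ e →
      + 1 - a ≡ (+ 1 - b) + (+ 1 - c) - (+ 1 - b) * (+ 1 - c) - d * (+ 1 - c) - e * (+ 1 - b) →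
      + 1 - χ₁ (x * y) ≡ (+ 1 - χ₁ x) + (+ 1 - χ₁ y) - (+ 1 - χ₁ x) * (+ 1 - χ₁ y) - δ x * (+ 1 - χ₁ y) - δ y * (+ 1 - χ₁ x)
    fill refl refl refl refl refl e = e
    lemma₁ : ∀ c e → + 1 - + 1 ≡ (+ 1 - + 1) + (+ 1 - c) - (+ 1 - + 1) * (+ 1 - c) - + 1 * (+ 1 - c) - e * (+ 1 - + 1)
    lemma₁ = solve-∀
    lemma₂ : ∀ b d → + 1 - + 1 ≡ (+ 1 - b) + (+ 1 - + 1) - (+ 1 - b) * (+ 1 - + 1) - d * (+ 1 - + 1) - + 1 * (+ 1 - b)
    lemma₂ = solve-∀
    lemma₃ : ∀ b c → + 1 - b * c ≡ (+ 1 - b) + (+ 1 - c) - (+ 1 - b) * (+ 1 - c) - + 0 * (+ 1 - c) - + 0 * (+ 1 - b)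
    lemma₃ = solve-∀
    split : Dec (x ≋ + 0) → Dec (y ≋ + 0) →
      + 1 - χ₁ (x * y) ≡ (+ 1 - χ₁ x) + (+ 1 - χ₁ y) - (+ 1 - χ₁ x) * (+ 1 - χ₁ y) - δ x * (+ 1 - χ₁ y) - δ y * (+ 1 - χ₁ x)
    split (yes x0) _ = fill (χ₁-zero (*-zeroˡ y x0)) (χ₁-zero x0) refl (δ-one x0) refl (lemma₁ (χ₁ y) (δ y))
    split (no hx) (yes y0) = fill (χ₁-zero (*-zeroʳ x y0)) refl (χ₁-zero y0) refl (δ-one y0) (lemma₂ (χ₁ x) (δ x))
    split (no hx) (no hy) = fill
      (trans (χ₁-χ (*-≢0 hx hy)) (trans (χ-* x y) (cong₂ _*_ (sym (χ₁-χ hx)) (sym (χ₁-χ hy)))))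
      refl refl (δ-zero hx) (δ-zero hy) (lemma₃ (χ₁ x) (χ₁ y))

  open CongruentSums (+ 8) using () renaming (sum-≋0 to sum-mod8)

  module _ (α β γ ε : ℤ) where

    private
      x y : ℤ → ℤ
      x = linear α β
      y = linear γ ε

    zeroSum : ℤ
    zeroSum = ∑ₚ (λ v → wt v * (δ (x v) * (+ 1 - χ₁ (y v)))) - δ (x (+ 0)) * (+ 1 - χ₁ (y (+ 0)))
      - wt (- + 1) * (δ (x (- + 1)) * (+ 1 - χ₁ (y (- + 1))))

    zeroSum-term : ∀ β? → (¬ β ≡ + 0 → ¬ β ≋ + 0) → (β ≡ + 0 → ¬ α ≋ + 0) → zeroSum ≡ ⟦ zeroTerm α β γ ε β? ⟧
    zeroSum-term (yes β0) _ hα = trans (cong₂ (λ s t → s - t * (+ 1 - χ₁ (y (+ 0))) - wt (- + 1) * (δ (x (- + 1)) * (+ 1 - χ₁ (y (- + 1)))))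
        (trans (∑-cong (λ v → trans (cong (λ z → wt v * (z * (+ 1 - χ₁ (y v)))) (x≢0 v)) (lemma (wt v) (+ 1 - χ₁ (y v))))) ∑-zero)
        (x≢0 (+ 0)))
      (trans (cong (λ z → + 0 - + 0 * (+ 1 - χ₁ (y (+ 0))) - wt (- + 1) * (z * (+ 1 - χ₁ (y (- + 1))))) (x≢0 (- + 1)))
        (lemma′ (+ 1 - χ₁ (y (+ 0))) (wt (- + 1)) (+ 1 - χ₁ (y (- + 1)))))
      where
      x≢0 : ∀ v → δ (x v) ≡ + 0
      x≢0 v = δ-zero (λ e → hα β0 (subst (_≋ + 0) (linear-constant α β0 v) e))
      lemma : ∀ w t → w * (+ 0 * t) ≡ + 0
      lemma = solve-∀
      lemma′ : ∀ s w t → + 0 - + 0 * s - w * (+ 0 * t) ≡ + 0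
      lemma′ = solve-∀
    zeroSum-term (no β≢0) good _ = cong₂ (λ s t → s - t - wt (- + 1) * (δ (x (- + 1)) * (+ 1 - χ₁ (y (- + 1)))))
      (trans (∑-cong (λ v → lemma (wt v) (δ (x v)) (+ 1 - χ₁ (y v))))
        (trans (∑-δ-linear α β (λ v → wt v * (+ 1 - χ₁ (y v))) hβ
            (λ e → cong₂ (λ s t → (+ 1 - κ n * s) * (+ 1 - t)) (χ-cong e) (χ₁-cong (linear-cong γ ε e))))
          (cong₂ (λ s t → (+ 1 - κ n * s) * (+ 1 - t)) (χ-root α β hβ)
            (trans (sym (χ₁-square {β} (y (- α * inv β)) hβ)) (χ₁-cong (by (inv-* hβ) (- (β * ε * α)) (lemma′ β γ ε α (inv β))))))))
      (cong₂ (λ s t → δ s * (+ 1 - χ₁ t)) (linear-0 α β) (linear-0 γ ε))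
      where
      hβ = good β≢0
      lemma : ∀ w d t → w * (d * t) ≡ d * (w * t)
      lemma = solve-∀
      lemma′ : ∀ β γ ε α i → β * β * (γ + ε * (- α * i)) - β * (β * γ - ε * α) ≡ - (β * ε * α) * (β * i - + 1)
      lemma′ = solve-∀

  cross : (x y : ℤ → ℤ) → ℤ
  cross x y = ∑ₚ (λ v → wt v * ((+ 1 - χ₁ (x v)) * (+ 1 - χ₁ (y v)))) - (+ 1 - χ₁ (x (+ 0))) * (+ 1 - χ₁ (y (+ 0)))
    - wt (- + 1) * ((+ 1 - χ₁ (x (- + 1))) * (+ 1 - χ₁ (y (- + 1))))

  -- Away from v = 0 the weight is even, and (1 - χ₁ x)(1 - χ₁ y) is 0 or 4.
  cross-mod8 : ∀ x y → Periodic₁ (χ₁ ∘ x) → Periodic₁ (χ₁ ∘ y) → cross x y Mod8.≋ + 0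
  cross-mod8 x y x-cong y-cong = Mod8.≋-trans
    (Mod8.+-cong {u = - (wt (- + 1) * C (- + 1))} {v = - + 0} (Mod8.≋-trans (Mod8.≋-reflexive (sym combined)) (sum-mod8 {p} (λ i → term (rep i)) (λ i → point (rep i) (zero? (rep i)))))
      (Mod8.neg-cong (away (neg-≢0 1≢0))))
    Mod8.≋-refl
    where
    C : ℤ → ℤ
    C v = (+ 1 - χ₁ (x v)) * (+ 1 - χ₁ (y v))
    term : ℤ → ℤ
    term v = wt v * C v - C (+ 0) * δ (v - + 0)
    combined : ∑ₚ term ≡ ∑ₚ (λ v → wt v * C v) - C (+ 0)
    combined = trans (∑-combination ((+ 1 , (λ v → wt v * C v)) ∷ (- C (+ 0) , (λ v → δ (v - + 0))) ∷ [])
        (λ v → lemma (wt v * C v) (C (+ 0)) (δ (v - + 0))))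
      (trans (cong (λ z → + 1 * ∑ₚ (λ v → wt v * C v) + (- C (+ 0) * z + + 0)) (∑-δ₁ (+ 0)))
        (lemma′ (∑ₚ (λ v → wt v * C v)) (C (+ 0))))
      where
      lemma : ∀ a c d → a - c * d ≡ + 1 * a + (- c * d + + 0)
      lemma = solve-∀
      lemma′ : ∀ s c → + 1 * s + (- c * + 1 + + 0) ≡ s - c
      lemma′ = solve-∀
    even : ∀ {s} → IsSign s → (+ 1 - s) * + 4 Mod8.≋ + 0
    even pos = Mod8.≋-refl
    even neg = Mod8.mod (divides (+ 1) refl)
    away : ∀ {v} → ¬ v ≋ + 0 → wt v * C v Mod8.≋ + 0
    away {v} hv = [ (λ e → Mod8.≋-trans (Mod8.*-congˡ (wt v) e) (Mod8.≋-reflexive (ℤₚ.*-zeroʳ (wt v))))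
                  , (λ e → Mod8.≋-trans (Mod8.≋-reflexive (cong (wt v *_) e)) (even (sign-* (κ-sign n) (χ-sign hv)))) ]′
                  (vanishing (χ₁ (y v)) (χ₁-sign (x v)) (χ₁-sign (y v)))
    point : ∀ v → Dec (v ≋ + 0) → term v Mod8.≋ + 0
    point v (yes v0) = Mod8.≋-reflexive (trans
      (cong₂ (λ s t → (+ 1 - κ n * s) * C v - C (+ 0) * t) (χ-zero v0) (δ-one (≋⇒0 {v} v0)))
      (trans (cong (λ z → (+ 1 - κ n * + 0) * z - C (+ 0) * + 1) (cong₂ (λ s t → (+ 1 - s) * (+ 1 - t)) (x-cong v0) (y-cong v0)))
        (lemma (κ n) (C (+ 0)))))
      where
      lemma : ∀ k c → (+ 1 - k * + 0) * c - c * + 1 ≡ + 0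
      lemma = solve-∀
    point v (no hv) = Mod8.≋-trans (Mod8.≋-reflexive (trans (cong (λ z → wt v * C v - C (+ 0) * z) (δ-zero (λ e → hv (0⇒≋ {v} e))))
      (lemma (wt v * C v) (C (+ 0))))) (away hv)
      where
      lemma : ∀ a c → a - c * + 0 ≡ a
      lemma = solve-∀

  -- `W` is linear in `1 - θ`, so `χ₁-product` splits it into the two linear parts, the cross term
  -- that will vanish modulo 8, and the corrections at the two zeros.
  W-product : ∀ α β γ ε →
    W (λ v → χ₁ (linear α β v * linear γ ε v)) ≡
    W (λ v → χ₁ (linear α β v)) + W (λ v → χ₁ (linear γ ε v)) - cross (linear α β) (linear γ ε)
      - zeroSum α β γ ε - zeroSum γ ε α β
  W-product α β γ ε = trans (cong₂ (λ s t → s - t - wt (- + 1) * (+ 1 - χ₁ (x (- + 1) * y (- + 1))))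
      (trans (∑-combination ((+ 1 , A) ∷ (+ 1 , B) ∷ (- + 1 , C) ∷ (- + 1 , D) ∷ (- + 1 , E) ∷ [])
        (λ v → trans (cong (wt v *_) (χ₁-product (x v) (y v)))
          (expand (wt v) (+ 1 - χ₁ (x v)) (+ 1 - χ₁ (y v)) (δ (x v)) (δ (y v)))))
        refl)
      (χ₁-product (x (+ 0)) (y (+ 0))))
    (trans (cong (λ z → total ((+ 1 , A) ∷ (+ 1 , B) ∷ (- + 1 , C) ∷ (- + 1 , D) ∷ (- + 1 , E) ∷ []) - z₀ - wt (- + 1) * z)
        (χ₁-product (x (- + 1)) (y (- + 1))))
      (regroup (∑ₚ A) (∑ₚ B) (∑ₚ C) (∑ₚ D) (∑ₚ E) (+ 1 - χ₁ (x (+ 0))) (+ 1 - χ₁ (y (+ 0))) (δ (x (+ 0))) (δ (y (+ 0)))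
        (wt (- + 1)) (+ 1 - χ₁ (x (- + 1))) (+ 1 - χ₁ (y (- + 1))) (δ (x (- + 1))) (δ (y (- + 1)))))
    where
    x y A B C D E : ℤ → ℤ
    x = linear α β
    y = linear γ ε
    A v = wt v * (+ 1 - χ₁ (x v))
    B v = wt v * (+ 1 - χ₁ (y v))
    C v = wt v * ((+ 1 - χ₁ (x v)) * (+ 1 - χ₁ (y v)))
    D v = wt v * (δ (x v) * (+ 1 - χ₁ (y v)))
    E v = wt v * (δ (y v) * (+ 1 - χ₁ (x v)))
    z₀ : ℤ
    z₀ = (+ 1 - χ₁ (x (+ 0))) + (+ 1 - χ₁ (y (+ 0))) - (+ 1 - χ₁ (x (+ 0))) * (+ 1 - χ₁ (y (+ 0)))
      - δ (x (+ 0)) * (+ 1 - χ₁ (y (+ 0))) - δ (y (+ 0)) * (+ 1 - χ₁ (x (+ 0)))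
    expand : ∀ w a b d e → w * (a + b - a * b - d * b - e * a) ≡
      + 1 * (w * a) + (+ 1 * (w * b) + (- + 1 * (w * (a * b)) + (- + 1 * (w * (d * b)) + (- + 1 * (w * (e * a)) + + 0))))
    expand = solve-∀
    regroup : ∀ A B C D E a b d e w a′ b′ d′ e′ →
      + 1 * A + (+ 1 * B + (- + 1 * C + (- + 1 * D + (- + 1 * E + + 0)))) - (a + b - a * b - d * b - e * a)
        - w * (a′ + b′ - a′ * b′ - d′ * b′ - e′ * a′) ≡
      (A - a - w * a′) + (B - b - w * b′) - (C - a * b - w * (a′ * b′)) - (D - d * b - w * (d′ * b′)) - (E - e * a - w * (e′ * a′))
    regroup = solve-∀

  W-cong : ∀ {θ θ′ : ℤ → ℤ} → (∀ v → θ v ≡ θ′ v) → W θ ≡ W θ′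
  W-cong e = cong₂ _-_ (cong₂ _-_ (∑-cong (λ v → cong (λ z → wt v * (+ 1 - z)) (e v))) (cong (λ z → + 1 - z) (e (+ 0))))
    (cong (λ z → wt (- + 1) * (+ 1 - z)) (e (- + 1)))

  W-one : W (λ _ → + 1) ≡ + 0
  W-one = trans (cong (λ s → s - (+ 1 - + 1) - wt (- + 1) * (+ 1 - + 1)) (trans (∑-cong (λ v → ℤₚ.*-zeroʳ (wt v))) ∑-zero))
    (lemma (wt (- + 1)))
    where
    lemma : ∀ w → + 0 - (+ 1 - + 1) - w * (+ 1 - + 1) ≡ + 0
    lemma = solve-∀

  -- The hypotheses say that no nonzero coefficient becomes zero modulo `p`, so the case distinction
  -- made once over the integers is also the one modulo `p`.
  W-productTerm : ∀ α β γ ε →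
    (¬ α ≡ + 0 → ¬ α ≋ + 0) → (¬ β ≡ + 0 → ¬ β ≋ + 0) → (¬ γ ≡ + 0 → ¬ γ ≋ + 0) → (¬ ε ≡ + 0 → ¬ ε ≋ + 0) →
    W (λ v → χ₁ (linear α β v * linear γ ε v)) Mod8.≋ ⟦ productTerm α β γ ε ⟧
  W-productTerm α β γ ε hα hβ hγ hε = choose (α ℤₚ.≟ + 0) (β ℤₚ.≟ + 0) (γ ℤₚ.≟ + 0) (ε ℤₚ.≟ + 0)
    where
    V : ℤ
    V = W (λ v → χ₁ (linear α β v * linear γ ε v))
    degenerate : (∀ v → linear α β v * linear γ ε v ≡ + 0) → V ≡ + 0
    degenerate e = trans (W-cong (λ v → χ₁-zero (≋-reflexive (e v)))) W-one
    zeroˡ : α ≡ + 0 → β ≡ + 0 → V ≡ + 0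
    zeroˡ α0 β0 = degenerate (λ v → trans (cong (_* linear γ ε v) (trans (linear-constant α β0 v) α0)) (ℤₚ.*-zeroˡ (linear γ ε v)))
    zeroʳ : γ ≡ + 0 → ε ≡ + 0 → V ≡ + 0
    zeroʳ γ0 ε0 = degenerate (λ v → trans (cong (linear α β v *_) (trans (linear-constant γ ε0 v) γ0)) (ℤₚ.*-zeroʳ (linear α β v)))
    generic : (β ≡ + 0 → ¬ α ≋ + 0) → (ε ≡ + 0 → ¬ γ ≋ + 0) → ∀ β? ε? →
      V Mod8.≋ ⟦ linearTerm α β β? ⊕ linearTerm γ ε ε? ⊝ zeroTerm α β γ ε β? ⊝ zeroTerm γ ε α β ε? ⟧
    generic g g′ β? ε? = Mod8.≋-trans (Mod8.≋-reflexive (W-product α β γ ε))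
      (Mod8.≋-trans (Mod8.+-congʳ (- zeroSum γ ε α β) (Mod8.+-congʳ (- zeroSum α β γ ε)
          (Mod8.+-congˡ (W (λ v → χ₁ (linear α β v)) + W (λ v → χ₁ (linear γ ε v)))
            (Mod8.neg-cong (cross-mod8 (linear α β) (linear γ ε)
              (λ e → χ₁-cong (linear-cong α β e)) (λ e → χ₁-cong (linear-cong γ ε e)))))))
        (Mod8.≋-reflexive (cong₂ _-_ (cong₂ _-_
          (trans (ℤₚ.+-identityʳ _) (cong₂ _+_ (W-linear α β β? hβ) (W-linear γ ε ε? hε)))
          (zeroSum-term α β γ ε β? hβ g)) (zeroSum-term γ ε α β ε? hε g′))))
    absurd : ∀ {a : ℤ} {A : Set} → ¬ a ≡ + 0 → a ≡ + 0 → A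
    absurd h e = ⊥-elim (h e)
    choose : ∀ α? β? γ? ε? → V Mod8.≋ ⟦ splitTerm α β γ ε α? β? γ? ε? ⟧
    choose (yes a) (yes b) _ _             = Mod8.≋-reflexive (zeroˡ a b)
    choose (yes a) (no b) (yes c) (yes d)  = Mod8.≋-reflexive (zeroʳ c d)
    choose (no a) _ (yes c) (yes d)        = Mod8.≋-reflexive (zeroʳ c d)
    choose (yes a) (no b) (yes c) (no d)   = generic (absurd b) (absurd d) (no b) (no d)
    choose (yes a) (no b) (no c) ε?        = generic (absurd b) (λ _ → hγ c) (no b) ε?
    choose (no a) β? (yes c) (no d)        = generic (λ _ → hα a) (absurd d) β? (no d)
    choose (no a) β? (no c) ε?             = generic (λ _ → hα a) (λ _ → hγ c) β? ε?

-- The quadratic case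

-- 4 P ≡ quadraticTerm + signTerm · S (mod 16), where A, σ, Δ are b + 2 c, a + b + c and the discriminant.
quadraticTerm : (c A σ Δ : ℤ) → Term
quadraticTerm c A σ Δ =
  con (+ 4) ⊝ con (+ 2) ⊗ (size ⊝ con (+ 1) ⊕ chi c ⊝ chi Δ)
  -- The bracket consists of `D` at 0, twice `edge`, the value of `E + 2 ρ`, and the elementary sums
  -- from `∑-D`. The products with 0 are left unreduced so that the first part is literally
  -- `D (+ 0)`.
  ⊝ kap ⊗ ((con (+ 1) ⊕ chi (+ 0 * + 0 - + 4 * (c * σ))) ⊗ ((con (+ 1) ⊕ chi (A + + 0)) ⊗ (con (+ 1) ⊕ chi (A - + 0)))
      ⊕ con (+ 2) ⊗ ((con (+ 1) ⊝ del A) ⊗ ((con (+ 1) ⊕ chi Δ) ⊗ (con (+ 1) ⊕ chi (+ 2 * A))))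
      ⊕ (con (+ 1) ⊕ chi Δ) ⊗ (con (+ 1) ⊕ chi (c * σ)) ⊗ (con (+ 2) ⊕ chi (- c))
      ⊝ (size ⊝ con (+ 1)) ⊝ chi (- + 1) ⊗ (size ⊗ del A ⊝ con (+ 1)) ⊕ chi (- + 1))
  ⊕ con (+ 2) ⊗ (con (+ 1) ⊝ chi₁ (c * + 0 * + 0 + A * + 0 + σ))
  ⊕ con (+ 2) ⊗ (weight₋₁ ⊗ (con (+ 1) ⊝ chi₁ (c * - + 1 * - + 1 + A * - + 1 + σ)))

signTerm : (c σ : ℤ) → Term
signTerm c σ = kap ⊗ chi (- (c * σ))

module QuadraticSums (n : ℕ) (1<n : 1 ℕ.< n) (prime : Prime (suc (n ℕ.+ n))) (c A σ Δ : ℤ)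
  (hc : ¬ OddPrime._≋_ n 1<n prime c (+ 0)) (hσ : ¬ OddPrime._≋_ n 1<n prime σ (+ 0))
  (hΔ : ¬ OddPrime._≋_ n 1<n prime Δ (+ 0)) (disc≡ : A * A - + 4 * (c * σ) ≡ Δ) where

  open LinearFactors n 1<n prime

  B : ℤ
  B = c * σ

  q : ℤ → ℤ
  q v = c * v * v + A * v + σ

  hB : ¬ B ≋ + 0
  hB = *-≢0 hc hσ

  h2c : ¬ + 2 * c ≋ + 0
  h2c = *-≢0 2≢0 hc

  complete : ∀ v → + 4 * c * q v ≡ (+ 2 * c * v + A) * (+ 2 * c * v + A) - Δ
  complete v = trans (lemma c A σ v) (cong (λ z → (+ 2 * c * v + A) * (+ 2 * c * v + A) - z) disc≡)
    where
    lemma : ∀ c A σ v → + 4 * c * (c * v * v + A * v + σ) ≡ (+ 2 * c * v + A) * (+ 2 * c * v + A) - (A * A - + 4 * (c * σ))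
    lemma = solve-∀

  δ-q : ∀ v → δ (q v) ≡ δ ((+ 2 * c * v + A) * (+ 2 * c * v + A) - Δ)
  δ-q v = trans (δ-iff (*-zeroʳ (+ 4 * c)) (λ e → [ (λ e′ → ⊥-elim (*-≢0 4≢0 hc e′)) , (λ e′ → e′) ]′ (euclid (+ 4 * c) (q v) e)))
    (cong δ (complete v))

  ∑-δ-q : ∑ₚ (λ v → δ (q v)) ≡ + 1 + χ Δ
  ∑-δ-q = trans (∑-cong δ-q) (trans (∑-affine (λ w → δ (w * w - Δ)) (λ e → δ-cong (+-congʳ (- Δ) (*-cong e e))) (+ 2 * c) A h2c)
    (square-count Δ))

  -- Multiplying by `χ (4 c) = χ c` completes the square; the remaining sum of `χ (w² - Δ)` is -1
  -- because `Δ` is a unit.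
  ∑-χ-q : ∑ₚ (λ v → χ (q v)) ≡ - χ c
  ∑-χ-q = begin
    ∑ₚ (λ v → χ (q v))
      ≡⟨ ∑-cong (λ v → trans (sym (ℤₚ.*-identityˡ (χ (q v)))) (trans (cong (_* χ (q v)) (sym (sign-square (χ-sign hc))))
           (trans (ℤₚ.*-assoc (χ c) (χ c) (χ (q v))) (cong (χ c *_) (point v))))) ⟩
    ∑ₚ (λ v → χ c * χ ((+ 2 * c * v + A) * (+ 2 * c * v + A) - Δ))
      ≡⟨ ∑-*ˡ (χ c) (λ v → χ ((+ 2 * c * v + A) * (+ 2 * c * v + A) - Δ)) ⟩
    χ c * ∑ₚ (λ v → χ ((+ 2 * c * v + A) * (+ 2 * c * v + A) - Δ))
      ≡⟨ cong (χ c *_) (trans (∑-affine (λ w → χ (w * w - Δ)) (λ e → χ-cong (+-congʳ (- Δ) (*-cong e e))) (+ 2 * c) A h2c)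
           (trans (∑-χ-squares-minus Δ) (cong (λ z → + p * z - + 1) (δ-zero hΔ)))) ⟩
    χ c * (+ p * + 0 - + 1)
      ≡⟨ lemma (χ c) (+ p) ⟩
    - χ c ∎
    where
    open ≡-Reasoning
    point : ∀ v → χ c * χ (q v) ≡ χ ((+ 2 * c * v + A) * (+ 2 * c * v + A) - Δ)
    point v = trans (cong (_* χ (q v)) (sym (χ-4 c))) (trans (sym (χ-* (+ 4 * c) (q v))) (cong χ (complete v)))
    lemma : ∀ x P → x * (P * + 0 - + 1) ≡ - x
    lemma = solve-∀

  -- `τ` is the part of the sum over `χ v` that leads to the cubic, `ρ` the contribution of the
  -- zeros of `q`, where `χ₁` is 1 instead of 0.
  τ ρ : ℤ
  τ = ∑ₚ (λ u → χ (u * u - + 4 * B) * χ (A + u))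
  ρ = ∑ₚ (λ v → δ (q v) * χ v)

  -- χ (v q v) = χ (A + u) for u = c v + σ / v, and each u comes from 1 + χ (u² - 4 B) values of v.
  ∑-χ-vq : ∑ₚ (λ v → χ (v * q v)) ≡ τ
  ∑-χ-vq = begin
    ∑ₚ (λ v → χ (v * q v))
      ≡⟨ ∑-cong (λ v → point v (zero? v)) ⟨
    ∑ₚ (λ v → ∑ₚ (λ u → δ (r u v) * χ (A + u)))
      ≡⟨ ∑-swap (λ v u → δ (r u v) * χ (A + u)) ⟩
    ∑ₚ (λ u → ∑ₚ (λ v → δ (r u v) * χ (A + u)))
      ≡⟨ ∑-cong (λ u → trans (∑-cong (λ v → ℤₚ.*-comm (δ (r u v)) (χ (A + u)))) (trans (∑-*ˡ (χ (A + u)) (λ v → δ (r u v)))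
           (trans (cong (χ (A + u) *_) (count u)) (expand (χ (A + u)) (χ (u * u - + 4 * B)))))) ⟩
    ∑ₚ (λ u → χ (A + u) + χ (u * u - + 4 * B) * χ (A + u))
      ≡⟨ ∑-+ (λ u → χ (A + u)) (λ u → χ (u * u - + 4 * B) * χ (A + u)) ⟩
    ∑ₚ (λ u → χ (A + u)) + τ
      ≡⟨ cong (_+ τ) (trans (∑-cong (λ u → cong χ (lemma A u))) (∑-χ-affine (+ 1) A 1≢0)) ⟩
    + 0 + τ
      ≡⟨ ℤₚ.+-identityˡ τ ⟩
    τ ∎
    where
    open ≡-Reasoning
    r : ℤ → ℤ → ℤ
    r u v = c * v * v - u * v + σ
    expand : ∀ x y → x * (+ 1 + y) ≡ x + y * x
    expand = solve-∀
    lemma : ∀ A u → A + u ≡ + 1 * u + A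
    lemma = solve-∀
    complete-r : ∀ c σ u v → + 4 * c * (c * v * v - u * v + σ) ≡
      (+ 2 * c * v + - u) * (+ 2 * c * v + - u) - (u * u - + 4 * (c * σ))
    complete-r = solve-∀
    count : ∀ u → ∑ₚ (λ v → δ (r u v)) ≡ + 1 + χ (u * u - + 4 * B)
    count u = trans (∑-cong (λ v → trans
        (δ-iff (*-zeroʳ (+ 4 * c)) (λ e → [ (λ e′ → ⊥-elim (*-≢0 4≢0 hc e′)) , (λ e′ → e′) ]′ (euclid (+ 4 * c) (r u v) e)))
        (cong δ (complete-r c σ u v))))
      (trans (∑-affine (λ w → δ (w * w - (u * u - + 4 * B))) (λ e → δ-cong (+-congʳ (- (u * u - + 4 * B)) (*-cong e e))) (+ 2 * c) (- u) h2c)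
        (square-count (u * u - + 4 * B)))
    point : ∀ v → Dec (v ≋ + 0) → ∑ₚ (λ u → δ (r u v) * χ (A + u)) ≡ χ (v * q v)
    point v (yes v0) = trans (trans (∑-cong (λ u → trans (cong (_* χ (A + u)) (δ-zero {r u v} (λ e → hσ (by₂ e v0 (+ 1) (- (c * v - u)) (lemma₀ c v u σ)))))
        (ℤₚ.*-zeroˡ (χ (A + u))))) ∑-zero) (sym (χ-zero (*-zeroˡ (q v) v0)))
      where
      lemma₀ : ∀ c v u σ → σ - + 0 ≡ + 1 * (c * v * v - u * v + σ - + 0) + - (c * v - u) * (v - + 0)
      lemma₀ = solve-∀
    point v (no hv) = trans (∑-cong (λ u → cong (_* χ (A + u)) (δ-iff
        (λ e → [ (λ e′ → ⊥-elim (neg-≢0 hv e′)) , (λ e′ → e′) ]′ (euclid (- v) (u - u₀) (≋-trans (root-of u) e)))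
        (λ e → ≋-trans (≋-sym (root-of u)) (*-zeroʳ (- v) e)))))
      (trans (∑-δ u₀ (λ u → χ (A + u)) (λ e → χ-cong (+-congˡ A e)))
        (trans (sym (trans (χ-* (v * v) (A + u₀)) (trans (cong (_* χ (A + u₀)) (χ-square v hv ≋-refl)) (ℤₚ.*-identityˡ (χ (A + u₀))))))
          (χ-cong (by (inv-* hv) (v * (c * v * v + σ)) (lemma₂ c v σ A (inv v))))))
      where
      u₀ : ℤ
      u₀ = (c * v * v + σ) * inv v
      lemma₁ : ∀ c v u σ i → - v * (u - (c * v * v + σ) * i) - (c * v * v - u * v + σ) ≡ (c * v * v + σ) * (v * i - + 1)
      lemma₁ = solve-∀
      lemma₂ : ∀ c v σ A i → v * v * (A + (c * v * v + σ) * i) - v * (c * v * v + A * v + σ) ≡ v * (c * v * v + σ) * (v * i - + 1)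
      lemma₂ = solve-∀
      root-of : ∀ u → - v * (u - u₀) ≋ r u v
      root-of u = by (inv-* hv) (c * v * v + σ) (lemma₁ c v u σ (inv v))

  W-quadratic : W (λ v → χ₁ (q v)) ≡
    + p - + 1 + χ c - χ Δ + κ n * (τ + ρ) - (+ 1 - χ₁ (q (+ 0))) - wt (- + 1) * (+ 1 - χ₁ (q (- + 1)))
  W-quadratic = cong (λ z → z - (+ 1 - χ₁ (q (+ 0))) - wt (- + 1) * (+ 1 - χ₁ (q (- + 1))))
    (trans (∑-combination
        ((+ 1 , (λ _ → + 1)) ∷ (- + 1 , (λ v → χ (q v))) ∷ (- + 1 , (λ v → δ (q v))) ∷ (- k , χ) ∷
         (k , (λ v → χ (v * q v))) ∷ (k , (λ v → δ (q v) * χ v)) ∷ [])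
        (λ v → trans (lemma k (χ v) (χ (q v)) (δ (q v))) (cong (λ z → + 1 * + 1 + (- + 1 * χ (q v) + (- + 1 * δ (q v) +
          (- k * χ v + (k * z + (k * (δ (q v) * χ v) + + 0)))))) (sym (χ-* v (q v))))))
      (trans (sums ∑-one ∑-χ-q ∑-δ-q ∑-χ ∑-χ-vq) (lemma′ (+ p) (χ c) (χ Δ) k τ ρ)))
    where
    k = κ n
    lemma : ∀ k c x d → (+ 1 - k * c) * (+ 1 - (x + d)) ≡
      + 1 * + 1 + (- + 1 * x + (- + 1 * d + (- k * c + (k * (c * x) + (k * (d * c) + + 0)))))
    lemma = solve-∀
    lemma′ : ∀ P c d k τ ρ → + 1 * P + (- + 1 * - c + (- + 1 * (+ 1 + d) + (- k * + 0 + (k * τ + (k * ρ + + 0))))) ≡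
      P - + 1 + c - d + k * (τ + ρ)
    lemma′ = solve-∀
    sums : ∀ {a a′ b b′ c c′ d d′ e e′} → a ≡ a′ → b ≡ b′ → c ≡ c′ → d ≡ d′ → e ≡ e′ →
      + 1 * a + (- + 1 * b + (- + 1 * c + (- k * d + (k * e + (k * ρ + + 0))))) ≡
      + 1 * a′ + (- + 1 * b′ + (- + 1 * c′ + (- k * d′ + (k * e′ + (k * ρ + + 0)))))
    sums refl refl refl refl refl = refl

  -- Even in `u`, and a multiple of 8 wherever no argument of `χ` vanishes. Expanding it yields `τ`
  -- twice, from `A + u` and from `A - u`, next to a product of all three characters, which depends
  -- on `u²` only.
  D : ℤ → ℤ
  D u = (+ 1 + χ (u * u - + 4 * B)) * ((+ 1 + χ (A + u)) * (+ 1 + χ (A - u)))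

  cubic : ℤ → ℤ → ℤ
  cubic k y = y * (y + + 1) * (y + k)

  square-difference : + 4 * B - A * A ≡ - Δ
  square-difference = trans (lemma (+ 4 * B) (A * A)) (cong -_ disc≡)
    where
    lemma : ∀ x y → x - y ≡ - (y - x)
    lemma = solve-∀

  private
    XY-product : ∑ₚ (λ u → χ ((A + u) * (A - u))) ≡ χ (- + 1) * (+ p * δ A - + 1)
    XY-product = trans (∑-cong (λ u → trans (cong χ (lemma A u)) (χ-* (- + 1) ((u - A) * (u - - A)))))
      (trans (∑-*ˡ (χ (- + 1)) (λ u → χ ((u - A) * (u - - A)))) (cong (χ (- + 1) *_)
        (trans (∑-χ-product A (- A)) (cong (λ z → + p * z - + 1) (δ-iff
          (λ e → [ (λ e′ → ⊥-elim (2≢0 e′)) , (λ e′ → e′) ]′ (euclid (+ 2) A (≋-trans (≋-reflexive (double A)) e)))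
          (λ e → ≋-trans (≋-reflexive (sym (double A))) (*-zeroʳ (+ 2) e)))))))
      where
      lemma : ∀ A u → (A + u) * (A - u) ≡ - + 1 * ((u - A) * (u - - A))
      lemma = solve-∀
      double : ∀ A → + 2 * A ≡ A - - A
      double = solve-∀

    -- In `1 + χ U` from `∑-squares` the 1 gives a quadratic sum equal to `- χ (- 1)`. The rest is
    -- the cubic with zeros `4 B`, 0 and `A²`, which `U = 4 B (y + 1)` carries to 0, -1 and `- k`,
    -- since `A² - 4 B = Δ`.
    triple-product : ∀ k → + 4 * B * k ≋ - Δ →
      ∑ₚ (λ u → χ ((u * u - + 4 * B) * (A * A - u * u))) ≡ - χ (- + 1) + χ (- B) * ∑ₚ (λ y → χ (cubic k y))
    triple-product k hk = begin
      ∑ₚ (λ u → χ ((u * u - + 4 * B) * (A * A - u * u)))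
        ≡⟨ ∑-squares (λ U → χ ((U - + 4 * B) * (A * A - U)))
             (λ e → χ-cong (*-cong (+-congʳ (- (+ 4 * B)) e) (+-congˡ (A * A) (neg-cong e)))) ⟩
      ∑ₚ (λ U → (+ 1 + χ U) * χ ((U - + 4 * B) * (A * A - U)))
        ≡⟨ ∑-combination ((χ (- + 1) , (λ U → χ ((U - + 4 * B) * (U - A * A)))) ∷ (+ 1 , F) ∷ [])
             (λ U → trans (expand (χ U) (χ ((U - + 4 * B) * (A * A - U)))) (cong₂ (λ s t → s + (+ 1 * t + + 0))
               (trans (cong χ (flip U (+ 4 * B) (A * A))) (χ-* (- + 1) ((U - + 4 * B) * (U - A * A))))
               (sym (χ-* U ((U - + 4 * B) * (A * A - U)))))) ⟩
      χ (- + 1) * ∑ₚ (λ U → χ ((U - + 4 * B) * (U - A * A))) + (+ 1 * ∑ₚ F + + 0)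
        ≡⟨ cong₂ (λ s t → χ (- + 1) * s + (+ 1 * t + + 0))
             (trans (∑-χ-product (+ 4 * B) (A * A)) (cong (λ z → + p * z - + 1)
               (δ-zero (λ e → neg-≢0 hΔ (subst (_≋ + 0) square-difference e)))))
             (trans (sym (∑-affine F F-cong (+ 4 * B) (+ 4 * B) (*-≢0 4≢0 hB))) (trans (∑-cong rescale) (∑-*ˡ (χ (- B)) (λ y → χ (cubic k y))))) ⟩
      χ (- + 1) * (+ p * + 0 - + 1) + (+ 1 * (χ (- B) * ∑ₚ (λ y → χ (cubic k y))) + + 0)
        ≡⟨ finish (χ (- + 1)) (+ p) (χ (- B) * ∑ₚ (λ y → χ (cubic k y))) ⟩
      - χ (- + 1) + χ (- B) * ∑ₚ (λ y → χ (cubic k y)) ∎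
      where
      open ≡-Reasoning
      F : ℤ → ℤ
      F U = χ (U * ((U - + 4 * B) * (A * A - U)))
      F-cong : Periodic₁ F
      F-cong e = χ-cong (*-cong e (*-cong (+-congʳ (- (+ 4 * B)) e) (+-congˡ (A * A) (neg-cong e))))
      expand : ∀ x y → (+ 1 + x) * y ≡ y + (+ 1 * (x * y) + + 0)
      expand = solve-∀
      flip : ∀ U b a → (U - b) * (a - U) ≡ - + 1 * ((U - b) * (U - a))
      flip = solve-∀
      finish : ∀ x P z → x * (P * + 0 - + 1) + (+ 1 * z + + 0) ≡ - x + z
      finish = solve-∀
      hk′ : + 4 * B * k ≋ + 4 * B - A * A
      hk′ = ≋-trans hk (≋-reflexive (sym square-difference))
      substitution : ∀ b k y a → (b * y + b) * ((b * y + b - b) * (a - (b * y + b))) - b * b * (- b * (y * (y + + 1) * (y + k))) ≡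
        b * b * (y * (y + + 1)) * (b * k - (b - a))
      substitution = solve-∀
      rescale : ∀ y → F (+ 4 * B * y + + 4 * B) ≡ χ (- B) * χ (cubic k y)
      rescale y = begin
        F (+ 4 * B * y + + 4 * B)
          ≡⟨ χ-cong (by hk′ (+ 4 * B * (+ 4 * B) * (y * (y + + 1))) (substitution (+ 4 * B) k y (A * A))) ⟩
        χ (+ 4 * B * (+ 4 * B) * (- (+ 4 * B) * cubic k y))
          ≡⟨ χ-* (+ 4 * B * (+ 4 * B)) (- (+ 4 * B) * cubic k y) ⟩
        χ (+ 4 * B * (+ 4 * B)) * χ (- (+ 4 * B) * cubic k y)
          ≡⟨ cong₂ _*_ (χ-square (+ 4 * B) (*-≢0 4≢0 hB) ≋-refl) (χ-* (- (+ 4 * B)) (cubic k y)) ⟩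
        + 1 * (χ (- (+ 4 * B)) * χ (cubic k y))
          ≡⟨ ℤₚ.*-identityˡ (χ (- (+ 4 * B)) * χ (cubic k y)) ⟩
        χ (- (+ 4 * B)) * χ (cubic k y)
          ≡⟨ cong (_* χ (cubic k y)) (trans (cong χ (ℤₚ.neg-distribʳ-* (+ 4) B)) (χ-4 (- B))) ⟩
        χ (- B) * χ (cubic k y) ∎

    reflected : ∑ₚ (λ u → χ (u * u - + 4 * B) * χ (A - u)) ≡ τ
    reflected = trans (∑-cong (λ u → cong₂ (λ s t → χ (s - + 4 * B) * χ (A + t)) (lemma u) (sym (ℤₚ.-1*i≡-i u))))
      (∑-dilate (λ u → χ (u * u - + 4 * B) * χ (A + u))
        (λ e → cong₂ _*_ (χ-cong (+-congʳ (- (+ 4 * B)) (*-cong e e))) (χ-cong (+-congˡ A e))) (- + 1) (neg-≢0 1≢0))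
      where
      lemma : ∀ u → u * u ≡ (- + 1 * u) * (- + 1 * u)
      lemma = solve-∀

  -- Of the eight terms of the expanded product, 1 and `χ (u² - 4 B)` give `p - 1`, the two linear
  -- ones vanish, the two mixed ones are `τ` each, and the last two are `XY-product` and
  -- `triple-product`.
  ∑-D : ∀ k → + 4 * B * k ≋ - Δ → ∑ₚ D ≡
    + p - + 1 + + 2 * τ + χ (- + 1) * (+ p * δ A - + 1) - χ (- + 1) + χ (- B) * ∑ₚ (λ y → χ (cubic k y))
  ∑-D k hk = trans (∑-combination
      ((+ 1 , (λ _ → + 1)) ∷ (+ 1 , (λ u → χ (u * u - + 4 * B))) ∷ (+ 1 , (λ u → χ (+ 1 * u + A))) ∷ (+ 1 , (λ u → χ (- + 1 * u + A))) ∷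
       (+ 1 , (λ u → χ ((A + u) * (A - u)))) ∷ (+ 1 , (λ u → χ (u * u - + 4 * B) * χ (A + u))) ∷
       (+ 1 , (λ u → χ (u * u - + 4 * B) * χ (A - u))) ∷ (+ 1 , (λ u → χ ((u * u - + 4 * B) * (A * A - u * u)))) ∷ [])
      point)
    (trans (sums ∑-one (trans (∑-χ-squares-minus (+ 4 * B)) (cong (λ z → + p * z - + 1) (δ-zero (*-≢0 4≢0 hB))))
        (∑-χ-affine (+ 1) A 1≢0) (∑-χ-affine (- + 1) A (neg-≢0 1≢0)) XY-product reflected (triple-product k hk))
      (lemma (+ p) (χ (- + 1) * (+ p * δ A - + 1)) τ (χ (- + 1)) (χ (- B) * ∑ₚ (λ y → χ (cubic k y)))))
    where
    expand : ∀ x y z → (+ 1 + x) * ((+ 1 + y) * (+ 1 + z)) ≡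
      + 1 * + 1 + (+ 1 * x + (+ 1 * y + (+ 1 * z + (+ 1 * (y * z) + (+ 1 * (x * y) + (+ 1 * (x * z) + (+ 1 * (x * (y * z)) + + 0)))))))
    expand = solve-∀
    lemma : ∀ P a τ c s → + 1 * P + (+ 1 * (P * + 0 - + 1) + (+ 1 * + 0 + (+ 1 * + 0 + (+ 1 * a + (+ 1 * τ + (+ 1 * τ + (+ 1 * (- c + s) + + 0))))))) ≡
      P - + 1 + + 2 * τ + a - c + s
    lemma = solve-∀
    sums : ∀ {a a′ b b′ c c′ d d′ e e′ f f′ g g′} → a ≡ a′ → b ≡ b′ → c ≡ c′ → d ≡ d′ → e ≡ e′ → f ≡ f′ → g ≡ g′ →
      + 1 * a + (+ 1 * b + (+ 1 * c + (+ 1 * d + (+ 1 * e + (+ 1 * τ + (+ 1 * f + (+ 1 * g + + 0))))))) ≡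
      + 1 * a′ + (+ 1 * b′ + (+ 1 * c′ + (+ 1 * d′ + (+ 1 * e′ + (+ 1 * τ + (+ 1 * f′ + (+ 1 * g′ + + 0)))))))
    sums refl refl refl refl refl refl refl = refl
    comm₁ : ∀ A u → A + u ≡ + 1 * u + A
    comm₁ = solve-∀
    comm₂ : ∀ A u → A - u ≡ - + 1 * u + A
    comm₂ = solve-∀
    product : ∀ A u → (A + u) * (A - u) ≡ A * A - u * u
    product = solve-∀
    point : ∀ u → D u ≡ _
    point u = trans (expand X Y Y′) (sums′ (cong χ (comm₁ A u)) (cong χ (comm₂ A u)) (sym (χ-* (A + u) (A - u)))
      (trans (cong (X *_) (sym (χ-* (A + u) (A - u)))) (trans (sym (χ-* (u * u - + 4 * B) ((A + u) * (A - u))))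
        (cong (λ z → χ ((u * u - + 4 * B) * z)) (product A u)))))
      where
      X Y Y′ : ℤ
      X = χ (u * u - + 4 * B)
      Y = χ (A + u)
      Y′ = χ (A - u)
      sums′ : ∀ {c c′ d d′ e e′ g g′} → c ≡ c′ → d ≡ d′ → e ≡ e′ → g ≡ g′ →
        + 1 * + 1 + (+ 1 * X + (+ 1 * c + (+ 1 * d + (+ 1 * e + (+ 1 * (X * Y) + (+ 1 * (X * Y′) + (+ 1 * g + + 0))))))) ≡
        + 1 * + 1 + (+ 1 * X + (+ 1 * c′ + (+ 1 * d′ + (+ 1 * e′ + (+ 1 * (X * Y) + (+ 1 * (X * Y′) + (+ 1 * g′ + + 0)))))))
      sums′ refl refl refl refl = refl

  δ-neg : ∀ x → δ (- x) ≡ δ x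
  δ-neg x = δ-iff (λ e → by e (- + 1) (lemma x)) neg-≋0
    where
    lemma : ∀ x → x - + 0 ≡ - + 1 * (- x - + 0)
    lemma = solve-∀
    neg-≋0 : x ≋ + 0 → - x ≋ + 0
    neg-≋0 = neg-cong

  -- The value of `D` at `A` and at `- A`, where one of its factors is `1 + χ 0 = 1`. If `A`
  -- vanishes these points coincide with 0, which is counted separately; hence the factor `1 - δ A`.
  edge : ℤ
  edge = (+ 1 - δ A) * ((+ 1 + χ Δ) * (+ 1 + χ (+ 2 * A)))

  -- The sum of `D` over the zeros of `u² - 4 B`, where its first factor is 1.
  E : ℤ
  E = ∑ₚ (λ u → δ (u * u - + 4 * B) * ((+ 1 + χ (A + u)) * (+ 1 + χ (A - u))))

  private
    Φ : (X Y Y′ a b c e : ℤ) → ℤ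
    Φ X Y Y′ a b c e = (+ 1 + X) * ((+ 1 + Y) * (+ 1 + Y′)) - D (+ 0) * a - edge * b - edge * c - e * ((+ 1 + Y) * (+ 1 + Y′))

    -- `D` with its values at 0, at `A` and `- A`, and at the square roots of `4 B` removed. What
    -- remains vanishes at these points and is a multiple of 8 elsewhere.
    interior : ℤ → ℤ
    interior u = Φ (χ (u * u - + 4 * B)) (χ (A + u)) (χ (A - u)) (δ (u - + 0)) (δ (u - A)) (δ (u - - A)) (δ (u * u - + 4 * B))

    Φ-cong : ∀ {X Y Y′ a b c e X₁ Y₁ Y₁′ a₁ b₁ c₁ e₁} → X ≡ X₁ → Y ≡ Y₁ → Y′ ≡ Y₁′ → a ≡ a₁ → b ≡ b₁ → c ≡ c₁ → e ≡ e₁ →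
      Φ X Y Y′ a b c e ≡ Φ X₁ Y₁ Y₁′ a₁ b₁ c₁ e₁
    Φ-cong refl refl refl refl refl refl refl = refl

    interior-cong : Periodic₁ interior
    interior-cong e = Φ-cong (χ-cong (+-congʳ (- (+ 4 * B)) (*-cong e e))) (χ-cong (+-congˡ A e)) (χ-cong (+-congˡ A (neg-cong e)))
      (δ-cong (+-congʳ (- + 0) e)) (δ-cong (+-congʳ (- A) e)) (δ-cong (+-congʳ (- - A) e)) (δ-cong (+-congʳ (- (+ 4 * B)) (*-cong e e)))

    interior-even : ∀ u → interior (- u) ≡ interior u
    interior-even u = trans (Φ-cong {Y = χ (A - u)} (cong (λ z → χ (z - + 4 * B)) (square u)) refl (cong χ (cong (λ z → A + z) (ℤₚ.neg-involutive u)))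
        (trans (cong δ (lemma₀ u)) (δ-neg (u - + 0))) (trans (cong δ (lemma₁ u A)) (δ-neg (u - - A)))
        (trans (cong δ (lemma₂ u A)) (δ-neg (u - A))) (cong (λ z → δ (z - + 4 * B)) (square u)))
      (swap (χ (u * u - + 4 * B)) (χ (A + u)) (χ (A - u)) (δ (u - + 0)) (δ (u - A)) (δ (u - - A)) (δ (u * u - + 4 * B)) (D (+ 0)) edge)
      where
      square : ∀ u → - u * - u ≡ u * u
      square = solve-∀
      lemma₀ : ∀ u → - u - + 0 ≡ - (u - + 0)
      lemma₀ = solve-∀
      lemma₁ : ∀ u A → - u - A ≡ - (u - - A)
      lemma₁ = solve-∀
      lemma₂ : ∀ u A → - u - - A ≡ - (u - A)
      lemma₂ = solve-∀
      swap : ∀ X Y Y′ a b c e d m → (+ 1 + X) * ((+ 1 + Y′) * (+ 1 + Y)) - d * a - m * c - m * b - e * ((+ 1 + Y′) * (+ 1 + Y)) ≡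
        (+ 1 + X) * ((+ 1 + Y) * (+ 1 + Y′)) - d * a - m * b - m * c - e * ((+ 1 + Y) * (+ 1 + Y′))
      swap = solve-∀

    interior-zero : ∀ {u} → u ≋ + 0 → interior u ≡ + 0
    interior-zero {u} u0 = trans (interior-cong u0) (split (zero? A))
      where
      X Y Y′ : ℤ
      X = χ (+ 0 * + 0 - + 4 * B)
      Y = χ (A + + 0)
      Y′ = χ (A - + 0)
      e0 : δ (+ 0 * + 0 - + 4 * B) ≡ + 0
      e0 = δ-zero (λ e → *-≢0 4≢0 hB (by e (- + 1) (lemma (+ 4 * B))))
        where
        lemma : ∀ b → b - + 0 ≡ - + 1 * (+ 0 * + 0 - b - + 0)
        lemma = solve-∀
      a1 : δ (+ 0 - + 0) ≡ + 1
      a1 = δ-one ≋-refl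
      split : Dec (A ≋ + 0) → interior (+ 0) ≡ + 0
      split (yes A0) = trans (Φ-cong {X} {Y} {Y′} {b = δ (+ 0 - A)} {c = δ (+ 0 - - A)} refl refl refl a1 refl refl e0)
        (trans (cong (λ z → D (+ 0) - D (+ 0) * + 1 - (+ 1 - z) * M * δ (+ 0 - A) - (+ 1 - z) * M * δ (+ 0 - - A) - + 0 * ((+ 1 + Y) * (+ 1 + Y′))) (δ-one A0))
          (lemma (D (+ 0)) M (δ (+ 0 - A)) (δ (+ 0 - - A)) ((+ 1 + Y) * (+ 1 + Y′))))
        where
        M : ℤ
        M = (+ 1 + χ Δ) * (+ 1 + χ (+ 2 * A))
        lemma : ∀ d m b c y → d - d * + 1 - (+ 1 - + 1) * m * b - (+ 1 - + 1) * m * c - + 0 * y ≡ + 0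
        lemma = solve-∀
      split (no hA) = trans (Φ-cong {X} {Y} {Y′} refl refl refl a1
          (δ-zero (λ e → hA (≋-sym (0⇒≋ {+ 0} {A} e)))) (δ-zero (λ e → neg-≢0 hA (≋-sym (0⇒≋ {+ 0} { - A} e)))) e0)
        (lemma (D (+ 0)) edge ((+ 1 + Y) * (+ 1 + Y′)))
        where
        lemma : ∀ d m y → d - d * + 1 - m * + 0 - m * + 0 - + 0 * y ≡ + 0
        lemma = solve-∀

    signs-mod8 : ∀ {x y z} → IsSign x → IsSign y → IsSign z → (+ 1 + x) * ((+ 1 + y) * (+ 1 + z)) Mod8.≋ + 0
    signs-mod8 {y = y} {z} neg _ _   = Mod8.≋-reflexive (ℤₚ.*-zeroˡ ((+ 1 + y) * (+ 1 + z)))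
    signs-mod8 {x} pos neg _ = Mod8.≋-refl
    signs-mod8 pos pos neg = Mod8.≋-refl
    signs-mod8 pos pos pos = Mod8.mod (divides (+ 1) refl)

    on-edge : ∀ {u w} → w * w ≡ A * A → u ≋ w → u * u - + 4 * B ≋ Δ
    on-edge ww e = ≋-trans (+-congʳ (- (+ 4 * B)) (*-cong e e)) (≋-reflexive (trans (cong (_- + 4 * B) ww) disc≡))

    interior-edge : ∀ {u} → ¬ u ≋ + 0 → ¬ u * u - + 4 * B ≋ + 0 → u ≋ A → interior u ≡ + 0
    interior-edge {u} hu he u≋A = trans (Φ-cong (χ-cong (on-edge refl u≋A))
        (χ-cong (≋-trans (+-congˡ A u≋A) (≋-reflexive (double A)))) (χ-zero (≋⇒0 {A} {u} (≋-sym u≋A)))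
        (δ-zero (λ e → hu (0⇒≋ {u} e))) (δ-one (≋⇒0 {u} {A} u≋A))
        (δ-zero (λ c → *-≢0 2≢0 hA (by₂ c u≋A (+ 1) (- + 1) (lemma u A)))) (δ-zero he))
      (trans (cong (λ z → (+ 1 + χ Δ) * ((+ 1 + χ (+ 2 * A)) * (+ 1 + + 0)) - D (+ 0) * + 0 - (+ 1 - z) * M * + 1
          - (+ 1 - z) * M * + 0 - + 0 * ((+ 1 + χ (+ 2 * A)) * (+ 1 + + 0))) (δ-zero hA))
        (lemma′ (+ 1 + χ Δ) (+ 1 + χ (+ 2 * A)) (D (+ 0))))
      where
      M : ℤ
      M = (+ 1 + χ Δ) * (+ 1 + χ (+ 2 * A))
      hA : ¬ A ≋ + 0
      hA A0 = hu (≋-trans u≋A A0)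
      double : ∀ A → A + A ≡ + 2 * A
      double = solve-∀
      lemma : ∀ u A → + 2 * A - + 0 ≡ + 1 * (u - - A - + 0) + - + 1 * (u - A)
      lemma = solve-∀
      lemma′ : ∀ x y d → x * (y * (+ 1 + + 0)) - d * + 0 - (+ 1 - + 0) * (x * y) * + 1 - (+ 1 - + 0) * (x * y) * + 0
        - + 0 * (y * (+ 1 + + 0)) ≡ + 0
      lemma′ = solve-∀

    interior-mod8 : ∀ u → interior u Mod8.≋ + 0
    interior-mod8 u = split (zero? u) (zero? (u * u - + 4 * B)) (zero? (u - A)) (zero? (u - - A))
      where
      X Y Y′ : ℤ
      X = χ (u * u - + 4 * B)
      Y = χ (A + u)
      Y′ = χ (A - u)
      negsq : ∀ A → - A * - A ≡ A * A
      negsq = solve-∀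
      a0 : ¬ u ≋ + 0 → δ (u - + 0) ≡ + 0
      a0 hu = δ-zero (λ e → hu (0⇒≋ {u} e))
      split : Dec (u ≋ + 0) → Dec (u * u - + 4 * B ≋ + 0) → Dec (u - A ≋ + 0) → Dec (u - - A ≋ + 0) → interior u Mod8.≋ + 0
      split (yes u0) _ _ _ = Mod8.≋-reflexive (interior-zero u0)
      -- The exceptional points do not collide: at `A` and `- A` the value of `u² - 4 B` is `Δ`, a
      -- unit.
      split (no hu) (yes e) _ _ = Mod8.≋-reflexive (trans (Φ-cong {Y = Y} {Y′} (χ-zero e) refl refl (a0 hu)
          (δ-zero (λ b → hΔ (≋-trans (≋-sym (on-edge refl (0⇒≋ {u} {A} b))) e)))
          (δ-zero (λ b → hΔ (≋-trans (≋-sym (on-edge (negsq A) (0⇒≋ {u} { - A} b))) e))) (δ-one e))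
        (lemma ((+ 1 + Y) * (+ 1 + Y′)) (D (+ 0)) edge))
        where
        lemma : ∀ y d m → (+ 1 + + 0) * y - d * + 0 - m * + 0 - m * + 0 - + 1 * y ≡ + 0
        lemma = solve-∀
      split (no hu) (no he) (yes b) _ = Mod8.≋-reflexive (interior-edge hu he (0⇒≋ {u} {A} b))
      split (no hu) (no he) (no hb) (yes c) = Mod8.≋-reflexive (trans (sym (interior-even u)) (interior-edge (neg-≢0 hu)
          (λ e → he (subst (λ z → z - + 4 * B ≋ + 0) (square u) e)) (by c (- + 1) (lemma u A))))
        where
        square : ∀ u → - u * - u ≡ u * u
        square = solve-∀
        lemma : ∀ u A → - u - A ≡ - + 1 * (u - - A - + 0)
        lemma = solve-∀
      split (no hu) (no he) (no hb) (no hc′) = Mod8.≋-trans (Mod8.≋-reflexive (trans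
          (Φ-cong {X} {Y} {Y′} refl refl refl (a0 hu) (δ-zero hb) (δ-zero hc′) (δ-zero he))
          (lemma ((+ 1 + X) * ((+ 1 + Y) * (+ 1 + Y′))) (D (+ 0)) edge ((+ 1 + Y) * (+ 1 + Y′)))))
        (signs-mod8 (χ-sign he) (χ-sign (λ e → hc′ (by e (+ 1) (lemma₁ A u)))) (χ-sign (λ e → hb (by e (- + 1) (lemma₂ A u)))))
        where
        lemma : ∀ x d m y → x - d * + 0 - m * + 0 - m * + 0 - + 0 * y ≡ x
        lemma = solve-∀
        lemma₁ : ∀ A u → u - - A - + 0 ≡ + 1 * (A + u - + 0)
        lemma₁ = solve-∀
        lemma₂ : ∀ A u → u - A - + 0 ≡ - + 1 * (A - u - + 0)
        lemma₂ = solve-∀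

  module HalfSum = HalfRange ℤₚ.+-0-commutativeMonoid

  private
    double-mod16 : ∀ {x} → x Mod8.≋ + 0 → x + x Mod16.≋ + 0
    double-mod16 {x} (Mod8.mod (divides q e)) = Mod16.mod (divides q (trans (lemma₁ x) (trans (cong (+ 2 *_) e) (lemma₂ q))))
      where
      lemma₁ : ∀ x → x + x - + 0 ≡ + 2 * (x - + 0)
      lemma₁ = solve-∀
      lemma₂ : ∀ q → + 2 * (q * + 8) ≡ q * + 16
      lemma₂ = solve-∀

    -- The value at 0 is 0, and the equal values at `h j` and `- h j` are multiples of 8, so each
    -- pair contributes a multiple of 16.
    ∑-interior : ∑ₚ interior Mod16.≋ + 0
    ∑-interior = Mod16.≋-trans (Mod16.≋-reflexive (HalfSum.fold-halves interior interior-cong))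
      (Mod16.+-cong {y = + 0} {v = + 0} (Mod16.≋-reflexive (interior-zero {+ 0} ≋-refl))
        (sum-mod16 {n} (λ j → interior (h j) + interior (- h j)) (λ j → Mod16.≋-trans
          (Mod16.≋-reflexive (cong (λ z → interior (h j) + z) (interior-even (h j)))) (double-mod16 (interior-mod8 (h j))))))
      where
      open CongruentSums (+ 16) using () renaming (sum-≋0 to sum-mod16)

  ∑-D-mod16 : ∑ₚ D Mod16.≋ D (+ 0) + + 2 * edge + E
  ∑-D-mod16 = Mod16.by ∑-interior (+ 1) (trans (lemma′ (∑ₚ D) (D (+ 0)) edge E) (cong (λ z → + 1 * (z - + 0)) (sym expanded)))
    where
    expanded : ∑ₚ interior ≡ ∑ₚ D - D (+ 0) - + 2 * edge - E
    expanded = trans (∑-combination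
        ((+ 1 , D) ∷ (- D (+ 0) , (λ u → δ (u - + 0))) ∷ (- edge , (λ u → δ (u - A))) ∷ (- edge , (λ u → δ (u - - A))) ∷
         (- + 1 , (λ u → δ (u * u - + 4 * B) * ((+ 1 + χ (A + u)) * (+ 1 + χ (A - u))))) ∷ [])
        (λ u → lemma (D u) (D (+ 0)) edge (δ (u - + 0)) (δ (u - A)) (δ (u - - A)) (δ (u * u - + 4 * B) * ((+ 1 + χ (A + u)) * (+ 1 + χ (A - u))))))
      (trans (sums (∑-δ₁ (+ 0)) (∑-δ₁ A) (∑-δ₁ (- A))) (finish (∑ₚ D) (D (+ 0)) edge E))
      where
      lemma : ∀ x d m a b c e → x - d * a - m * b - m * c - e ≡ + 1 * x + (- d * a + (- m * b + (- m * c + (- + 1 * e + + 0))))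
      lemma = solve-∀
      sums : ∀ {a b c a′ b′ c′} → a ≡ a′ → b ≡ b′ → c ≡ c′ →
        + 1 * ∑ₚ D + (- D (+ 0) * a + (- edge * b + (- edge * c + (- + 1 * E + + 0)))) ≡
        + 1 * ∑ₚ D + (- D (+ 0) * a′ + (- edge * b′ + (- edge * c′ + (- + 1 * E + + 0))))
      sums refl refl refl = refl
      finish : ∀ x d m e → + 1 * x + (- d * + 1 + (- m * + 1 + (- m * + 1 + (- + 1 * e + + 0)))) ≡ x - d - + 2 * m - e
      finish = solve-∀
    lemma′ : ∀ x d m e → x - (d + + 2 * m + e) ≡ + 1 * (x - d - + 2 * m - e - + 0)
    lemma′ = solve-∀

  private
    sign-inverse : ∀ {x y} → IsSign x → IsSign y → x * y ≡ + 1 → x ≡ y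
    sign-inverse pos pos _ = refl
    sign-inverse neg neg _ = refl

    sign-opposite : ∀ {x y} → IsSign x → IsSign y → x * y ≡ - + 1 → x + y ≡ + 0
    sign-opposite pos neg _ = refl
    sign-opposite neg pos _ = refl

    ρ-nonresidue : (∀ y → ¬ y * y ≋ Δ) → ρ ≡ + 0
    ρ-nonresidue nonsquare = trans (∑-cong (λ v → trans (cong (_* χ v) (trans (δ-q v)
      (δ-zero (λ e → nonsquare (+ 2 * c * v + A) (0⇒≋ {_} {Δ} e))))) (ℤₚ.*-zeroˡ (χ v)))) ∑-zero

    ρ-residue : ∀ d → d * d ≋ Δ → ρ ≡ χ (- c) * (χ (+ 2 * (A - d)) + χ (+ 2 * (A + d)))
    ρ-residue d d² = begin
      ρ
        ≡⟨ ∑-cong (λ v → trans (cong (_* χ v) (trans (δ-q v) (trans (δ-cong (+-congˡ ((+ 2 * c * v + A) * (+ 2 * c * v + A)) (neg-cong (≋-sym d²))))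
             (trans (δ-squares (+ 2 * c * v + A) d hd) (cong₂ (λ s t → δ s + δ t) (lemma₁ c v A d) (lemma₂ c v A d))))))
             (ℤₚ.*-distribʳ-+ (χ v) (δ (A - d + + 2 * c * v)) (δ (A + d + + 2 * c * v)))) ⟩
      ∑ₚ (λ v → δ (A - d + + 2 * c * v) * χ v + δ (A + d + + 2 * c * v) * χ v)
        ≡⟨ ∑-+ (λ v → δ (A - d + + 2 * c * v) * χ v) (λ v → δ (A + d + + 2 * c * v) * χ v) ⟩
      ∑ₚ (λ v → δ (A - d + + 2 * c * v) * χ v) + ∑ₚ (λ v → δ (A + d + + 2 * c * v) * χ v)
        ≡⟨ cong₂ _+_ (root (A - d)) (root (A + d)) ⟩
      χ (- c) * χ (+ 2 * (A - d)) + χ (- c) * χ (+ 2 * (A + d))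
        ≡⟨ ℤₚ.*-distribˡ-+ (χ (- c)) (χ (+ 2 * (A - d))) (χ (+ 2 * (A + d))) ⟨
      χ (- c) * (χ (+ 2 * (A - d)) + χ (+ 2 * (A + d))) ∎
      where
      open ≡-Reasoning
      hd : ¬ d ≋ + 0
      hd = square-≢0 hΔ d²
      lemma₁ : ∀ c v A d → + 2 * c * v + A - d ≡ A - d + + 2 * c * v
      lemma₁ = solve-∀
      lemma₂ : ∀ c v A d → + 2 * c * v + A - - d ≡ A + d + + 2 * c * v
      lemma₂ = solve-∀
      root : ∀ a → ∑ₚ (λ v → δ (a + + 2 * c * v) * χ v) ≡ χ (- c) * χ (+ 2 * a)
      root a = trans (∑-δ-linear a (+ 2 * c) χ h2c χ-cong) (trans (χ-root a (+ 2 * c) h2c)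
        (trans (cong χ (lemma a c)) (χ-* (- c) (+ 2 * a))))
        where
        lemma : ∀ a c → - a * (+ 2 * c) ≡ - c * (+ 2 * a)
        lemma = solve-∀

    E-nonresidue : (∀ y → ¬ y * y ≋ B) → E ≡ + 0
    E-nonresidue nonsquare = trans (∑-cong (λ u → trans (cong (_* ((+ 1 + χ (A + u)) * (+ 1 + χ (A - u))))
        (δ-zero (λ e → nonsquare (u * inv (+ 2)) (halve u (0⇒≋ {u * u} {+ 4 * B} e)))))
        (ℤₚ.*-zeroˡ ((+ 1 + χ (A + u)) * (+ 1 + χ (A - u)))))) ∑-zero
      where
      lemma : ∀ u i B → u * i * (u * i) - B ≡ i * i * (u * u - + 4 * B) + B * (+ 2 * i + + 1) * (+ 2 * i - + 1)
      lemma = solve-∀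
      halve : ∀ u → u * u ≋ + 4 * B → u * inv (+ 2) * (u * inv (+ 2)) ≋ B
      halve u e = by₂ e (inv-* 2≢0) (inv (+ 2) * inv (+ 2)) (B * (+ 2 * inv (+ 2) + + 1)) (lemma u (inv (+ 2)) B)

    E-residue : ∀ s → s * s ≋ B → E ≡ + 2 * ((+ 1 + χ (A + + 2 * s)) * (+ 1 + χ (A - + 2 * s)))
    E-residue s s² = begin
      E
        ≡⟨ ∑-cong (λ u → trans (cong (_* F u) (trans (δ-cong (+-congˡ (u * u) (neg-cong (by {+ 4 * B} {+ 2 * s * (+ 2 * s)} s² (- + 4) (square s B)))))
             (δ-squares u (+ 2 * s) (*-≢0 2≢0 (square-≢0 hB s²))))) (ℤₚ.*-distribʳ-+ (F u) (δ (u - + 2 * s)) (δ (u - - (+ 2 * s))))) ⟩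
      ∑ₚ (λ u → δ (u - + 2 * s) * F u + δ (u - - (+ 2 * s)) * F u)
        ≡⟨ ∑-+ (λ u → δ (u - + 2 * s) * F u) (λ u → δ (u - - (+ 2 * s)) * F u) ⟩
      ∑ₚ (λ u → δ (u - + 2 * s) * F u) + ∑ₚ (λ u → δ (u - - (+ 2 * s)) * F u)
        ≡⟨ cong₂ _+_ (∑-δ (+ 2 * s) F F-cong) (∑-δ (- (+ 2 * s)) F F-cong) ⟩
      F (+ 2 * s) + F (- (+ 2 * s))
        ≡⟨ cong (λ z → F (+ 2 * s) + (+ 1 + χ (A - + 2 * s)) * (+ 1 + χ (A + z))) (ℤₚ.neg-involutive (+ 2 * s)) ⟩
      F (+ 2 * s) + (+ 1 + χ (A - + 2 * s)) * (+ 1 + χ (A + + 2 * s))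
        ≡⟨ lemma (+ 1 + χ (A + + 2 * s)) (+ 1 + χ (A - + 2 * s)) ⟩
      + 2 * F (+ 2 * s) ∎
      where
      open ≡-Reasoning
      F : ℤ → ℤ
      F u = (+ 1 + χ (A + u)) * (+ 1 + χ (A - u))
      F-cong : Periodic₁ F
      F-cong e = cong₂ (λ s t → (+ 1 + s) * (+ 1 + t)) (χ-cong (+-congˡ A e)) (χ-cong (+-congˡ A (neg-cong e)))
      square : ∀ s B → + 4 * B - + 2 * s * (+ 2 * s) ≡ - + 4 * (s * s - B)
      square = solve-∀
      lemma : ∀ x y → x * y + y * x ≡ + 2 * (x * y)
      lemma = solve-∀

    split-Δ : ∀ s → s * s ≋ B → (A + + 2 * s) * (A - + 2 * s) ≋ Δ
    split-Δ s s² = ≋-trans (by s² (- + 4) (lemma A s B)) (≋-reflexive disc≡)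
      where
      lemma : ∀ A s B → (A + + 2 * s) * (A - + 2 * s) - (A * A - + 4 * B) ≡ - + 4 * (s * s - B)
      lemma = solve-∀

    factor-≢0 : ∀ {x y z} → ¬ z ≋ + 0 → x * y ≋ z → ¬ x ≋ + 0 × ¬ y ≋ + 0
    factor-≢0 {x} {y} hz e = (λ x0 → hz (≋-trans (≋-sym e) (*-zeroˡ y x0))) , (λ y0 → hz (≋-trans (≋-sym e) (*-zeroʳ x y0)))

    roots-product : ∀ d → d * d ≋ Δ → + 2 * (A - d) * (+ 2 * (A + d)) ≋ + 4 * (+ 4 * B)
    roots-product d d² = by d² (- + 4) (trans (cong (λ z → + 2 * (A - d) * (+ 2 * (A + d)) - z) (cong (+ 4 *_) four-B)) (lemma A d Δ))
      where
      four-B : + 4 * B ≡ A * A - Δ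
      four-B = trans (lemma₀ (+ 4 * B) (A * A)) (cong (λ z → A * A - z) disc≡)
        where
        lemma₀ : ∀ b a → b ≡ a - (a - b)
        lemma₀ = solve-∀
      lemma : ∀ A d D → + 2 * (A - d) * (+ 2 * (A + d)) - + 4 * (A * A - D) ≡ - + 4 * (d * d - D)
      lemma = solve-∀

  -- If `Δ` is a nonresidue then `q` has no zeros, and for a root `s` of `B` the product
  -- `(A + 2 s) (A - 2 s) = Δ` makes the two characters opposite, so `E` vanishes. If `B` is a
  -- nonresidue, `E` is empty and the two zeros of `q` cancel in `ρ`. If both are squares, all four
  -- characters equal one sign `t`, and `2 (1 + t)² + 4 t χ (- c)` changes by `8 (1 + χ (- c))`, a
  -- multiple of 16, when `t` changes sign.
  E+2ρ : E + + 2 * ρ Mod16.≋ (+ 1 + χ Δ) * (+ 1 + χ B) * (+ 2 + χ (- c))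
  E+2ρ = cases (character Δ) (character B)
    where
    Goal : Set
    Goal = E + + 2 * ρ Mod16.≋ (+ 1 + χ Δ) * (+ 1 + χ B) * (+ 2 + χ (- c))
    fill : ∀ {e r D′ B′} → E ≡ e → ρ ≡ r → χ Δ ≡ D′ → χ B ≡ B′ →
      e + + 2 * r Mod16.≋ (+ 1 + D′) * (+ 1 + B′) * (+ 2 + χ (- c)) → Goal
    fill refl refl refl refl z = z
    zeroˡ : ∀ x y → + 0 ≡ (+ 1 + - + 1) * (+ 1 + x) * y
    zeroˡ = solve-∀
    zeroʳ : ∀ x y → + 0 ≡ (+ 1 + x) * (+ 1 + - + 1) * y
    zeroʳ = solve-∀
    module _ (s : ℤ) (s² : s * s ≋ B) where
      hs : ¬ A + + 2 * s ≋ + 0 × ¬ A - + 2 * s ≋ + 0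
      hs = factor-≢0 hΔ (split-Δ s s²)
      t t₂ : ℤ
      t = χ (A + + 2 * s)
      t₂ = χ (A - + 2 * s)
      tt₂ : t * t₂ ≡ χ Δ
      tt₂ = trans (sym (χ-* (A + + 2 * s) (A - + 2 * s))) (χ-cong (split-Δ s s²))
    cases : Character Δ → Character B → Goal
    cases (zero e _) _ = ⊥-elim (hΔ e)
    cases _ (zero e _) = ⊥-elim (hB e)
    cases (nonresidue _ nΔ eΔ) (nonresidue _ nB eB) = fill (E-nonresidue nB) (ρ-nonresidue nΔ) eΔ eB
      (Mod16.≋-reflexive (zeroˡ (- + 1) (+ 2 + χ (- c))))
    cases (nonresidue _ nΔ eΔ) (residue _ s s² eB) = fill
      (trans (E-residue s s²) (opposite-vanish (χ-sign (proj₁ (hs s s²))) (χ-sign (proj₂ (hs s s²))) (trans (tt₂ s s²) eΔ)))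
      (ρ-nonresidue nΔ) eΔ eB (Mod16.≋-reflexive (zeroˡ (+ 1) (+ 2 + χ (- c))))
      where
      opposite-vanish : ∀ {x y} → IsSign x → IsSign y → x * y ≡ - + 1 → + 2 * ((+ 1 + x) * (+ 1 + y)) ≡ + 0
      opposite-vanish pos neg _ = refl
      opposite-vanish neg pos _ = refl
    cases (residue _ d d² eΔ) (nonresidue _ nB eB) = fill (E-nonresidue nB)
      (trans (ρ-residue d d²) (trans (cong (χ (- c) *_) (sign-opposite (χ-sign (proj₁ hd)) (χ-sign (proj₂ hd))
        (trans (sym (χ-* (+ 2 * (A - d)) (+ 2 * (A + d)))) (trans (χ-cong (roots-product d d²)) (trans (χ-4 (+ 4 * B)) (trans (χ-4 B) eB))))))
        (ℤₚ.*-zeroʳ (χ (- c)))))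
      eΔ eB (Mod16.≋-reflexive (zeroʳ (+ 1) (+ 2 + χ (- c))))
      where
      hd : ¬ + 2 * (A - d) ≋ + 0 × ¬ + 2 * (A + d) ≋ + 0
      hd = factor-≢0 (*-≢0 4≢0 (*-≢0 4≢0 hB)) (roots-product d d²)
    cases (residue _ d d² eΔ) (residue _ s s² eB) = fill
      (trans (E-residue s s²) (cong (λ z → + 2 * ((+ 1 + t s s²) * (+ 1 + z))) (sym t≡t₂)))
      (trans (ρ-residue d d²) (cong (χ (- c) *_) (cong₂ _+_ r≡t (trans (sym r≡r₂) r≡t))))
      eΔ eB (signs ht (χ-sign (neg-≢0 hc)))
      where
      hd : ¬ + 2 * (A - d) ≋ + 0 × ¬ + 2 * (A + d) ≋ + 0
      hd = factor-≢0 (*-≢0 4≢0 (*-≢0 4≢0 hB)) (roots-product d d²)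
      ht : IsSign (t s s²)
      ht = χ-sign (proj₁ (hs s s²))
      t≡t₂ : t s s² ≡ t₂ s s²
      t≡t₂ = sign-inverse ht (χ-sign (proj₂ (hs s s²))) (trans (tt₂ s s²) eΔ)
      r≡r₂ : χ (+ 2 * (A - d)) ≡ χ (+ 2 * (A + d))
      r≡r₂ = sign-inverse (χ-sign (proj₁ hd)) (χ-sign (proj₂ hd))
        (trans (sym (χ-* (+ 2 * (A - d)) (+ 2 * (A + d)))) (trans (χ-cong (roots-product d d²)) (trans (χ-4 (+ 4 * B)) (trans (χ-4 B) eB))))
      lemma : ∀ A d s x B → (A - d + + 2 * s) * (A - d + + 2 * s) - + 2 * (A - d) * (A + + 2 * s) ≡
        + 1 * (d * d - x) + + 4 * (s * s - B) + (x - (A * A - + 4 * B))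
      lemma = solve-∀
      -- From A² = d² + (2 s)².
      pythagoras : (A - d + + 2 * s) * (A - d + + 2 * s) ≋ + 2 * (A - d) * (A + + 2 * s)
      pythagoras = by₂ d² s² (+ 1) (+ 4) (trans (lemma A d s Δ B)
        (trans (cong (λ z → + 1 * (d * d - Δ) + + 4 * (s * s - B) + z) (trans (cong (λ z → Δ - z) disc≡) (ℤₚ.+-inverseʳ Δ)))
          (ℤₚ.+-identityʳ (+ 1 * (d * d - Δ) + + 4 * (s * s - B)))))
      r≡t : χ (+ 2 * (A - d)) ≡ t s s²
      r≡t = sign-inverse (χ-sign (proj₁ hd)) ht (trans (sym (χ-* (+ 2 * (A - d)) (A + + 2 * s)))
        (χ-square (A - d + + 2 * s) (square-≢0 (*-≢0 (proj₁ hd) (proj₁ (hs s s²))) pythagoras) pythagoras))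
      signs : ∀ {t x} → IsSign t → IsSign x → + 2 * ((+ 1 + t) * (+ 1 + t)) + + 2 * (x * (t + t)) Mod16.≋ (+ 1 + + 1) * (+ 1 + + 1) * (+ 2 + x)
      signs pos pos = Mod16.≋-refl
      signs pos neg = Mod16.≋-refl
      signs neg pos = Mod16.mod (divides (- + 1) refl)
      signs neg neg = Mod16.≋-refl

  -- The symmetrized sum controls `2 τ + 2 ρ` modulo 16 and not `τ + ρ` itself; this forces the
  -- doubling of `W`.
  W-term : ∀ k → + 4 * B * k ≋ - Δ →
    + 4 - + 2 * W (λ v → χ₁ (q v)) Mod16.≋ ⟦ quadraticTerm c A σ Δ ⟧ + ⟦ signTerm c σ ⟧ * ∑ₚ (λ y → χ (cubic k y))
  W-term k hk = Mod16.≋-trans (Mod16.≋-reflexive (cong (λ w → + 4 - + 2 * w) W-quadratic))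
    (Mod16.by bracket (- κ n) (collect (+ p) (χ c) (χ Δ) (κ n) τ ρ (+ 1 - χ₁ (q (+ 0))) (wt (- + 1) * (+ 1 - χ₁ (q (- + 1))))
      (D (+ 0)) edge exceptional (χ (- + 1)) (+ p * δ A - + 1) (χ (- B)) S₀))
    where
    S₀ exceptional : ℤ
    S₀ = ∑ₚ (λ y → χ (cubic k y))
    exceptional = (+ 1 + χ Δ) * (+ 1 + χ B) * (+ 2 + χ (- c))
    combine : ∀ P T R D d e f m a s S →
      + 2 * T + + 2 * R - (D + + 2 * d + f - (P - + 1) - m * a + m - s * S) ≡
      + 1 * ((P - + 1 + + 2 * T + m * a - m + s * S) - (D + + 2 * d + e)) + + 1 * (e + + 2 * R - f)
    combine = solve-∀
    bracket : + 2 * τ + + 2 * ρ Mod16.≋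
      D (+ 0) + + 2 * edge + exceptional - (+ p - + 1) - χ (- + 1) * (+ p * δ A - + 1) + χ (- + 1) - χ (- B) * S₀
    bracket = Mod16.by₂ (Mod16.≋-trans (Mod16.≋-reflexive (sym (∑-D k hk))) ∑-D-mod16) E+2ρ (+ 1) (+ 1)
      (combine (+ p) τ ρ (D (+ 0)) edge E exceptional (χ (- + 1)) (+ p * δ A - + 1) (χ (- B)) S₀)
    collect : ∀ P x d k T R q₀ q₁ D e f m a s S →
      + 4 - + 2 * (P - + 1 + x - d + k * (T + R) - q₀ - q₁) -
      (+ 4 - + 2 * (P - + 1 + x - d) - k * (D + + 2 * e + f - (P - + 1) - m * a + m) + + 2 * q₀ + + 2 * q₁ + k * s * S) ≡
      - k * (+ 2 * T + + 2 * R - (D + + 2 * e + f - (P - + 1) - m * a + m - s * S))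
    collect = solve-∀

-- From the lists in the definitions to sums over residues

findᵇ-just : ∀ {A : Set} (f : A → Bool) xs {x} → findᵇ f xs ≡ just x → f x ≡ true
findᵇ-just f (y ∷ xs) e with f y in eq
findᵇ-just f (y ∷ xs) refl | true  = eq
findᵇ-just f (y ∷ xs) e    | false = findᵇ-just f xs e

findᵇ-nothing : ∀ {A : Set} (f : A → Bool) xs → findᵇ f xs ≡ nothing → ∀ {x} → x ∈ xs → f x ≡ false
findᵇ-nothing f (y ∷ xs) e m with f y in eq
findᵇ-nothing f (y ∷ xs) e (here refl) | false = eq
findᵇ-nothing f (y ∷ xs) e (there m)   | false = findᵇ-nothing f xs e m

sumℤ-upTo : ∀ (f : ℕ → ℤ) m → sumℤ (map f (map suc (upTo m))) ≡ sum {m} (λ i → f (suc (toℕ i)))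
sumℤ-upTo f m = trans (cong (sumℤ) (sym (Listₚ.map-∘ (upTo m)))) (trans (cong sumℤ (Listₚ.map-upTo (f ∘ suc) m)) (applied (f ∘ suc) m))
  where
  applied : ∀ (g : ℕ → ℤ) m → sumℤ (applyUpTo g m) ≡ sum {m} (g ∘ toℕ)
  applied g zero    = refl
  applied g (suc m) = cong (λ z → g 0 + z) (applied (g ∘ suc) m)

module Residues16 = Residues 16

module Assembly (n : ℕ) (1<n : 1 ℕ.< n) (prime : Prime (suc (n ℕ.+ n))) where

  open LinearFactors n 1<n prime public

  module _ (a b c : ℤ) where

    congruence : ℕ → ℤ
    congruence k = + 4 * c * sigma a b c * + k + disc a b c

    kOf-spec : ¬ c ≋ + 0 → ¬ sigma a b c ≋ + 0 → congruence (kOf a b c p) ≋ + 0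
    kOf-spec hc hσ with findᵇ (λ k → divᵇ p (congruence k)) (map suc (upTo p)) in eq
    ... | just k = found (zero? (congruence k)) (findᵇ-just (λ k → divᵇ p (congruence k)) (map suc (upTo p)) eq)
      where
      found : Dec (congruence k ≋ + 0) → divᵇ p (congruence k) ≡ true → congruence k ≋ + 0
      found (yes e) _ = e
      found (no ¬e) t = ⊥-elim (true≢false (trans (sym t) (divᵇ-false ¬e)))
    ... | nothing = ⊥-elim (true≢false (trans (sym (divᵇ-true solution))
        (findᵇ-nothing (λ k → divᵇ p (congruence k)) (map suc (upTo p)) eq (∈-map⁺ suc (∈-upTo⁺ (n%ℕd<d (x - + 1) p))))))
      where
      e x : ℤ
      e = + 4 * c * sigma a b c
      x = - disc a b c * inv e
      he : ¬ e ≋ + 0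
      he = *-≢0 (*-≢0 4≢0 hc) hσ
      lemma₁ : ∀ e d i → e * (- d * i) + d - + 0 ≡ - d * (e * i - + 1)
      lemma₁ = solve-∀
      lemma₂ : ∀ x → + 1 + (x - + 1) ≡ x
      lemma₂ = solve-∀
      -- The search runs over 1, ..., `p`, so the solution `x` is represented by
      -- `1 + ((x - 1) mod p)`, which gives `p` rather than 0 when `p` divides `x`.
      solution : congruence (suc ((x - + 1) %ℕ p)) ≋ + 0
      solution = ≋-trans (+-congʳ (disc a b c) (*-congˡ e (≋-trans (+-congˡ (+ 1) (%-≋ (x - + 1))) (≋-reflexive (lemma₂ x)))))
        (by (inv-* he) (- disc a b c) (lemma₁ e (disc a b c) (inv e)))

    cubicSum : ℤ
    cubicSum = ∑ₚ (λ y → χ (y * (y + + 1) * (y + + kOf a b c p)))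

    -- The sum in `S` starts at `y = 1`; the missing term `y = 0` is a zero of the cubic.
    S-cubicSum : + S a b c p Mod16.≋ cubicSum
    S-cubicSum = Mod16.≋-trans (Residues16.%-≋ _) (Mod16.≋-reflexive (trans
      (sumℤ-upTo (λ y → legendre (+ y * (+ y + + 1) * (+ y + + kOf a b c p)) p) (n ℕ.+ n))
      (trans (sum-cong-≗ {n ℕ.+ n} (λ i → sym (χ-legendre (+ suc (toℕ i) * (+ suc (toℕ i) + + 1) * (+ suc (toℕ i) + + kOf a b c p)))))
        (sym (trans (cong (_+ rest) (χ-zero (≋-reflexive (lemma (+ kOf a b c p))))) (ℤₚ.+-identityˡ rest))))))
      where
      rest : ℤ
      rest = sum {n ℕ.+ n} (λ i → χ (+ suc (toℕ i) * (+ suc (toℕ i) + + 1) * (+ suc (toℕ i) + + kOf a b c p)))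
      lemma : ∀ k → + 0 * (+ 0 + + 1) * (+ 0 + k) ≡ + 0
      lemma = solve-∀

    P-mod16 : ∀ {w} → W (θ a b c) Mod8.≋ w → + 4 * P a b c p Mod16.≋ + 4 - + 2 * w
    P-mod16 {w} e = double (Mod8.≋-trans (P-mod8 a b c) (Mod8.+-congˡ (+ 2) (Mod8.neg-cong e)))
      where
      double : ∀ {x} → + 2 * x Mod8.≋ + 2 - w → + 4 * x Mod16.≋ + 4 - + 2 * w
      double {x} (Mod8.mod (divides q e)) = Mod16.mod (divides q (trans (lemma₁ x w) (trans (cong (+ 2 *_) e) (lemma₂ q))))
        where
        lemma₁ : ∀ x w → + 4 * x - (+ 4 - + 2 * w) ≡ + 2 * (+ 2 * x - (+ 2 - w))
        lemma₁ = solve-∀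
        lemma₂ : ∀ q → + 2 * (q * + 8) ≡ q * + 16
        lemma₂ = solve-∀

    -- f (1 , 1 + v) = c v² + A v + σ.
    A : ℤ
    A = b + + 2 * c

    P-quadratic : ¬ c ≋ + 0 → ¬ sigma a b c ≋ + 0 → ¬ disc a b c ≋ + 0 →
      + 4 * P a b c p Mod16.≋ ⟦ quadraticTerm c A (sigma a b c) (disc a b c) ⟧ + ⟦ signTerm c (sigma a b c) ⟧ * + S a b c p
    P-quadratic hc hσ hΔ = Mod16.≋-trans
      (P-mod16 (Mod8.≋-reflexive (W-cong (λ v → cong χ₁ (expand a b c v)))))
      (Mod16.≋-trans
        (QuadraticSums.W-term n 1<n prime c A (sigma a b c) (disc a b c) hc hσ hΔ (complete-square a b c) (+ kOf a b c p)
          (by (kOf-spec hc hσ) (+ 1) (rearrange c (sigma a b c) (+ kOf a b c p) (disc a b c))))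
        (Mod16.+-congˡ ⟦ quadraticTerm c A (sigma a b c) (disc a b c) ⟧
          (Mod16.*-congˡ ⟦ signTerm c (sigma a b c) ⟧ (Mod16.≋-sym S-cubicSum))))
      where
      expand : ∀ a b c v → a * + 1 * + 1 + b * + 1 * (+ 1 + v) + c * (+ 1 + v) * (+ 1 + v) ≡ c * v * v + (b + + 2 * c) * v + (a + b + c)
      expand = solve-∀
      complete-square : ∀ a b c → (b + + 2 * c) * (b + + 2 * c) - + 4 * (c * (a + b + c)) ≡ b * b - + 4 * a * c
      complete-square = solve-∀
      rearrange : ∀ c σ k d → + 4 * (c * σ) * k - - d ≡ + 1 * (+ 4 * c * σ * k + d - + 0)
      rearrange = solve-∀

    -- If p divides the discriminant then p divides k, and the cubic becomes y² (y + 1).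
    S-degenerate : ¬ c ≋ + 0 → ¬ sigma a b c ≋ + 0 → disc a b c ≋ + 0 → + S a b c p Mod16.≋ - + 1
    S-degenerate hc hσ Δ0 = Mod16.≋-trans S-cubicSum (Mod16.≋-reflexive (trans
        (∑-combination ((+ 1 , (λ y → χ (+ 1 * y + + 1))) ∷ (- + 1 , (λ y → δ (y - + 0))) ∷ []) (λ y → point y (zero? y)))
        (trans (cong₂ (λ s t → + 1 * s + (- + 1 * t + + 0)) (∑-χ-affine (+ 1) (+ 1) 1≢0) (∑-δ₁ (+ 0))) refl)))
      where
      k : ℤ
      k = + kOf a b c p
      lemma : ∀ e k d → e * k - + 0 ≡ + 1 * (e * k + d - + 0) + - + 1 * (d - + 0)
      lemma = solve-∀
      k0 : k ≋ + 0
      k0 = [ (λ e → ⊥-elim (*-≢0 (*-≢0 4≢0 hc) hσ e)) , (λ e → e) ]′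
        (euclid (+ 4 * c * sigma a b c) k (by₂ (kOf-spec hc hσ) Δ0 (+ 1) (- + 1) (lemma (+ 4 * c * sigma a b c) k (disc a b c))))
      cubic≋ : ∀ y k → y * (y + + 1) * (y + k) - y * y * (+ 1 * y + + 1) ≡ y * (y + + 1) * (k - + 0)
      cubic≋ = solve-∀
      point : ∀ y → Dec (y ≋ + 0) → χ (y * (y + + 1) * (y + k)) ≡ + 1 * χ (+ 1 * y + + 1) + (- + 1 * δ (y - + 0) + + 0)
      point y (yes y0) = trans (χ-zero (*-zeroˡ (y + k) (*-zeroˡ (y + + 1) y0)))
        (sym (cong₂ (λ s t → + 1 * s + (- + 1 * t + + 0)) (χ-square (+ 1) 1≢0 (≋-sym (+-congʳ (+ 1) (*-congˡ (+ 1) y0)))) (δ-one (≋⇒0 {y} y0))))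
      point y (no hy) = trans (χ-cong (by k0 (y * (y + + 1)) (cubic≋ y k))) (trans (χ-* (y * y) (+ 1 * y + + 1))
        (trans (cong (_* χ (+ 1 * y + + 1)) (χ-square y hy ≋-refl))
          (sym (trans (cong (λ z → + 1 * χ (+ 1 * y + + 1) + (- + 1 * z + + 0)) (δ-zero (λ e → hy (0⇒≋ {y} e))))
            (ℤₚ.+-identityʳ (+ 1 * χ (+ 1 * y + + 1)))))))

    -- The unit square `K²` is invisible to `χ₁`. It provides the denominators needed to split the
    -- form into integral linear factors when the discriminant is 0.
    P-factorable : ∀ K α β γ ε → ¬ K ≋ + 0 →
      (¬ α ≡ + 0 → ¬ α ≋ + 0) → (¬ β ≡ + 0 → ¬ β ≋ + 0) → (¬ γ ≡ + 0 → ¬ γ ≋ + 0) → (¬ ε ≡ + 0 → ¬ ε ≋ + 0) →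
      (∀ v → K * K * form a b c (+ 1) (+ 1 + v) ≡ (α + β * v) * (γ + ε * v)) →
      + 4 * P a b c p Mod16.≋ + 4 - + 2 * ⟦ productTerm α β γ ε ⟧
    P-factorable K α β γ ε hK hα hβ hγ hε factors = P-mod16 (Mod8.≋-trans
      (Mod8.≋-reflexive (W-cong (λ v → trans (sym (χ₁-square {K} (form a b c (+ 1) (+ 1 + v)) hK)) (cong χ₁ (factors v)))))
      (W-productTerm α β γ ε hα hβ hγ hε))

-- The two statements

-- The absolute value, with 1 in place of 0: a coefficient that is zero over the integers excludes
-- no prime and must not annihilate the modulus.
nonzeroPart : ℤ → ℕ
nonzeroPart (+ zero)  = 1
nonzeroPart (+ suc k) = suc k
nonzeroPart -[1+ k ]  = suc k

nonzeroPart-nonZero : ∀ x → NonZero (nonzeroPart x)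
nonzeroPart-nonZero (+ zero)  = _
nonzeroPart-nonZero (+ suc k) = _
nonzeroPart-nonZero -[1+ k ]  = _

nonzeroPart-∣ : ∀ {p} x → ¬ p ℕ∣.∣ nonzeroPart x → ¬ x ≡ + 0 → ¬ + p ∣ x
nonzeroPart-∣ (+ zero)  _  x≢0 _ = x≢0 refl
nonzeroPart-∣ (+ suc k) p∤ _   d = p∤ (∣⇒∣ᵤ d)
nonzeroPart-∣ -[1+ k ]  p∤ _   d = p∤ (∣⇒∣ᵤ d)

P-sign : ∀ a b c p → Prime p → 3 ℕ.< p → IsSign (P a b c p)
P-sign a b c = odd-prime (λ p → IsSign (P a b c p)) (λ n 1<n pr → let open Reduction n 1<n pr using () renaming (P-sign to sign) in sign a b c)

badPrimes : (K α β γ ε : ℤ) → ℕ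
badPrimes K α β γ ε = nonzeroPart K ℕ.* (nonzeroPart α ℕ.* (nonzeroPart β ℕ.* (nonzeroPart γ ℕ.* nonzeroPart ε)))

badPrimes-nonZero : ∀ K α β γ ε → NonZero (badPrimes K α β γ ε)
badPrimes-nonZero K α β γ ε =
  ℕₚ.m*n≢0 _ _ {{nonzeroPart-nonZero K}} {{ℕₚ.m*n≢0 _ _ {{nonzeroPart-nonZero α}} {{ℕₚ.m*n≢0 _ _ {{nonzeroPart-nonZero β}}
    {{ℕₚ.m*n≢0 _ _ {{nonzeroPart-nonZero γ}} {{nonzeroPart-nonZero ε}}}}}}}}

P-factored : ∀ a b c K α β γ ε → ¬ K ≡ + 0 →
  (∀ v → K * K * form a b c (+ 1) (+ 1 + v) ≡ (α + β * v) * (γ + ε * v)) →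
  ∀ p → Prime p → 3 ℕ.< p → ¬ p ℕ∣.∣ badPrimes K α β γ ε →
  + 4 * P a b c p Mod16.≋ + 4 - + 2 * at (productTerm α β γ ε) p
P-factored a b c K α β γ ε K≢0 factors = odd-prime
  (λ p → ¬ p ℕ∣.∣ badPrimes K α β γ ε → + 4 * P a b c p Mod16.≋ + 4 - + 2 * at (productTerm α β γ ε) p) local
  where
  local : ∀ n → 1 ℕ.< n → Prime (suc (n ℕ.+ n)) → ¬ suc (n ℕ.+ n) ℕ∣.∣ badPrimes K α β γ ε →
    + 4 * P a b c (suc (n ℕ.+ n)) Mod16.≋ + 4 - + 2 * at (productTerm α β γ ε) (suc (n ℕ.+ n))
  local n 1<n pr p∤ = subst (λ z → + 4 * P a b c p Mod16.≋ + 4 - + 2 * z) (sym (at-⟦⟧ (productTerm α β γ ε)))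
    (P-factorable a b c K α β γ ε (good K (p∤ ∘ ℕ∣.∣m⇒∣m*n _) K≢0)
      (good α (p∤ ∘ ℕ∣.∣n⇒∣m*n (nonzeroPart K) ∘ ℕ∣.∣m⇒∣m*n _))
      (good β (p∤ ∘ ℕ∣.∣n⇒∣m*n (nonzeroPart K) ∘ ℕ∣.∣n⇒∣m*n (nonzeroPart α) ∘ ℕ∣.∣m⇒∣m*n _))
      (good γ (p∤ ∘ ℕ∣.∣n⇒∣m*n (nonzeroPart K) ∘ ℕ∣.∣n⇒∣m*n (nonzeroPart α) ∘ ℕ∣.∣n⇒∣m*n (nonzeroPart β) ∘ ℕ∣.∣m⇒∣m*n _))
      (good ε (p∤ ∘ ℕ∣.∣n⇒∣m*n (nonzeroPart K) ∘ ℕ∣.∣n⇒∣m*n (nonzeroPart α) ∘ ℕ∣.∣n⇒∣m*n (nonzeroPart β) ∘ ℕ∣.∣n⇒∣m*n (nonzeroPart γ)))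
      factors)
    where
    open Assembly n 1<n pr
    good : ∀ x → ¬ p ℕ∣.∣ nonzeroPart x → ¬ x ≡ + 0 → ¬ x ≋ + 0
    good x p∤x x≢0 e = nonzeroPart-∣ x p∤x x≢0 (≋0⇒∣ e)

sign-mod16 : ∀ {s t} → IsSign s → IsSign t → + 4 * s Mod16.≋ + 4 * t → s ≡ t
sign-mod16 pos pos _ = refl
sign-mod16 neg neg _ = refl
sign-mod16 pos neg (Mod16.mod d) = ⊥-elim (ℕ∣.>⇒∤ (ℕₚ.m≤m+n 9 7) (∣⇒∣ᵤ d))
sign-mod16 neg pos (Mod16.mod d) = ⊥-elim (ℕ∣.>⇒∤ (ℕₚ.m≤m+n 9 7) (∣⇒∣ᵤ d))

remainder-≡ : ∀ {d m p r} .{{_ : NonZero d}} → d ℕ∣.∣ m → + m ℤd.∣ (+ p - + r) → p ℕ.% d ≡ r ℕ.% d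
remainder-≡ {d} {m} {p} {r} d∣m m∣p-r = Residues.%-cong d {+ p} {+ r} (Residues.mod (∣ᵤ⇒∣ (ℕ∣.∣-trans d∣m m∣p-r)))

∣-residue : ∀ {q m p r} → q ℕ∣.∣ m → + m ℤd.∣ (+ p - + r) → q ℕ∣.∣ p → q ℕ∣.∣ r
∣-residue {q} {m} {p} {r} q∣m m∣ q∣p = ∣⇒∣ᵤ {+ q} {+ r} (subst (+ q ∣_) (lemma (+ p) (+ r))
  (Signed.∣m∣n⇒∣m-n (∣ᵤ⇒∣ {+ q} {+ p} q∣p) (∣ᵤ⇒∣ {+ q} {+ p - + r} (ℕ∣.∣-trans q∣m m∣))))
  where
  lemma : ∀ p r → p - (p - r) ≡ r
  lemma = solve-∀

prime-∣-prime : ∀ {p q} → Prime p → Prime q → p ℕ∣.∣ q → p ≡ q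
prime-∣-prime pr pr′ d = [ (λ e → ⊥-elim (ℕ.nonTrivial⇒≢1 {{prime⇒nonTrivial pr}} e)) , (λ e → e) ]′ (prime⇒irreducible pr′ d)

P-periodic : ∀ a b c m n u v → (∀ i j → form a b c i j ≡ (m * i + n * j) * (u * i + v * j)) → Periodic DomP (P a b c)
P-periodic a b c m n u v factors = M ℕ.* E.modulus , ℕ.>-nonZero⁻¹ (M ℕ.* E.modulus) {{ℕₚ.m*n≢0 M E.modulus {{M≢0}} {{E.nonZero}}}} , periodic
  where
  t : Term
  t = productTerm (m + n) n (u + v) v
  module E = Explicit (explicit-term t)
  instance
    modulus≢0 : NonZero E.modulus
    modulus≢0 = E.nonZero
  M : ℕ
  M = badPrimes (+ 1) (m + n) n (u + v) v
  M≢0 : NonZero M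
  M≢0 = badPrimes-nonZero (+ 1) (m + n) n (u + v) v
  linear-factors : ∀ x → + 1 * + 1 * form a b c (+ 1) (+ 1 + x) ≡ ((m + n) + n * x) * ((u + v) + v * x)
  linear-factors x = trans (ℤₚ.*-identityˡ (form a b c (+ 1) (+ 1 + x))) (trans (factors (+ 1) (+ 1 + x)) (lemma m n u v x))
    where
    lemma : ∀ m n u v x → (m * + 1 + n * (+ 1 + x)) * (u * + 1 + v * (+ 1 + x)) ≡ ((m + n) + n * x) * ((u + v) + v * x)
    lemma = solve-∀
  periodic : ∀ p₁ p₂ → DomP p₁ → DomP p₂ → + (M ℕ.* E.modulus) ℤd.∣ (+ p₁ - + p₂) → P a b c p₁ ≡ P a b c p₂
  periodic p₁ p₂ (pr₁ , 3<p₁) (pr₂ , 3<p₂) d = by-cases (p₁ ℕ∣.∣? (M ℕ.* E.modulus)) (p₂ ℕ∣.∣? (M ℕ.* E.modulus))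
    where
    back : + (M ℕ.* E.modulus) ℤd.∣ (+ p₂ - + p₁)
    back = subst (M ℕ.* E.modulus ℕ∣.∣_) (ℤₚ.∣i-j∣≡∣j-i∣ (+ p₁) (+ p₂)) d
    value-at : ∀ p → Prime p → 3 ℕ.< p → ¬ p ℕ∣.∣ M ℕ.* E.modulus → + 4 * P a b c p Mod16.≋ + 4 - + 2 * E.value (p ℕ.% E.modulus)
    value-at p pr 3<p p∤ = Mod16.≋-trans
      (P-factored a b c (+ 1) (m + n) n (u + v) v (λ ()) linear-factors p pr 3<p (λ z → p∤ (ℕ∣.∣m⇒∣m*n E.modulus z)))
      (Mod16.+-congˡ (+ 4) (Mod16.neg-cong (Mod16.*-congˡ (+ 2) (E.agrees p pr 3<p (λ z → p∤ (ℕ∣.∣n⇒∣m*n M z))))))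
    by-cases : Dec (p₁ ℕ∣.∣ M ℕ.* E.modulus) → Dec (p₂ ℕ∣.∣ M ℕ.* E.modulus) → P a b c p₁ ≡ P a b c p₂
    -- A prime dividing the modulus divides every prime in its class, so it is the only one there.
    by-cases (yes z) _ = cong (P a b c) (prime-∣-prime pr₁ pr₂ (∣-residue z d ℕ∣.∣-refl))
    by-cases _ (yes z) = cong (P a b c) (sym (prime-∣-prime pr₂ pr₁ (∣-residue z back ℕ∣.∣-refl)))
    by-cases (no h₁) (no h₂) = sign-mod16 (P-sign a b c p₁ pr₁ 3<p₁) (P-sign a b c p₂ pr₂ 3<p₂)
      (Mod16.≋-trans (value-at p₁ pr₁ 3<p₁ h₁) (Mod16.≋-trans
        (Mod16.≋-reflexive (cong (λ k → + 4 - + 2 * E.value k) (remainder-≡ {{E.nonZero}} (ℕ∣.n∣m*n M) d)))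
        (Mod16.≋-sym (value-at p₂ pr₂ 3<p₂ h₂))))

-- The common outcome for zero and nonzero discriminant. As `X` and `ε` depend on the residue of `p`
-- only and `ε` is a sign, `P` determines `S` on each residue class.
record Dependence (a b c : ℤ) : Set where
  field
    bad       : ℕ
    {{bad≢0}} : NonZero bad
    X ε       : Term
    relation  : ∀ p → DomS a b c p → ¬ p ℕ∣.∣ bad →
                IsSign (at ε p) × + 4 * P a b c p Mod16.≋ at X p + at ε p * + S a b c p

units : ∀ {p c σ} → ¬ + p ℤd.∣ c * σ → ¬ + p ∣ c × ¬ + p ∣ σ
units {p} {c} {σ} h = (λ d → h (∣⇒∣ᵤ (Signed.∣m⇒∣m*n σ d))) , (λ d → h (∣⇒∣ᵤ (Signed.∣n⇒∣m*n c d)))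

dependence : ∀ a b c → ¬ c * sigma a b c ≡ + 0 → Dependence a b c
dependence a b c cσ≢0 = by-cases (disc a b c ℤₚ.≟ + 0)
  where
  σ Δ A K : ℤ
  σ = sigma a b c
  Δ = disc a b c
  A = b + + 2 * c
  K = + 4 * c
  by-cases : Dec (Δ ≡ + 0) → Dependence a b c
  by-cases (no Δ≢0) = record
    { bad = ℤ.∣ Δ ∣ ; bad≢0 = ℤ.≢-nonZero Δ≢0 ; X = quadraticTerm c A σ Δ ; ε = signTerm c σ
    ; relation = λ p dom p∤ → odd-prime Q local p (proj₁ dom) (proj₁ (proj₂ dom)) (proj₂ (proj₂ dom)) p∤ }
    where
    Q : ℕ → Set
    Q p = ¬ + p ℤd.∣ c * σ → ¬ p ℕ∣.∣ ℤ.∣ Δ ∣ →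
      IsSign (at (signTerm c σ) p) × + 4 * P a b c p Mod16.≋ at (quadraticTerm c A σ Δ) p + at (signTerm c σ) p * + S a b c p
    local : ∀ n → 1 ℕ.< n → Prime (suc (n ℕ.+ n)) → Q (suc (n ℕ.+ n))
    local n 1<n pr p∤cσ p∤Δ =
        subst IsSign (sym (at-⟦⟧ (signTerm c σ))) (sign-* (κ-sign n) (χ-sign (neg-≢0 (*-≢0 hc hσ))))
      , subst₂ (λ x e → + 4 * P a b c p Mod16.≋ x + e * + S a b c p) (sym (at-⟦⟧ (quadraticTerm c A σ Δ))) (sym (at-⟦⟧ (signTerm c σ)))
          (P-quadratic a b c hc hσ (λ e → p∤Δ (∣⇒∣ᵤ (≋0⇒∣ e))))
      where
      open Assembly n 1<n pr hiding (A)
      hc : ¬ c ≋ + 0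
      hc e = proj₁ (units {σ = σ} p∤cσ) (≋0⇒∣ e)
      hσ : ¬ σ ≋ + 0
      hσ e = proj₂ (units {c = c} p∤cσ) (≋0⇒∣ e)
  by-cases (yes Δ≡0) = record
    { bad = badPrimes K (K * A) (K * (+ 2 * c)) A (+ 2 * c) ; bad≢0 = badPrimes-nonZero K (K * A) (K * (+ 2 * c)) A (+ 2 * c)
    -- Here `4 P ≡ 4 - 2 t` and `S ≡ -1`; writing 4 as `5 + S` gives the relation with `ε = 1`.
    ; X = con (+ 5) ⊝ con (+ 2) ⊗ t ; ε = con (+ 1)
    ; relation = λ p dom p∤ → pos , Mod16.≋-trans (P-factored a b c K (K * A) (K * (+ 2 * c)) A (+ 2 * c) K≢0 factors p (proj₁ dom) (proj₁ (proj₂ dom)) p∤)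
        (Mod16.by (degenerate p dom) (- + 1) (lemma (at t p) (+ S a b c p))) }
    where
    t : Term
    t = productTerm (K * A) (K * (+ 2 * c)) A (+ 2 * c)
    c≢0 : ¬ c ≡ + 0
    c≢0 refl = cσ≢0 refl
    K≢0 : ¬ K ≡ + 0
    K≢0 e = [ (λ ()) , c≢0 ]′ (ℤₚ.i*j≡0⇒i≡0∨j≡0 (+ 4) e)
    lemma : ∀ t s → + 4 - + 2 * t - (+ 5 - + 2 * t + + 1 * s) ≡ - + 1 * (s - - + 1)
    lemma = solve-∀
    factors : ∀ v → K * K * form a b c (+ 1) (+ 1 + v) ≡ (K * A + K * (+ 2 * c) * v) * (A + + 2 * c * v)
    factors v = trans (expand a b c v) (trans (cong (λ z → (K * A + K * (+ 2 * c) * v) * (A + + 2 * c * v) - K * z) Δ≡0)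
      (vanish ((K * A + K * (+ 2 * c) * v) * (A + + 2 * c * v)) K))
      where
      expand : ∀ a b c v → + 4 * c * (+ 4 * c) * (a * + 1 * + 1 + b * + 1 * (+ 1 + v) + c * (+ 1 + v) * (+ 1 + v)) ≡
        (+ 4 * c * (b + + 2 * c) + + 4 * c * (+ 2 * c) * v) * ((b + + 2 * c) + + 2 * c * v) - + 4 * c * (b * b - + 4 * a * c)
      expand = solve-∀
      vanish : ∀ x k → x - k * + 0 ≡ x
      vanish = solve-∀
    degenerate : ∀ p → DomS a b c p → + S a b c p Mod16.≋ - + 1
    degenerate p (pr , 3<p , p∤) = odd-prime (λ p → ¬ + p ℤd.∣ c * σ → + S a b c p Mod16.≋ - + 1)
      (λ n 1<n pr p∤cσ → let open Assembly n 1<n pr in S-degenerate a b c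
        (λ e → proj₁ (units {σ = σ} p∤cσ) (≋0⇒∣ e)) (λ e → proj₂ (units {c = c} p∤cσ) (≋0⇒∣ e)) (≋-reflexive Δ≡0)) p pr 3<p p∤

-- `P` changes by -2 while `S` moves by 8 modulo 16: upwards from `s < 8`, which gives -1/4, and
-- downwards otherwise, which gives 1/4.
slope intercept : ℕ → ℚ
slope s = if s ℕ.<ᵇ 8 then -[1+ 0 ] ℚ./ 4 else + 1 ℚ./ 4
intercept s = ℚ.1ℚ ℚ.- slope s ℚ.* toℚ (+ s)

-- The line through (s , 1) and (s + 8 , -1), the second abscissa being reduced modulo 16.
line : ∀ (i : Fin 16) → slope (toℕ i) ≢ ℚ.0ℚ
  × toℚ (+ 1) ≡ slope (toℕ i) ℚ.* toℚ (+ toℕ i) ℚ.+ intercept (toℕ i)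
  × toℚ (- + 1) ≡ slope (toℕ i) ℚ.* toℚ (+ ((toℕ i ℕ.+ 8) ℕ.% 16)) ℚ.+ intercept (toℕ i)
line = toWitness {a? = Finₚ.all? (λ i → ¬? (slope (toℕ i) ℚₚ.≟ ℚ.0ℚ)
  ×-dec (toℚ (+ 1) ℚₚ.≟ slope (toℕ i) ℚ.* toℚ (+ toℕ i) ℚ.+ intercept (toℕ i))
  ×-dec (toℚ (- + 1) ℚₚ.≟ slope (toℕ i) ℚ.* toℚ (+ ((toℕ i ℕ.+ 8) ℕ.% 16)) ℚ.+ intercept (toℕ i)))} tt

S<16 : ∀ a b c p → S a b c p ℕ.< 16
S<16 a b c p = n%ℕd<d (sumℤ (map (λ y → legendre (+ y * (+ y + + 1) * (+ y + + kOf a b c p)) p) (map suc (upTo (p ℕ.∸ 1))))) 16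

P-S-equivalent : ∀ a b c → Equivalent (DomS a b c) (P a b c) (λ p → + S a b c p)
P-S-equivalent a b c = by-cases (c * sigma a b c ℤₚ.≟ + 0)
  where
  by-cases : Dec (c * sigma a b c ≡ + 0) → Equivalent (DomS a b c) (P a b c) (λ p → + S a b c p)
  -- Every prime divides `c σ = 0`, so the common domain is empty and any nonconstant line serves.
  by-cases (yes cσ≡0) = 1 , s≤s z≤n , λ r _ _ → ℚ.1ℚ , ℚ.0ℚ , (λ ()) , λ p dom _ →
    ⊥-elim (proj₂ (proj₂ dom) (subst (λ z → p ℕ∣.∣ ℤ.∣ z ∣) (sym cσ≡0) (p ℕ∣.∣0)))
  by-cases (no cσ≢0) = M , ℕ.>-nonZero⁻¹ M {{M≢0}} , λ r _ coprime → slope (s₊ r) , intercept (s₊ r) ,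
      proj₁ (line (i₊ r)) , λ p dom p≡r → on-line r p dom p≡r coprime
    where
    open Dependence (dependence a b c cσ≢0)
    module X = Explicit (explicit-term X)
    module ε = Explicit (explicit-term ε)
    instance
      X-modulus≢0 : NonZero X.modulus
      X-modulus≢0 = X.nonZero
      ε-modulus≢0 : NonZero ε.modulus
      ε-modulus≢0 = ε.nonZero
    M : ℕ
    M = bad ℕ.* (X.modulus ℕ.* ε.modulus)
    M≢0 : NonZero M
    M≢0 = ℕₚ.m*n≢0 bad _ {{bad≢0}} {{ℕₚ.m*n≢0 X.modulus ε.modulus {{X.nonZero}} {{ε.nonZero}}}}
    x e : ℕ → ℤ
    x r = X.value (r ℕ.% X.modulus)
    e r = ε.value (r ℕ.% ε.modulus)
    -- The value of `S` that belongs to `P = 1`: the solution of `4 = x + e S` modulo 16, where the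
    -- sign `e` is its own inverse.
    i₊ : ℕ → Fin 16
    i₊ r = Residues.red 16 (e r * (+ 4 - x r))
    s₊ : ℕ → ℕ
    s₊ r = toℕ (i₊ r)
    on-line : ∀ r p → DomS a b c p → + M ℤd.∣ (+ p - + r) → gcd r M ≡ 1 →
      toℚ (P a b c p) ≡ slope (s₊ r) ℚ.* toℚ (+ S a b c p) ℚ.+ intercept (s₊ r)
    on-line r p dom@(pr , 3<p , _) p≡r coprime = finish refl (P-sign a b c p pr 3<p)
      where
      -- A prime dividing `M` would also divide `r`, against `gcd r M ≡ 1`; so all exceptional
      -- primes lie outside the classes considered.
      p∤M : ¬ p ℕ∣.∣ M
      p∤M d = ℕ.nonTrivial⇒≢1 {{prime⇒nonTrivial pr}} (ℕ∣.∣1⇒≡1 (subst (p ℕ∣.∣_) coprime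
        (gcd-greatest (∣-residue {p = p} {r} d p≡r ℕ∣.∣-refl) d)))
      X≋ : at X p Mod16.≋ x r
      X≋ = subst (λ k → at X p Mod16.≋ X.value k) (remainder-≡ {{X.nonZero}} (ℕ∣.∣n⇒∣m*n bad (ℕ∣.m∣m*n ε.modulus)) p≡r)
        (X.agrees p pr 3<p (λ d → p∤M (ℕ∣.∣n⇒∣m*n bad (ℕ∣.∣m⇒∣m*n ε.modulus d))))
      ε≋ : at ε p Mod16.≋ e r
      ε≋ = subst (λ k → at ε p Mod16.≋ ε.value k) (remainder-≡ {{ε.nonZero}} (ℕ∣.∣n⇒∣m*n bad (ℕ∣.n∣m*n X.modulus)) p≡r)
        (ε.agrees p pr 3<p (λ d → p∤M (ℕ∣.∣n⇒∣m*n bad (ℕ∣.∣n⇒∣m*n X.modulus d))))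
      relation′ : IsSign (at ε p) × + 4 * P a b c p Mod16.≋ at X p + at ε p * + S a b c p
      relation′ = relation p dom (λ d → p∤M (ℕ∣.∣m⇒∣m*n (X.modulus ℕ.* ε.modulus) d))
      solved : ∀ {y} → P a b c p ≡ y → + S a b c p Mod16.≋ at ε p * (+ 4 * y - at X p)
      solved {y} refl = Mod16.≋-trans (Mod16.≋-reflexive (trans (sym (ℤₚ.*-identityˡ (+ S a b c p)))
          (cong (_* + S a b c p) (sym (sign-square (proj₁ relation′))))))
        (Mod16.by (proj₂ relation′) (- at ε p) (lemma (at ε p) (+ S a b c p) (+ 4 * y) (at X p)))
        where
        lemma : ∀ e s y x → e * e * s - e * (y - x) ≡ - e * (y - (x + e * s))
        lemma = solve-∀
      base : + s₊ r Mod16.≋ at ε p * (+ 4 * + 1 - at X p)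
      base = Mod16.≋-trans (Residues.rep-red 16 (e r * (+ 4 - x r)))
        (Mod16.*-cong (Mod16.≋-sym ε≋) (Mod16.+-congˡ (+ 4) (Mod16.neg-cong (Mod16.≋-sym X≋))))
      -- Replacing `P = 1` by `P = -1` changes `S` by `- 8 e`, and this is 8 modulo 16 for either
      -- sign `e`.
      shifted : ∀ {e} → IsSign e → ∀ x → e * (+ 4 * - + 1 - x) Mod16.≋ e * (+ 4 * + 1 - x) + + 8
      shifted pos x = Mod16.mod (divides (- + 1) (lemma x))
        where
        lemma : ∀ x → + 1 * (+ 4 * - + 1 - x) - (+ 1 * (+ 4 * + 1 - x) + + 8) ≡ - + 1 * + 16
        lemma = solve-∀
      shifted neg x = Mod16.≋-reflexive (lemma x)
        where
        lemma : ∀ x → - + 1 * (+ 4 * - + 1 - x) ≡ - + 1 * (+ 4 * + 1 - x) + + 8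
        lemma = solve-∀
      finish : ∀ {y} → P a b c p ≡ y → IsSign y → toℚ (P a b c p) ≡ slope (s₊ r) ℚ.* toℚ (+ S a b c p) ℚ.+ intercept (s₊ r)
      finish P≡1 pos = trans (cong toℚ P≡1) (trans (proj₁ (proj₂ (line (i₊ r))))
        (cong (λ s → slope (s₊ r) ℚ.* toℚ (+ s) ℚ.+ intercept (s₊ r))
          (Residues.≋⇒≡ 16 (Finₚ.toℕ<n (i₊ r)) (S<16 a b c p) (Mod16.≋-trans base (Mod16.≋-sym (solved P≡1))))))
      finish P≡-1 neg = trans (cong toℚ P≡-1) (trans (proj₂ (proj₂ (line (i₊ r))))
        (cong (λ s → slope (s₊ r) ℚ.* toℚ (+ s) ℚ.+ intercept (s₊ r))
          (Residues.≋⇒≡ 16 (ℕD.m%n<n (s₊ r ℕ.+ 8) 16) (S<16 a b c p) (Mod16.≋-trans (Residues.%-≋ 16 (+ (s₊ r ℕ.+ 8)))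
            (Mod16.≋-trans (Mod16.+-congʳ (+ 8) base) (Mod16.≋-sym (Mod16.≋-trans (solved P≡-1) (shifted (proj₁ relation′) (at X p)))))))))

theorem2p3 : (a b c : ℤ) →
    Equivalent (DomS a b c) (P a b c) (λ p → + (S a b c p))
    × ((m n u v : ℤ) →
    (∀ i j → form a b c i j ≡ (m * i + n * j) * (u * i + v * j)) →
    Periodic DomP (P a b c))
theorem2p3 a b c = P-S-equivalent a b c , P-periodic a b c
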